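{- For every constant $c > 0$ there exists a constant $K = K(c) > 0$ such that for all positive integers $k$ and $\ell$ with $\ell \le \binom{k}{2}$ and $\min\{\ell,\, k^2/2 - \ell\} \ge c k^2$ we have $$\mathrm{ind}(k,\ell) \le K k^{ -0.1}.$$
   Context: All graphs are finite and simple. For a positive integer $k$ and a graph $G$ with at least $k$ vertices, let $A = A_{G,k}$ be chosen uniformly at random from all $k$-element subsets of $V(G)$, and let $X_{G,k} = e(G[A])$ be the number of edges of $G$ with both endpoints in $A$. For integers $n \ge k$ and $0 \le \ell \le \binom{k}{2}$ let $I(n,k,\ell) = \max\{\mathbb{P}(X_{G,k} = \ell) : G \text{ is a graph on } n \text{ vertices}\}$. For fixed $k,\ell$ the sequence $I(n,k,\ell)$ is non-increasing in $n$, and the edge-inducibility is defined by $\mathrm{ind}(k,\ell) := \lim_{n\to\infty} I(n,k,\ell)$. -}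

module Defs where

open import Data.Bool.Base using (Bool; true; false; T)
open import Data.Bool.Properties using (T?)
open import Data.Fin.Base as Fin using (Fin; zero; suc)
import Data.Fin.Properties as Fin
open import Data.Fin.Subset using (Subset; _∈_; ∣_∣)
open import Data.Fin.Subset.Properties using (_∈?_)
open import Data.Integer.Base as ℤ using (+_)
import Data.Integer.Properties as ℤ
open import Data.List.Base
  using (List; []; _∷_; [_]; _++_; map; filter; length; allFin; cartesianProduct; cartesianProductWith)
import Data.List.Extrema
open import Data.List.Membership.Propositional renaming (_∈_ to _∈ᴸ_)
open import Data.List.Membership.Propositional.Properties
  using (∈-map⁺; ∈-map⁻; ∈-++⁺ˡ; ∈-++⁺ʳ; ∈-cartesianProductWith⁺)
open import Data.List.Properties using (filter-≐)
open import Data.List.Relation.Unary.All as All using ()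
open import Data.List.Relation.Unary.Any using (here; there)
open import Data.Nat.Base as ℕ using (ℕ; zero; suc)
import Data.Nat.Properties as ℕ
open import Data.Product.Base using (Σ-syntax; ∃-syntax; _×_; _,_; proj₁; proj₂)
open import Data.Rational.Base
  using (ℚ; mkℚ; *<*; ↧ₙ_; 0ℚ; 1ℚ; _/_; -_; _+_; _-_; _*_; _≤_; _<_; 1/_; NonZero; Positive; positive; nonNegative; toℚᵘ)
  renaming (∣_∣ to ∣_∣ᵠ)
import Data.Rational.Properties as ℚ
import Data.Rational.Solver as ℚ
import Data.Rational.Unnormalised.Base as ℚᵘ
import Data.Rational.Unnormalised.Properties as ℚᵘ
open import Data.Sum.Base using (inj₁; inj₂)
open import Data.Vec.Base using ([]; _∷_; lookup; tabulate)
open import Data.Vec.Properties using (lookup∘tabulate)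
open import Level using (0ℓ)
open import Relation.Binary.PropositionalEquality
  using (_≡_; refl; sym; trans; cong; subst; subst₂; module ≡-Reasoning)
open import Relation.Nullary using (yes; no)
open import Relation.Nullary.Decidable using (_×-dec_)
open import Relation.Binary.Bundles using (DecTotalOrder)
open import Relation.Unary using (Pred; Decidable)

record Graph (n : ℕ) : Set where
  field
    adj    : Fin n → Fin n → Bool
    symm   : ∀ i j → adj i j ≡ adj j i
    irrefl : ∀ i → adj i i ≡ false

open Graph public

IsEdgeIn : ∀ {n} → Graph n → Subset n → Pred (Fin n × Fin n) 0ℓ
IsEdgeIn G A (i , j) = i Fin.< j × i ∈ A × j ∈ A × T (adj G i j)

isEdgeIn? : ∀ {n} (G : Graph n) (A : Subset n) → Decidable (IsEdgeIn G A)
isEdgeIn? G A (i , j) =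
  (i Fin.<? j) ×-dec (i ∈? A) ×-dec (j ∈? A) ×-dec T? (adj G i j)

edges : ∀ {n} → Graph n → Subset n → ℕ
edges {n} G A =
  length (filter (isEdgeIn? G A) (cartesianProduct (allFin n) (allFin n)))

subsets : ∀ n → List (Subset n)
subsets zero    = [ [] ]
subsets (suc n) = map (true ∷_) (subsets n) ++ map (false ∷_) (subsets n)

kSubsets : ∀ n → ℕ → List (Subset n)
kSubsets n k = filter (λ A → ∣ A ∣ ℕ.≟ k) (subsets n)

-- The value 0 for a zero denominator is a convention; it only arises for
-- the empty list (that is, for kSubsets n k with n < k).
ratio : ℕ → ℕ → ℚ
ratio a zero    = 0ℚ
ratio a (suc b) = + a / suc b

-- Entries are weighted equally; it is used for duplicate-free lists only.
ℙ[_∣_] : ∀ {A : Set} {P : Pred A 0ℓ} → List A → Decidable P → ℚ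
ℙ[ xs ∣ P? ] = ratio (length (filter P? xs)) (length xs)

prob : ∀ {n} → Graph n → ℕ → ℕ → ℚ
prob {n} G k ℓ = ℙ[ kSubsets n k ∣ (λ A → edges G A ℕ.≟ ℓ) ]

emptyGraph : Graph 0
emptyGraph = record { adj = λ () ; symm = λ () ; irrefl = λ () }

-- N is the neighbourhood of the new vertex 0.
extend : ∀ {n} → Graph n → Subset n → Graph (suc n)
extend {n} G N = record { adj = a ; symm = s ; irrefl = r }
  where
  a : Fin (suc n) → Fin (suc n) → Bool
  a zero    zero    = false
  a zero    (suc j) = lookup N j
  a (suc i) zero    = lookup N i
  a (suc i) (suc j) = adj G i j
  s : ∀ i j → a i j ≡ a j i
  s zero    zero    = refl
  s zero    (suc j) = refl
  s (suc i) zero    = refl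
  s (suc i) (suc j) = symm G i j
  r : ∀ i → a i i ≡ false
  r zero    = refl
  r (suc i) = irrefl G i

allGraphs : ∀ n → List (Graph n)
allGraphs zero    = [ emptyGraph ]
allGraphs (suc n) = cartesianProductWith extend (allGraphs n) (subsets n)

open Data.List.Extrema (DecTotalOrder.totalOrder ℚ.≤-decTotalOrder) using (max; xs≤max; argmax-sel)

-- All probabilities are nonnegative, so the default value 0 of max is
-- harmless; prob≤I and I-attained show that this is the maximum over Graph n.
I : ℕ → ℕ → ℕ → ℚ
I n k ℓ = max 0ℚ (map (λ G → prob G k ℓ) (allGraphs n))

∈-subsets : ∀ {n} (A : Subset n) → A ∈ᴸ subsets n
∈-subsets []          = here refl
∈-subsets (true  ∷ A) = ∈-++⁺ˡ (∈-map⁺ (true ∷_) (∈-subsets A))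
∈-subsets (false ∷ A) = ∈-++⁺ʳ (map (true ∷_) (subsets _)) (∈-map⁺ (false ∷_) (∈-subsets A))

allGraphs-complete : ∀ {n} (G : Graph n) →
  ∃[ H ] (H ∈ᴸ allGraphs n × (∀ i j → adj G i j ≡ adj H i j))
allGraphs-complete {zero}  G = emptyGraph , here refl , λ ()
allGraphs-complete {suc n} G =
  extend H N , ∈-cartesianProductWith⁺ extend H∈ (∈-subsets N) , same
  where
  G′ : Graph n
  G′ = record { adj    = λ i j → adj G (suc i) (suc j)
              ; symm   = λ i j → symm G (suc i) (suc j)
              ; irrefl = λ i → irrefl G (suc i) }
  N = tabulate (λ j → adj G zero (suc j))
  H  = proj₁ (allGraphs-complete G′)
  H∈ = proj₁ (proj₂ (allGraphs-complete G′))
  same : ∀ i j → adj G i j ≡ adj (extend H N) i j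
  same zero    zero    = irrefl G zero
  same zero    (suc j) = sym (lookup∘tabulate _ j)
  same (suc i) zero    = trans (symm G (suc i) zero) (sym (lookup∘tabulate _ i))
  same (suc i) (suc j) = proj₂ (proj₂ (allGraphs-complete G′)) i j

edges-cong : ∀ {n} {G H : Graph n} → (∀ i j → adj G i j ≡ adj H i j) →
             ∀ A → edges G A ≡ edges H A
edges-cong {n} {G} {H} eq A = cong length
  (filter-≐ (isEdgeIn? G A) (isEdgeIn? H A)
    ( (λ (p , q , r , t) → p , q , r , subst T (eq _ _) t)
    , (λ (p , q , r , t) → p , q , r , subst T (sym (eq _ _)) t))
    (cartesianProduct (allFin n) (allFin n)))

prob-cong : ∀ {n} {G H : Graph n} → (∀ i j → adj G i j ≡ adj H i j) →
            ∀ k ℓ → prob G k ℓ ≡ prob H k ℓ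
prob-cong {n} {G} {H} eq k ℓ = cong (λ xs → ratio (length xs) (length (kSubsets n k)))
  (filter-≐ (λ A → edges G A ℕ.≟ ℓ) (λ A → edges H A ℕ.≟ ℓ)
    ( (λ e → trans (sym (edges-cong {G = G} {H} eq _)) e)
    , (λ e → trans (edges-cong {G = G} {H} eq _) e))
    (kSubsets n k))

prob≤I : ∀ {n} (G : Graph n) k ℓ → prob G k ℓ ≤ I n k ℓ
prob≤I G k ℓ with H , H∈ , eq ← allGraphs-complete G =
  subst (_≤ _) (sym (prob-cong {G = G} {H} eq k ℓ))
    (All.lookup (xs≤max 0ℚ _) (∈-map⁺ (λ G → prob G k ℓ) H∈))

ratio-nonNeg : ∀ a b → 0ℚ ≤ ratio a b
ratio-nonNeg a zero    = ℚ.≤-refl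
ratio-nonNeg a (suc b) = ℚ.nonNegative⁻¹ _ {{ℚ.normalize-nonNeg a (suc b)}}

I-attained : ∀ n k ℓ → Σ[ G ∈ Graph n ] prob G k ℓ ≡ I n k ℓ
I-attained n k ℓ with argmax-sel (λ p → p) 0ℚ (map (λ G → prob G k ℓ) (allGraphs n))
... | inj₁ I≡0 = edgeless , ℚ.≤-antisym (prob≤I edgeless k ℓ)
                   (subst (_≤ prob edgeless k ℓ) (sym I≡0) (ratio-nonNeg _ (length (kSubsets n k))))
  where
  edgeless : Graph n
  edgeless = record { adj = λ _ _ → false ; symm = λ _ _ → refl ; irrefl = λ _ → refl }
... | inj₂ I∈ with G , _ , eq ← ∈-map⁻ (λ G → prob G k ℓ) I∈ = G , sym eq

IsCauchy : (ℕ → ℚ) → Set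
IsCauchy x = ∀ ε → 0ℚ < ε →
  ∃[ N ] ∀ m n → N ℕ.≤ m → N ℕ.≤ n → ∣ x m - x n ∣ᵠ < ε

-- Equality of reals is not _≡_ but mutual _≤ℝ_.
record ℝ : Set where
  constructor mkℝ
  field
    seq    : ℕ → ℚ
    cauchy : IsCauchy seq

open ℝ public

infix  4 _≤ℝ_ _<ℝ_ _⟶_
infixl 6 _+ℝ_
infixl 7 _*ℝ_

_≤ℝ_ : ℝ → ℝ → Set
x ≤ℝ y = ∀ ε → 0ℚ < ε → ∃[ N ] ∀ n → N ℕ.≤ n → seq x n ≤ seq y n + ε

_<ℝ_ : ℝ → ℝ → Set
x <ℝ y = ∃[ δ ] (0ℚ < δ × ∃[ N ] ∀ n → N ℕ.≤ n → seq x n + δ ≤ seq y n)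

fromℚ : ℚ → ℝ
fromℚ p = mkℝ (λ _ → p) λ ε 0<ε → 0 , λ _ _ _ _ →
  subst (_< ε) (sym (cong ∣_∣ᵠ (ℚ.+-inverseʳ p))) 0<ε

0ℝ : ℝ
0ℝ = fromℚ 0ℚ

private
  ½ : ℚ
  ½ = + 1 / 2

  half-pos : ∀ {ε} → 0ℚ < ε → 0ℚ < ½ * ε
  half-pos 0<ε = ℚ.*-monoʳ-<-pos ½ 0<ε

  half+half : ∀ ε → ½ * ε + ½ * ε ≡ ε
  half+half = solve 1 (λ e → con ½ :* e :+ con ½ :* e := e) refl
    where open ℚ.+-*-Solver

_+ℝ_ : ℝ → ℝ → ℝ
x +ℝ y = mkℝ (λ n → seq x n + seq y n) λ ε 0<ε →
  let N₁ , c₁ = cauchy x (½ * ε) (half-pos 0<ε)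
      N₂ , c₂ = cauchy y (½ * ε) (half-pos 0<ε)
  in N₁ ℕ.⊔ N₂ , λ m n N≤m N≤n →
    let open ℚ.≤-Reasoning in begin-strict
    ∣ (seq x m + seq y m) - (seq x n + seq y n) ∣ᵠ
      ≡⟨ cong ∣_∣ᵠ (rearrange (seq x m) (seq y m) (seq x n) (seq y n)) ⟩
    ∣ (seq x m - seq x n) + (seq y m - seq y n) ∣ᵠ
      ≤⟨ ℚ.∣p+q∣≤∣p∣+∣q∣ (seq x m - seq x n) (seq y m - seq y n) ⟩
    ∣ seq x m - seq x n ∣ᵠ + ∣ seq y m - seq y n ∣ᵠ
      <⟨ ℚ.+-mono-<
           (c₁ m n (ℕ.m⊔n≤o⇒m≤o N₁ N₂ N≤m) (ℕ.m⊔n≤o⇒m≤o N₁ N₂ N≤n))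
           (c₂ m n (ℕ.m⊔n≤o⇒n≤o N₁ N₂ N≤m) (ℕ.m⊔n≤o⇒n≤o N₁ N₂ N≤n)) ⟩
    ½ * ε + ½ * ε
      ≡⟨ half+half ε ⟩
    ε ∎
  where
  rearrange : ∀ a b c d → (a + b) - (c + d) ≡ (a - c) + (b - d)
  rearrange = solve 4 (λ a b c d → (a :+ b) :- (c :+ d) := (a :- c) :+ (b :- d)) refl
    where open ℚ.+-*-Solver

private
  eventuallyBounded : (x : ℝ) →
    ∃[ N ] ∃[ B ] (0ℚ < B × ∀ n → N ℕ.≤ n → ∣ seq x n ∣ᵠ ≤ B)
  eventuallyBounded x with N , c ← cauchy x 1ℚ (ℚ.positive⁻¹ 1ℚ) =
    N , 1ℚ + ∣ seq x N ∣ᵠ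
      , ℚ.+-mono-<-≤ (ℚ.positive⁻¹ 1ℚ) (ℚ.0≤∣p∣ (seq x N))
      , λ n N≤n → let open ℚ.≤-Reasoning in begin
        ∣ seq x n ∣ᵠ                          ≡⟨ cong ∣_∣ᵠ (split (seq x n) (seq x N)) ⟩
        ∣ (seq x n - seq x N) + seq x N ∣ᵠ    ≤⟨ ℚ.∣p+q∣≤∣p∣+∣q∣ (seq x n - seq x N) (seq x N) ⟩
        ∣ seq x n - seq x N ∣ᵠ + ∣ seq x N ∣ᵠ ≤⟨ ℚ.+-monoˡ-≤ ∣ seq x N ∣ᵠ (ℚ.<⇒≤ (c n N N≤n ℕ.≤-refl)) ⟩
        1ℚ + ∣ seq x N ∣ᵠ ∎
    where
    split : ∀ a b → a ≡ (a - b) + b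
    split = solve 2 (λ a b → a := (a :- b) :+ b) refl
      where open ℚ.+-*-Solver

  rescale : ∀ C ε → 0ℚ < C → 0ℚ < ε → ∃[ δ ] (0ℚ < δ × C * δ ≡ ε)
  rescale C ε 0<C 0<ε = C⁻¹ * ε
    , subst (_< C⁻¹ * ε) (ℚ.*-zeroʳ C⁻¹) (ℚ.*-monoʳ-<-pos C⁻¹ {{ℚ.1/pos⇒pos C {{C-pos}}}} 0<ε)
    , (begin
        C * (C⁻¹ * ε) ≡⟨ ℚ.*-assoc C C⁻¹ ε ⟨
        (C * C⁻¹) * ε ≡⟨ cong (_* ε) (ℚ.*-inverseʳ C {{C-nz}}) ⟩
        1ℚ * ε        ≡⟨ ℚ.*-identityˡ ε ⟩
        ε             ∎)
    where
    open ≡-Reasoning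
    C-pos : Positive C
    C-pos = positive 0<C
    C-nz : NonZero C
    C-nz = ℚ.pos⇒nonZero C {{C-pos}}
    C⁻¹ : ℚ
    C⁻¹ = (1/ C) {{C-nz}}

  product-close : ∀ a b c d A B δ → 0ℚ < A → 0ℚ < B →
    ∣ a ∣ᵠ ≤ A → ∣ d ∣ᵠ ≤ B → ∣ a - c ∣ᵠ < δ → ∣ b - d ∣ᵠ < δ →
    ∣ a * b - c * d ∣ᵠ < (A + B) * δ
  product-close a b c d A B δ 0<A 0<B a≤A d≤B ac<δ bd<δ = begin-strict
    ∣ a * b - c * d ∣ᵠ                          ≡⟨ cong ∣_∣ᵠ (rearrange a b c d) ⟩
    ∣ a * (b - d) + d * (a - c) ∣ᵠ              ≤⟨ ℚ.∣p+q∣≤∣p∣+∣q∣ (a * (b - d)) (d * (a - c)) ⟩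
    ∣ a * (b - d) ∣ᵠ + ∣ d * (a - c) ∣ᵠ         <⟨ ℚ.+-mono-< (small a (b - d) A 0<A a≤A bd<δ)
                                                              (small d (a - c) B 0<B d≤B ac<δ) ⟩
    A * δ + B * δ                               ≡⟨ ℚ.*-distribʳ-+ δ A B ⟨
    (A + B) * δ                                 ∎
    where
    open ℚ.≤-Reasoning
    small : ∀ p q D → 0ℚ < D → ∣ p ∣ᵠ ≤ D → ∣ q ∣ᵠ < δ → ∣ p * q ∣ᵠ < D * δ
    small p q D 0<D p≤D q<δ = begin-strict
      ∣ p * q ∣ᵠ      ≡⟨ ℚ.∣p*q∣≡∣p∣*∣q∣ p q ⟩
      ∣ p ∣ᵠ * ∣ q ∣ᵠ ≤⟨ ℚ.*-monoʳ-≤-nonNeg ∣ q ∣ᵠ {{nonNegative (ℚ.0≤∣p∣ q)}} p≤D ⟩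
      D * ∣ q ∣ᵠ      <⟨ ℚ.*-monoʳ-<-pos D {{positive 0<D}} q<δ ⟩
      D * δ           ∎
    rearrange : ∀ a b c d → a * b - c * d ≡ a * (b - d) + d * (a - c)
    rearrange = solve 4 (λ a b c d → a :* b :- c :* d := a :* (b :- d) :+ d :* (a :- c)) refl
      where open ℚ.+-*-Solver

  *-cauchy : ∀ x y → IsCauchy (λ n → seq x n * seq y n)
  *-cauchy x y ε 0<ε =
    let N₁ , A , 0<A , x≤A = eventuallyBounded x
        N₂ , B , 0<B , y≤B = eventuallyBounded y
        δ , 0<δ , eq       = rescale (A + B) ε (ℚ.+-mono-< 0<A 0<B) 0<ε
        N₃ , cx            = cauchy x δ 0<δ
        N₄ , cy            = cauchy y δ 0<δ
        M₁ = N₁ ℕ.⊔ N₂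
        M₂ = N₃ ℕ.⊔ N₄
    in M₁ ℕ.⊔ M₂ , λ m n N≤m N≤n →
      let M₁≤m = ℕ.m⊔n≤o⇒m≤o M₁ M₂ N≤m
          M₂≤m = ℕ.m⊔n≤o⇒n≤o M₁ M₂ N≤m
          M₁≤n = ℕ.m⊔n≤o⇒m≤o M₁ M₂ N≤n
          M₂≤n = ℕ.m⊔n≤o⇒n≤o M₁ M₂ N≤n
      in subst (∣ seq x m * seq y m - seq x n * seq y n ∣ᵠ <_) eq
           (product-close (seq x m) (seq y m) (seq x n) (seq y n) A B δ 0<A 0<B
             (x≤A m (ℕ.m⊔n≤o⇒m≤o N₁ N₂ M₁≤m))
             (y≤B n (ℕ.m⊔n≤o⇒n≤o N₁ N₂ M₁≤n))
             (cx m n (ℕ.m⊔n≤o⇒m≤o N₃ N₄ M₂≤m) (ℕ.m⊔n≤o⇒m≤o N₃ N₄ M₂≤n))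
             (cy m n (ℕ.m⊔n≤o⇒n≤o N₃ N₄ M₂≤m) (ℕ.m⊔n≤o⇒n≤o N₃ N₄ M₂≤n)))

_*ℝ_ : ℝ → ℝ → ℝ
x *ℝ y = mkℝ (λ n → seq x n * seq y n) (*-cauchy x y)

-- Convergence: ∣ a n − L ∣ ≤ ε for all large n, with the absolute value
-- written out as two inequalities.
_⟶_ : (ℕ → ℝ) → ℝ → Set
a ⟶ L = ∀ ε → 0ℚ < ε → ∃[ N ] ∀ n → N ℕ.≤ n →
  a n ≤ℝ L +ℝ fromℚ ε × L ≤ℝ a n +ℝ fromℚ ε

-- L = ind(k,ℓ). The terms with n < k are the conventional value 0 and do
-- not influence the limit.
_IsIndOf_ : ℝ → ℕ × ℕ → Set
L IsIndOf (k , ℓ) = (λ n → fromℚ (I n k ℓ)) ⟶ L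

-- The real number k^(-1/d): its m-th approximation is J/(m+1), where J is
-- the largest j with j^d · k ≤ (m+1)^d, that is j/(m+1) ≤ k^(-1/d).

module InverseRoot (k d : ℕ) .{{_ : ℕ.NonZero k}} .{{_ : ℕ.NonZero d}} where

  search : (M b : ℕ) → ℕ
  search M zero    = zero
  search M (suc b) with (suc b ℕ.^ d) ℕ.* k ℕ.≤? M ℕ.^ d
  ... | yes _ = suc b
  ... | no  _ = search M b

  -- Since k ≥ 1, no j > M qualifies, so searching downwards from M suffices.
  J : ℕ → ℕ
  J M = search M M

  approx : ℕ → ℚ
  approx m = + J (suc m) / suc m

  private
    search-lower : ∀ M b → (search M b ℕ.^ d) ℕ.* k ℕ.≤ M ℕ.^ d
    search-lower M zero = subst (ℕ._≤ M ℕ.^ d) (sym (cong (ℕ._* k) 0^d)) ℕ.z≤n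
      where
      0^d : 0 ℕ.^ d ≡ 0
      0^d = trans (cong (0 ℕ.^_) (sym (ℕ.suc-pred d))) refl
    search-lower M (suc b) with (suc b ℕ.^ d) ℕ.* k ℕ.≤? M ℕ.^ d
    ... | yes p = p
    ... | no  _ = search-lower M b

    search-upper : ∀ M b → M ℕ.^ d ℕ.< (suc b ℕ.^ d) ℕ.* k →
                   M ℕ.^ d ℕ.< (suc (search M b) ℕ.^ d) ℕ.* k
    search-upper M zero    h = h
    search-upper M (suc b) h with (suc b ℕ.^ d) ℕ.* k ℕ.≤? M ℕ.^ d
    ... | yes _ = h
    ... | no ¬p = search-upper M b (ℕ.≰⇒> ¬p)

  J-lower : ∀ M → (J M ℕ.^ d) ℕ.* k ℕ.≤ M ℕ.^ d
  J-lower M = search-lower M M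

  J-upper : ∀ M → M ℕ.^ d ℕ.< (suc (J M) ℕ.^ d) ℕ.* k
  J-upper M = search-upper M M
    (ℕ.<-≤-trans (ℕ.^-monoˡ-< d (ℕ.n<1+n M)) (ℕ.m≤m*n (suc M ℕ.^ d) k))

  private
    pow-* : ∀ a b e → (a ℕ.* b) ℕ.^ e ≡ a ℕ.^ e ℕ.* b ℕ.^ e
    pow-* a b zero    = refl
    pow-* a b (suc e) = begin
      a ℕ.* b ℕ.* (a ℕ.* b) ℕ.^ e           ≡⟨ cong (a ℕ.* b ℕ.*_) (pow-* a b e) ⟩
      a ℕ.* b ℕ.* (a ℕ.^ e ℕ.* b ℕ.^ e)     ≡⟨ ℕ.[m*n]*[o*p]≡[m*o]*[n*p] a b (a ℕ.^ e) (b ℕ.^ e) ⟩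
      a ℕ.* a ℕ.^ e ℕ.* (b ℕ.* b ℕ.^ e)     ∎
      where open ≡-Reasoning

    swap : ∀ a b c → a ℕ.* b ℕ.* c ≡ a ℕ.* c ℕ.* b
    swap a b c = trans (ℕ.*-assoc a b c) (trans (cong (a ℕ.*_) (ℕ.*-comm b c)) (sym (ℕ.*-assoc a c b)))

    cross : ∀ M .{{_ : ℕ.NonZero M}} N → J M ℕ.* N ℕ.< suc (J N) ℕ.* M
    cross M N = ℕ.≰⇒> λ h → ℕ.<-irrefl refl (contra h)
      where
      contra : suc (J N) ℕ.* M ℕ.≤ J M ℕ.* N → N ℕ.^ d ℕ.* M ℕ.^ d ℕ.< N ℕ.^ d ℕ.* M ℕ.^ d
      contra h = begin-strict
        N ℕ.^ d ℕ.* M ℕ.^ d                   <⟨ ℕ.*-monoˡ-< (M ℕ.^ d) {{ℕ.m^n≢0 M d}} (J-upper N) ⟩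
        suc (J N) ℕ.^ d ℕ.* k ℕ.* M ℕ.^ d     ≡⟨ swap (suc (J N) ℕ.^ d) k (M ℕ.^ d) ⟩
        suc (J N) ℕ.^ d ℕ.* M ℕ.^ d ℕ.* k     ≡⟨ cong (ℕ._* k) (pow-* (suc (J N)) M d) ⟨
        (suc (J N) ℕ.* M) ℕ.^ d ℕ.* k         ≤⟨ ℕ.*-monoˡ-≤ k (ℕ.^-monoˡ-≤ d h) ⟩
        (J M ℕ.* N) ℕ.^ d ℕ.* k               ≡⟨ cong (ℕ._* k) (pow-* (J M) N d) ⟩
        J M ℕ.^ d ℕ.* N ℕ.^ d ℕ.* k           ≡⟨ swap (J M ℕ.^ d) (N ℕ.^ d) k ⟩
        J M ℕ.^ d ℕ.* k ℕ.* N ℕ.^ d           ≤⟨ ℕ.*-monoˡ-≤ (N ℕ.^ d) (J-lower M) ⟩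
        M ℕ.^ d ℕ.* N ℕ.^ d                   ≡⟨ ℕ.*-comm (M ℕ.^ d) (N ℕ.^ d) ⟩
        N ℕ.^ d ℕ.* M ℕ.^ d                   ∎
        where open ℕ.≤-Reasoning

    toℚᵘ-/ : ∀ a b → toℚᵘ (+ a / suc b) ℚᵘ.≃ ℚᵘ.mkℚᵘ (+ a) b
    toℚᵘ-/ a b = ℚ.toℚᵘ-fromℚᵘ (ℚᵘ.mkℚᵘ (+ a) b)

    /-mono-< : ∀ a b c e → a ℕ.* suc e ℕ.< c ℕ.* suc b → + a / suc b < + c / suc e
    /-mono-< a b c e h = ℚ.toℚᵘ-cancel-<
      (ℚᵘ.<-respˡ-≃ (ℚᵘ.≃-sym (toℚᵘ-/ a b))
        (ℚᵘ.<-respʳ-≃ (ℚᵘ.≃-sym (toℚᵘ-/ c e))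
          (ℚᵘ.*<* (subst₂ ℤ._<_ (ℤ.pos-* a (suc e)) (ℤ.pos-* c (suc b)) (ℤ.+<+ h)))))

    suc-/ : ∀ a b → + suc a / suc b ≡ + 1 / suc b + + a / suc b
    suc-/ a b = ℚ.toℚᵘ-injective (begin-equality
      toℚᵘ (+ suc a / suc b)                     ≃⟨ toℚᵘ-/ (suc a) b ⟩
      ℚᵘ.mkℚᵘ (+ suc a) b                        ≃⟨ ℚᵘ.*≡* eq ⟩
      ℚᵘ.mkℚᵘ (+ 1) b ℚᵘ.+ ℚᵘ.mkℚᵘ (+ a) b       ≃⟨ ℚᵘ.+-cong (toℚᵘ-/ 1 b) (toℚᵘ-/ a b) ⟨
      toℚᵘ (+ 1 / suc b) ℚᵘ.+ toℚᵘ (+ a / suc b) ≃⟨ ℚ.toℚᵘ-homo-+ (+ 1 / suc b) (+ a / suc b) ⟨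
      toℚᵘ (+ 1 / suc b + + a / suc b)           ∎)
      where
      open ℚᵘ.≤-Reasoning
      B = + suc b
      eq : + suc a ℤ.* (+ (suc b ℕ.* suc b)) ≡ ((+ 1) ℤ.* B ℤ.+ + a ℤ.* B) ℤ.* B
      eq = trans (cong (+ suc a ℤ.*_) (ℤ.pos-* (suc b) (suc b)))
             (trans (sym (ℤ.*-assoc (+ suc a) B B))
               (cong (ℤ._* B) (ℤ.*-distribʳ-+ B (+ 1) (+ a))))

    1/-small : ∀ ε → 0ℚ < ε → ∀ n → ↧ₙ ε ℕ.≤ n → + 1 / suc n < ε
    1/-small ε@(mkℚ ℤ.+[1+ p ] q _) 0<ε n q≤n = subst (+ 1 / suc n <_) (ℚ.↥p/↧p≡p ε)
      (/-mono-< 1 n (suc p) q (ℕ.<-≤-trans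
        (subst (ℕ._< suc n) (sym (ℕ.*-identityˡ (suc q))) (ℕ.s≤s q≤n))
        (ℕ.m≤n*m (suc n) (suc p))))
    1/-small (mkℚ ℤ.+0 _ _) (*<* (ℤ.+<+ ()))
    1/-small (mkℚ ℤ.-[1+ _ ] _ _) (*<* ())

    approx-close : ∀ ε → 0ℚ < ε → ∀ m n → ↧ₙ ε ℕ.≤ n → approx m - approx n < ε
    approx-close ε 0<ε m n N≤n = begin-strict
      approx m - approx n                   <⟨ ℚ.+-monoˡ-< (- approx n)
                                                 (/-mono-< (J (suc m)) m (suc (J (suc n))) n (cross (suc m) (suc n))) ⟩
      + suc (J (suc n)) / suc n - approx n  ≡⟨ cong (_- approx n) (suc-/ (J (suc n)) n) ⟩
      + 1 / suc n + approx n - approx n     ≡⟨ cancel (+ 1 / suc n) (approx n) ⟩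
      + 1 / suc n                           <⟨ 1/-small ε 0<ε n N≤n ⟩
      ε                                     ∎
      where
      open ℚ.≤-Reasoning
      cancel : ∀ a b → a + b - b ≡ a
      cancel = solve 2 (λ a b → a :+ b :- b := a) refl
        where open ℚ.+-*-Solver

    abs-< : ∀ a b ε → a - b < ε → b - a < ε → ∣ a - b ∣ᵠ < ε
    abs-< a b ε a-b<ε b-a<ε with ℚ.∣p∣≡p∨∣p∣≡-p (a - b)
    ... | inj₁ eq = subst (_< ε) (sym eq) a-b<ε
    ... | inj₂ eq = subst (_< ε) (trans (neg-minus a b) (sym eq)) b-a<ε
      where
      neg-minus : ∀ a b → b - a ≡ - (a - b)
      neg-minus = solve 2 (λ a b → b :- a := :- (a :- b)) refl
        where open ℚ.+-*-Solver

    approx-cauchy : IsCauchy approx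
    approx-cauchy ε 0<ε = ↧ₙ ε , λ m n N≤m N≤n →
      abs-< (approx m) (approx n) ε (approx-close ε 0<ε m n N≤n) (approx-close ε 0<ε n m N≤m)

  value : ℝ
  value = mkℝ approx approx-cauchy

infix 8 _^-1/_

_^-1/_ : (k d : ℕ) .{{_ : ℕ.NonZero k}} .{{_ : ℕ.NonZero d}} → ℝ
k ^-1/ d = InverseRoot.value k d

{-# OPTIONS --safe #-}
module Submission where

open import Defs
open import Algebra.Bundles using (CommutativeRing)
import Algebra.Properties.Semiring.Sum as Sum
open import Data.Bool.Base using (Bool; true; false; not; _∧_; _xor_; if_then_else_)
open import Data.Fin.Base using (Fin; zero; suc)
open import Data.Fin.Subset using (Subset; ∣_∣; ⊥)
open import Data.Fin.Subset.Properties using (_∈?_; ∣⊥∣≡0)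
open import Data.Integer.Base as ℤ using ()
import Data.Integer.Properties as ℤ
open import Data.List.Base using (List; []; _∷_; _++_; map; filter; length; tabulate; allFin; cartesianProduct)
open import Data.List.Properties using (length-map; filter-++; length-++; filter-≐; filter-none; filter-all)
open import Data.List.Relation.Unary.All as All using (All; []; _∷_)
import Data.List.Relation.Unary.All.Properties as All
open import Data.List.Relation.Unary.AllPairs as AllPairs using (AllPairs; []; _∷_)
import Data.List.Relation.Unary.AllPairs.Properties as AllPairs
open import Data.Maybe.Base using (just; nothing)
open import Data.Nat.Base as ℕ using (ℕ; zero; suc; _!; NonZero)
import Data.Nat.Properties as ℕ
open import Data.Nat.Tactic.RingSolver using () renaming (solve-∀ to solve-∀ℕ)
open import Data.Product.Base using (Σ-syntax; ∃-syntax; _×_; _,_; proj₁; proj₂; swap)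
open import Data.Rational.Base as ℚ hiding (NonZero; ∣_∣)
open import Data.Rational.Properties
import Data.Rational.Unnormalised.Base as ℚᵘ
import Data.Rational.Unnormalised.Properties as ℚᵘ
open import Data.Sum.Base using (_⊎_; inj₁; inj₂)
open import Data.Unit.Base using (⊤; tt)
open import Data.Vec.Base using (Vec; []; _∷_; lookup; _[_]≔_)
open import Function.Base using (_∘_)
open import Level using (0ℓ)
open import Relation.Binary.PropositionalEquality hiding (J)
open import Relation.Nullary using (Dec; yes; no; does; contradiction)
open import Relation.Nullary.Decidable using (_×-dec_)
open import Relation.Unary using (Pred; Decidable)
open import Tactic.RingSolver using (solve-∀)
open import Tactic.RingSolver.Core.AlmostCommutativeRing using (AlmostCommutativeRing; fromCommutativeRing)

-- Sample the k vertices independently, which costs a factor 2 when n is large,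
-- and let s be about k^(1/10).  If the edge density p is below 1/s or above
-- 1 - 1/s, Markov's inequality for the number of edges or non-edges shows that
-- the number of edges equals ℓ with probability O(1/s).
--
-- Otherwise a random vertex distinguishes two random vertices x and y with
-- probability at least p(1-p)/2 ≥ 1/(4s).  Reveal all but s³ of the vertices.
-- By anticoncentration of the difference of their degrees into the revealed
-- set, these degrees differ by more than s³ except for a proportion O(1/s) of
-- the pairs (x , y), weighted by the probability of being distinguished.  If
-- they do, then replacing x by y among the last s³ vertices changes the number
-- of edges in a direction that does not depend on the other s³ - 1 vertices.
-- A Sperner-type argument for such monotone functions completes the proof; it
-- also gives the anticoncentration of the degree differences.

-- The exponent comes from tuning one random walk that is used twice. With `m` vertices unrevealed,
-- the walk for the edge count starts at 1, has its upper barrier at 1 + s and moves with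
-- probability about `D̄`, which is at least 1/(4s). It stays inside with probability about s/(m D̄)
-- at most, and this is O(1/s) if `m` is s³. Degrees within `m` of each other form a window of w =
-- 2m + 1 differences. The walk for the degrees starts at w and reaches w + δ with probability w/(w
-- + δ), so δ is s⁴. Its exit time is w δ/(a (1 - a)), where a is the probability of being joined to
-- x but not to y, and both a and 1 - a may be tiny. The factor 1/a cancels against the weight of
-- the pair, which is why pairs are weighted; 1/(1 - a) is at most s unless Markov's inequality
-- takes over. What remains is an error of order s w δ/k = s⁸/k, to be compared with D̄/s, which may
-- be as small as 1/(4s²): hence s¹⁰ ≤ k. Inequalities between quotients are stated with the
-- denominators cleared.

ringℚ : AlmostCommutativeRing 0ℓ 0ℓ
ringℚ = fromCommutativeRing +-*-commutativeRing isZero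
  where
  isZero : ∀ p → _
  isZero p with 0ℚ ≟ p
  ... | yes 0≡p = just 0≡p
  ... | no  _   = nothing

-- Ordered arithmetic in ℚ, indicators and expectations

0≤1 : 0ℚ ≤ 1ℚ
0≤1 = nonNegative⁻¹ 1ℚ

0≤+ : ∀ {p q} → 0ℚ ≤ p → 0ℚ ≤ q → 0ℚ ≤ p + q
0≤+ = +-mono-≤

*-monoˡ : ∀ {r p q} → 0ℚ ≤ r → p ≤ q → r * p ≤ r * q
*-monoˡ {r} 0≤r = *-monoˡ-≤-nonNeg r {{nonNegative 0≤r}}

*-monoʳ : ∀ {r p q} → 0ℚ ≤ r → p ≤ q → p * r ≤ q * r
*-monoʳ {r} 0≤r = *-monoʳ-≤-nonNeg r {{nonNegative 0≤r}}

0≤* : ∀ {p q} → 0ℚ ≤ p → 0ℚ ≤ q → 0ℚ ≤ p * q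
0≤* {p} {q} 0≤p 0≤q = subst (_≤ p * q) (*-zeroʳ p) (*-monoˡ 0≤p 0≤q)

≤-offset : ∀ {p q} r → 0ℚ ≤ r → q ≡ p + r → p ≤ q
≤-offset {p} r 0≤r refl = subst (_≤ p + r) (+-identityʳ p) (+-monoʳ-≤ p 0≤r)

0≤q-p : ∀ {p q} → p ≤ q → 0ℚ ≤ q - p
0≤q-p {p} {q} p≤q = subst (_≤ q - p) (+-inverseʳ p) (+-monoˡ-≤ (- p) p≤q)

-- The recursion lets `ι (suc n)` unfold to `1ℚ + ι n` in inductions, while numerals such as `ι 4`
-- evaluate and can occur in ring identities.
ι : ℕ → ℚ
ι zero    = 0ℚ
ι (suc n) = 1ℚ + ι n

0≤ι : ∀ n → 0ℚ ≤ ι n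
0≤ι zero    = ≤-refl
0≤ι (suc n) = 0≤+ 0≤1 (0≤ι n)

0<ι : ∀ n .{{_ : NonZero n}} → 0ℚ < ι n
0<ι (suc n) = <-≤-trans (positive⁻¹ 1ℚ) (≤-offset (ι n) (0≤ι n) refl)

𝟙 : {P : Set} → Dec P → ℚ
𝟙 (yes _) = 1ℚ
𝟙 (no  _) = 0ℚ

0≤𝟙 : {P : Set} (P? : Dec P) → 0ℚ ≤ 𝟙 P?
0≤𝟙 (yes _) = 0≤1
0≤𝟙 (no  _) = ≤-refl

𝟙≤1 : {P : Set} (P? : Dec P) → 𝟙 P? ≤ 1ℚ
𝟙≤1 (yes _) = ≤-refl
𝟙≤1 (no  _) = 0≤1

𝟙≤ : {P : Set} (P? : Dec P) {q : ℚ} → 0ℚ ≤ q → (P → 1ℚ ≤ q) → 𝟙 P? ≤ q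
𝟙≤ (yes p) _   1≤q = 1≤q p
𝟙≤ (no  _) 0≤q _   = 0≤q

-- A positive normalised linear functional. Fubini's theorem is the extra axiom `E-swap`, because
-- linearity alone gives it only for finite `V`. Congruence is derived from monotonicity, which
-- replaces function extensionality.
record Expectation (V : Set) : Set where
  field
    E       : (V → ℚ) → ℚ
    E-mono  : ∀ {f g} → (∀ x → f x ≤ g x) → E f ≤ E g
    E-const : ∀ c → E (λ _ → c) ≡ c
    E-+     : ∀ f g → E (λ x → f x + g x) ≡ E f + E g
    E-*     : ∀ c f → E (λ x → c * f x) ≡ c * E f
    E-swap  : ∀ (f : V → V → ℚ) → E (λ x → E (λ y → f x y)) ≡ E (λ y → E (λ x → f x y))

  E-cong : ∀ {f g} → (∀ x → f x ≡ g x) → E f ≡ E g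
  E-cong f≗g = ≤-antisym (E-mono λ x → ≤-reflexive (f≗g x)) (E-mono λ x → ≤-reflexive (sym (f≗g x)))

  E-affine : ∀ a b f → E (λ x → a + b * f x) ≡ a + b * E f
  E-affine a b f = trans (E-+ _ _) (cong₂ _+_ (E-const a) (E-* b f))

  E-complement : ∀ f → E (λ x → 1ℚ - f x) ≡ 1ℚ - E f
  E-complement f = trans (E-cong λ x → minus (f x)) (trans (E-affine 1ℚ (- 1ℚ) f) (sym (minus (E f))))
    where
    minus : ∀ x → 1ℚ - x ≡ 1ℚ + (- 1ℚ) * x
    minus = solve-∀ ringℚ

-- Averages over tuples

module Tuples {V : Set} (𝔈 : Expectation V) where
  open Expectation 𝔈

  𝔼 : ∀ m → (Vec V m → ℚ) → ℚ
  𝔼 zero    f = f []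
  𝔼 (suc m) f = E λ x → 𝔼 m λ v → f (x ∷ v)

  𝔼-mono : ∀ m {f g} → (∀ v → f v ≤ g v) → 𝔼 m f ≤ 𝔼 m g
  𝔼-mono zero    f≤g = f≤g []
  𝔼-mono (suc m) f≤g = E-mono λ x → 𝔼-mono m λ v → f≤g (x ∷ v)

  𝔼-cong : ∀ m {f g} → (∀ v → f v ≡ g v) → 𝔼 m f ≡ 𝔼 m g
  𝔼-cong m f≗g = ≤-antisym (𝔼-mono m λ v → ≤-reflexive (f≗g v)) (𝔼-mono m λ v → ≤-reflexive (sym (f≗g v)))

  𝔼-const : ∀ m c → 𝔼 m (λ _ → c) ≡ c
  𝔼-const zero    c = refl
  𝔼-const (suc m) c = trans (E-cong λ _ → 𝔼-const m c) (E-const c)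

  𝔼-+ : ∀ m f g → 𝔼 m (λ v → f v + g v) ≡ 𝔼 m f + 𝔼 m g
  𝔼-+ zero    f g = refl
  𝔼-+ (suc m) f g = trans (E-cong λ x → 𝔼-+ m _ _) (E-+ _ _)

  𝔼-* : ∀ m c f → 𝔼 m (λ v → c * f v) ≡ c * 𝔼 m f
  𝔼-* zero    c f = refl
  𝔼-* (suc m) c f = trans (E-cong λ x → 𝔼-* m c _) (E-* c _)

  𝔼-affine : ∀ m a b f → 𝔼 m (λ v → a + b * f v) ≡ a + b * 𝔼 m f
  𝔼-affine m a b f = trans (𝔼-+ m _ _) (cong₂ _+_ (𝔼-const m a) (𝔼-* m b f))

  E-𝔼-swap : ∀ m (f : V → Vec V m → ℚ) → E (λ x → 𝔼 m (f x)) ≡ 𝔼 m (λ v → E λ x → f x v)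
  E-𝔼-swap zero    f = refl
  E-𝔼-swap (suc m) f = trans (E-swap _) (E-cong λ y → E-𝔼-swap m (λ x v → f x (y ∷ v)))

  𝔼≤ : ∀ m {f c} → (∀ v → f v ≤ c) → 𝔼 m f ≤ c
  𝔼≤ m {c = c} f≤c = ≤-trans (𝔼-mono m f≤c) (≤-reflexive (𝔼-const m c))

  0≤𝔼 : ∀ m {f} → (∀ v → 0ℚ ≤ f v) → 0ℚ ≤ 𝔼 m f
  0≤𝔼 m 0≤f = ≤-trans (≤-reflexive (sym (𝔼-const m 0ℚ))) (𝔼-mono m 0≤f)

  0≤E : ∀ {f} → (∀ x → 0ℚ ≤ f x) → 0ℚ ≤ E f
  0≤E 0≤f = ≤-trans (≤-reflexive (sym (E-const 0ℚ))) (E-mono 0≤f)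

  E≤ : ∀ {f c} → (∀ x → f x ≤ c) → E f ≤ c
  E≤ {c = c} f≤c = ≤-trans (E-mono f≤c) (≤-reflexive (E-const c))

-- Anticoncentration of monotone functions

hits : {A : Set} → ℕ → List (A → ℕ) → A → ℚ
hits t []      a = 0ℚ
hits t (F ∷ L) a = 𝟙 (F a ℕ.≟ t) + hits t L a

module _ {A : Set} where

  infix 4 _▷_
  _▷_ : (F G : A → ℕ) → Set
  F ▷ G = ∀ a → G a ℕ.< F a

  0≤hits : ∀ t (L : List (A → ℕ)) a → 0ℚ ≤ hits t L a
  0≤hits t []      a = ≤-refl
  0≤hits t (F ∷ L) a = 0≤+ (0≤𝟙 (F a ℕ.≟ t)) (0≤hits t L a)

  hits-below : ∀ t {L : List (A → ℕ)} a → All (λ F → F a ℕ.< t) L → hits t L a ≡ 0ℚ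
  hits-below t a []                     = refl
  hits-below t a (_∷_ {F} Fa<t below) with F a ℕ.≟ t
  ... | yes Fa≡t = contradiction Fa≡t (ℕ.<⇒≢ Fa<t)
  ... | no  _    = trans (+-identityˡ _) (hits-below t a below)

  hits≤1 : ∀ t {L : List (A → ℕ)} → AllPairs _▷_ L → ∀ a → hits t L a ≤ 1ℚ
  hits≤1 t []                       a = 0≤1
  hits≤1 t (_∷_ {F} {L} F▷L desc)   a with F a ℕ.≟ t
  ... | yes refl = ≤-reflexive (trans (cong (1ℚ +_) (hits-below t a (All.map (λ F▷G → F▷G a) F▷L))) (+-identityʳ 1ℚ))
  ... | no  _    = ≤-trans (≤-reflexive (+-identityˡ _)) (hits≤1 t desc a)

module Anticoncentration {V : Set} (𝔈 : Expectation V) (_≺_ : V → V → Set) where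
  open Expectation 𝔈
  open Tuples 𝔈

  Mono : ∀ m → (Vec V m → ℕ) → Set
  Mono zero    F = ⊤
  Mono (suc m) F = (∀ {x y} → x ≺ y → ∀ v → F (x ∷ v) ℕ.< F (y ∷ v))
                 × (∀ x → Mono m λ v → F (x ∷ v))

  at : ∀ {m} → V → (Vec V (suc m) → ℕ) → Vec V m → ℕ
  at x F v = F (x ∷ v)

  hits-at : ∀ {m} t x (L : List (Vec V (suc m) → ℕ)) v → hits t L (x ∷ v) ≡ hits t (map (at x) L) v
  hits-at t x []      v = refl
  hits-at t x (F ∷ L) v = cong (𝟙 (F (x ∷ v) ℕ.≟ t) +_) (hits-at t x L v)

  -- A weight below the indicator of comparability stands in for the indicator, so that its mean `θ`
  -- can be computed: it will be `a * (1ℚ - a)` for differences of degrees and `D̄ - lost m B` for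
  -- the number of edges.
  module _ (ω : V → V → ℚ)
           (ω-comparable : ∀ x y → ω x y ≤ 0ℚ ⊎ (ω x y ≤ 1ℚ × (x ≺ y ⊎ y ≺ x)))
           (θ c : ℚ) (θ≡ : θ ≡ E λ x → E λ y → ω x y) (0≤θ : 0ℚ ≤ θ) (0≤c : 0ℚ ≤ c) where

    -- For c = θ j this is c (r + d) times r/(r + d) + r d/(θ j), which bounds the
    -- probability that a random walk started at r, making a ±1 step with
    -- probability θ at each time, avoids 0 for j steps: it must hit r + d first
    -- or stay in the interval, whose expected exit time is r d/θ.
    bound : ℕ → ℚ → ℚ → ℚ
    bound j r d = c * r + (r + d) * (r * d + (c - ι j * θ))

    private
      bound-nil : ∀ c d s → c * 0ℚ + (0ℚ + d) * (0ℚ * d + s) ≡ c * (0ℚ + d) * 0ℚ + d * s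
      bound-nil = solve-∀ ringℚ

      bound-end : ∀ c r s → c * r + (r + 0ℚ) * (r * 0ℚ + s) ≡ c * (r + 0ℚ) * 1ℚ + r * s
      bound-end = solve-∀ ringℚ

      bound-start : ∀ c r d θ → c * r + (r + d) * (r * d + (c - 0ℚ * θ)) ≡ c * (r + d) * 1ℚ + (c * r + (r + d) * (r * d))
      bound-start = solve-∀ ringℚ

      -- A step of the walk keeps r + d, and the products (r + 1)(d - 1) and (r - 1)(d + 1) average
      -- to r d - 1. This gain of 1, scaled by r + d and weighted by `θ`, pays for the next
      -- coordinate in `bound-step`.
      bound-chains : ∀ c r d s →
        (c * (1ℚ + (1ℚ + r)) + (1ℚ + (1ℚ + r) + d) * ((1ℚ + (1ℚ + r)) * d + s)) + (c * r + (r + (1ℚ + (1ℚ + d))) * (r * (1ℚ + (1ℚ + d)) + s))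
        ≡ (1ℚ + 1ℚ) * (c * (1ℚ + r) + ((1ℚ + r) + (1ℚ + d)) * ((1ℚ + r) * (1ℚ + d) + s)) - (1ℚ + 1ℚ) * ((1ℚ + r) + (1ℚ + d)) * 1ℚ
      bound-chains = solve-∀ ringℚ

      bound-step : ∀ c r d j θ →
        (1ℚ + 1ℚ) * (c * r + (r + d) * (r * d + (c - j * θ))) + (- ((1ℚ + 1ℚ) * (r + d))) * θ
        ≡ (1ℚ + 1ℚ) * (c * r + (r + d) * (r * d + (c - (1ℚ + j) * θ)))
      bound-step = solve-∀ ringℚ

      weaken-slack : ∀ j → ι (suc j) * θ ≤ c → ι j * θ ≤ c
      weaken-slack j = ≤-trans (≤-offset θ 0≤θ (eq (ι j) θ))
        where
        eq : ∀ j θ → (1ℚ + j) * θ ≡ j * θ + θ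
        eq = solve-∀ ringℚ

      double : ∀ (f : V → ℚ) → E (λ x → E λ y → f x + f y) ≡ (1ℚ + 1ℚ) * E f
      double f = begin
        E (λ x → E λ y → f x + f y)        ≡⟨ E-cong (λ x → trans (E-+ _ _) (cong (_+ E f) (E-const (f x)))) ⟩
        E (λ x → f x + E f)                ≡⟨ E-+ _ _ ⟩
        E f + E (λ _ → E f)                ≡⟨ cong (E f +_) (E-const (E f)) ⟩
        E f + E f                          ≡⟨ eq (E f) ⟩
        (1ℚ + 1ℚ) * E f                    ∎
        where
        open ≡-Reasoning
        eq : ∀ p → p + p ≡ (1ℚ + 1ℚ) * p
        eq = solve-∀ ringℚ

    -- Symmetrise the first coordinate over a pair (x , y).  If x ≺ y, the 2 × r
    -- grid of functions decomposes into chains of lengths r + 1 and r - 1, so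
    -- the length of the chain performs the above random walk.
    hits-bound : ∀ j t L d → All (Mono j) L → AllPairs _▷_ L → ι j * θ ≤ c →
      c * (ι (length L) + ι d) * 𝔼 j (hits t L) ≤ bound j (ι (length L)) (ι d)
    -- The base cases are absorption at 0, absorption at the upper barrier and the end of time. The
    -- slack makes `c - ι j * θ` nonnegative in the first two.
    hits-bound j t [] d _ _ slack = ≤-trans (≤-reflexive (cong (c * (0ℚ + ι d) *_) (𝔼-const j 0ℚ)))
      (≤-offset (ι d * (c - ι j * θ)) (0≤* (0≤ι d) (0≤q-p slack)) (bound-nil c (ι d) _))
    hits-bound j t L zero _ desc slack = ≤-trans
      (*-monoˡ (0≤* 0≤c (0≤+ (0≤ι (length L)) (0≤ι 0))) (𝔼≤ j (hits≤1 t desc)))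
      (≤-offset (ι (length L) * (c - ι j * θ)) (0≤* (0≤ι (length L)) (0≤q-p slack)) (bound-end c _ _))
    hits-bound zero t L d _ desc slack = ≤-trans
      (*-monoˡ (0≤* 0≤c (0≤+ 0≤r 0≤d)) (hits≤1 t desc []))
      (≤-offset _ (0≤+ (0≤* 0≤c 0≤r) (0≤* (0≤+ 0≤r 0≤d) (0≤* 0≤r 0≤d))) (bound-start c (ι (length L)) (ι d) θ))
      where
      0≤r = 0≤ι (length L)
      0≤d = 0≤ι d
    hits-bound (suc j) t L@(F ∷ L′) (suc d) (F-mono ∷ L′-mono) (F▷L′ ∷ desc) slack =
      *-cancelˡ-≤-pos (1ℚ + 1ℚ) (begin
        (1ℚ + 1ℚ) * (c * ρ * E (λ x → 𝔼 j λ v → hits t L (x ∷ v)))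
          ≡⟨ cong ((1ℚ + 1ℚ) *_) (sym (E-* (c * ρ) _)) ⟩
        (1ℚ + 1ℚ) * E (λ x → c * ρ * 𝔼 j λ v → hits t L (x ∷ v))
          ≡⟨ cong ((1ℚ + 1ℚ) *_) (E-cong λ x → cong (c * ρ *_) (𝔼-cong j (hits-at t x L))) ⟩
        (1ℚ + 1ℚ) * E φ
          ≡⟨ double φ ⟨
        E (λ x → E λ y → φ x + φ y)
          ≤⟨ E-mono (λ x → E-mono λ y → pair x y) ⟩
        E (λ x → E λ y → A + B * ω x y)
          ≡⟨ E-cong (λ x → E-affine A B (ω x)) ⟩
        E (λ x → A + B * E (ω x))
          ≡⟨ E-affine A B (λ x → E (ω x)) ⟩
        A + B * E (λ x → E (ω x))
          ≡⟨ cong (λ z → A + B * z) θ≡ ⟨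
        A + B * θ
          ≡⟨ bound-step c r (ι (suc d)) (ι j) θ ⟩
        (1ℚ + 1ℚ) * bound (suc j) r (ι (suc d)) ∎)
      where
      open ≤-Reasoning
      r ρ : ℚ
      r = ι (length L)
      ρ = r + ι (suc d)
      0≤ρ : 0ℚ ≤ ρ
      0≤ρ = 0≤+ (0≤ι (length L)) (0≤ι (suc d))
      A B : ℚ
      A = (1ℚ + 1ℚ) * bound j r (ι (suc d))
      B = - ((1ℚ + 1ℚ) * ρ)
      slack′ : ι j * θ ≤ c
      slack′ = weaken-slack j slack
      φ : V → ℚ
      φ x = c * ρ * 𝔼 j (hits t (map (at x) L))

      mono-at : ∀ {K} x → All (Mono (suc j)) K → All (Mono j) (map (at x) K)
      mono-at x K-mono = All.map⁺ (All.map (λ (_ , m) → m x) K-mono)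
      desc-at : ∀ {K : List (Vec V (suc j) → ℕ)} x → AllPairs _▷_ K → AllPairs _▷_ (map (at x) K)
      desc-at x K-desc = AllPairs.map⁺ (AllPairs.map (λ F▷G v → F▷G (x ∷ v)) K-desc)

      φ-bound : ∀ x → φ x ≤ bound j r (ι (suc d))
      φ-bound x = subst (λ l → c * (ι l + ι (suc d)) * 𝔼 j (hits t (map (at x) L)) ≤ bound j (ι l) (ι (suc d)))
        (length-map (at x) L)
        (hits-bound j t (map (at x) L) (suc d) (mono-at {L} x (F-mono ∷ L′-mono)) (desc-at {L} x (F▷L′ ∷ desc)) slack′)

      -- The largest function `F`, evaluated at y, moves from the chain at y to the top of the chain
      -- at x. For x ≺ y it lies above `at x F`, so the longer list is again descending.
      split : ∀ x y → φ x + φ y ≡ c * ρ * 𝔼 j (hits t (at y F ∷ map (at x) L)) + c * ρ * 𝔼 j (hits t (map (at y) L′))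
      split x y = trans (sym (*-distribˡ-+ (c * ρ) _ _)) (trans (cong (c * ρ *_)
        (trans (sym (𝔼-+ j _ _)) (trans (𝔼-cong j λ v → regroup (hits t (map (at x) L) v) (𝟙 (F (y ∷ v) ℕ.≟ t)) (hits t (map (at y) L′) v)) (𝔼-+ j _ _))))
        (*-distribˡ-+ (c * ρ) _ _))
        where
        regroup : ∀ a b c → a + (b + c) ≡ (b + a) + c
        regroup = solve-∀ ringℚ

      long : ∀ x y → x ≺ y → c * ρ * 𝔼 j (hits t (at y F ∷ map (at x) L)) ≤ bound j (1ℚ + r) (ι d)
      long x y x≺y = subst₂ (λ l ρ → c * ρ * 𝔼 j (hits t (at y F ∷ map (at x) L)) ≤ bound j (1ℚ + ι l) (ι d))
        (length-map (at x) L)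
        (trans (cong (λ l → 1ℚ + ι l + ι d) (length-map (at x) L)) (shift r (ι d)))
        (hits-bound j t (at y F ∷ map (at x) L) d
          (proj₂ F-mono y ∷ mono-at {L} x (F-mono ∷ L′-mono))
          ((step ∷ All.map⁺ (All.map (λ F▷G v → ℕ.<-trans (F▷G (x ∷ v)) (step v)) F▷L′)) ∷ desc-at {L} x (F▷L′ ∷ desc))
          slack′)
        where
        step : at y F ▷ at x F
        step = proj₁ F-mono x≺y
        shift : ∀ r d → 1ℚ + r + d ≡ r + (1ℚ + d)
        shift = solve-∀ ringℚ

      short : ∀ y → c * ρ * 𝔼 j (hits t (map (at y) L′)) ≤ bound j (ι (length L′)) (ι (suc (suc d)))
      short y = subst₂ (λ l ρ → c * ρ * 𝔼 j (hits t (map (at y) L′)) ≤ bound j (ι l) (ι (suc (suc d))))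
        (length-map (at y) L′)
        (trans (cong (λ l → ι l + ι (suc (suc d))) (length-map (at y) L′)) (shift (ι (length L′)) (ι (suc d))))
        (hits-bound j t (map (at y) L′) (suc (suc d)) (mono-at y L′-mono) (desc-at y desc) slack′)
        where
        shift : ∀ r d → r + (1ℚ + d) ≡ 1ℚ + r + d
        shift = solve-∀ ringℚ

      comparable : ∀ x y w → x ≺ y → w ≤ 1ℚ → φ x + φ y ≤ A + B * w
      comparable x y w x≺y w≤1 = begin
        φ x + φ y                                               ≡⟨ split x y ⟩
        _                                                       ≤⟨ +-mono-≤ (long x y x≺y) (short y) ⟩
        bound j (1ℚ + r) (ι d) + bound j (ι (length L′)) (ι (suc (suc d)))
                                                                ≡⟨ bound-chains c (ι (length L′)) (ι d) (c - ι j * θ) ⟩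
        A - (1ℚ + 1ℚ) * ρ * 1ℚ  ≤⟨ ≤-offset ((1ℚ + 1ℚ) * ρ * (1ℚ - w))
                                                                     (0≤* (0≤* (0≤ι 2) 0≤ρ) (0≤q-p w≤1)) (eq A ρ w) ⟩
        A + B * w ∎
        where
        eq : ∀ b ρ ω → b + (- ((1ℚ + 1ℚ) * ρ)) * ω ≡ b - (1ℚ + 1ℚ) * ρ * 1ℚ + (1ℚ + 1ℚ) * ρ * (1ℚ - ω)
        eq = solve-∀ ringℚ

      pair : ∀ x y → φ x + φ y ≤ A + B * ω x y
      pair x y with ω-comparable x y
      ... | inj₂ (ω≤1 , inj₁ x≺y) = comparable x y _ x≺y ω≤1
      ... | inj₂ (ω≤1 , inj₂ y≺x) = ≤-trans (≤-reflexive (+-comm (φ x) (φ y))) (comparable y x _ y≺x ω≤1)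
      -- Without comparability both chains keep their length, and the bound for the unchanged state
      -- suffices.
      ... | inj₁ ω≤0 = ≤-trans (+-mono-≤ (φ-bound x) (φ-bound y))
        (≤-offset ((1ℚ + 1ℚ) * ρ * (0ℚ - ω x y)) (0≤* (0≤* (0≤ι 2) 0≤ρ) (0≤q-p ω≤0)) (eq (bound j r (ι (suc d))) ρ (ω x y)))
        where
        eq : ∀ b ρ ω → (1ℚ + 1ℚ) * b + (- ((1ℚ + 1ℚ) * ρ)) * ω ≡ b + b + (1ℚ + 1ℚ) * ρ * (0ℚ - ω)
        eq = solve-∀ ringℚ

-- Sums along a tuple

bit : Bool → ℕ
bit b = if b then 1 else 0

bit≤1 : ∀ b → bit b ℕ.≤ 1
bit≤1 true  = ℕ.≤-refl
bit≤1 false = ℕ.z≤n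

ν : Bool → ℚ
ν b = ι (bit b)

0≤ν : ∀ b → 0ℚ ≤ ν b
0≤ν b = 0≤ι (bit b)

ν≤1 : ∀ b → ν b ≤ 1ℚ
ν≤1 true  = ≤-refl
ν≤1 false = 0≤1

ν-not : ∀ b → ν (not b) ≡ 1ℚ - ν b
ν-not true  = refl
ν-not false = refl

ι-+ : ∀ m n → ι (m ℕ.+ n) ≡ ι m + ι n
ι-+ zero    n = sym (+-identityˡ (ι n))
ι-+ (suc m) n = trans (cong (1ℚ +_) (ι-+ m n)) (sym (+-assoc 1ℚ (ι m) (ι n)))

ι-* : ∀ m n → ι (m ℕ.* n) ≡ ι m * ι n
ι-* zero    n = sym (*-zeroˡ (ι n))
ι-* (suc m) n = trans (ι-+ n (m ℕ.* n)) (trans (cong (ι n +_) (ι-* m n)) (eq (ι m) (ι n)))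
  where
  eq : ∀ m n → n + m * n ≡ (1ℚ + m) * n
  eq = solve-∀ ringℚ

ι-mono : ∀ {m n} → m ℕ.≤ n → ι m ≤ ι n
ι-mono {n = n} ℕ.z≤n = 0≤ι n
ι-mono (ℕ.s≤s m≤n)   = +-monoʳ-≤ 1ℚ (ι-mono m≤n)

module _ {V : Set} where

  -- The accumulator keeps the form stable: fixing the first coordinate gives `lin` again, as the
  -- recursion of `Mono` demands.
  lin : ∀ {m} → (V → ℕ) → ℕ → Vec V m → ℕ
  lin φ a []      = a
  lin φ a (x ∷ v) = lin φ (φ x ℕ.+ a) v

  lin-mono : ∀ {φ ψ : V → ℕ} → (∀ x → φ x ℕ.≤ ψ x) → ∀ {m a b} (v : Vec V m) → a ℕ.≤ b → lin φ a v ℕ.≤ lin ψ b v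
  lin-mono φ≤ψ []      a≤b = a≤b
  lin-mono φ≤ψ (x ∷ v) a≤b = lin-mono φ≤ψ v (ℕ.+-mono-≤ (φ≤ψ x) a≤b)

  lin-cong : ∀ {φ ψ : V → ℕ} → (∀ x → φ x ≡ ψ x) → ∀ {m a} (v : Vec V m) → lin φ a v ≡ lin ψ a v
  lin-cong φ≗ψ v = ℕ.≤-antisym (lin-mono (λ x → ℕ.≤-reflexive (φ≗ψ x)) v ℕ.≤-refl)
                               (lin-mono (λ x → ℕ.≤-reflexive (sym (φ≗ψ x))) v ℕ.≤-refl)

  lin-strict : ∀ (φ : V → ℕ) {m a b} (v : Vec V m) → a ℕ.< b → lin φ a v ℕ.< lin φ b v
  lin-strict φ []      a<b = a<b
  lin-strict φ (x ∷ v) a<b = lin-strict φ v (ℕ.+-monoʳ-< (φ x) a<b)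

  lin-+ : ∀ (φ ψ : V → ℕ) {m} a b (v : Vec V m) → lin (λ x → φ x ℕ.+ ψ x) (a ℕ.+ b) v ≡ lin φ a v ℕ.+ lin ψ b v
  lin-+ φ ψ a b []      = refl
  lin-+ φ ψ a b (x ∷ v) = trans (cong (λ c → lin (λ x → φ x ℕ.+ ψ x) c v) (eq (φ x) (ψ x) a b)) (lin-+ φ ψ (φ x ℕ.+ a) (ψ x ℕ.+ b) v)
    where
    eq : ∀ p q a b → p ℕ.+ q ℕ.+ (a ℕ.+ b) ≡ p ℕ.+ a ℕ.+ (q ℕ.+ b)
    eq = solve-∀ℕ

  lin-one : ∀ {m} a (v : Vec V m) → lin (λ _ → 1) a v ≡ m ℕ.+ a
  lin-one a []            = refl
  lin-one {suc m} a (x ∷ v) = trans (lin-one (suc a) v) (ℕ.+-suc m a)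

  lin-start : ∀ (φ : V → ℕ) {m} a (v : Vec V m) → lin φ a v ≡ a ℕ.+ lin φ 0 v
  lin-start φ a v = trans (cong (λ c → lin φ c v) (sym (ℕ.+-identityʳ a))) (go a 0 v)
    where
    go : ∀ {m} a b (v : Vec V m) → lin φ (a ℕ.+ b) v ≡ a ℕ.+ lin φ b v
    go a b []      = refl
    go a b (x ∷ v) = trans (cong (λ c → lin φ c v) (eq (φ x) a b)) (go a (φ x ℕ.+ b) v)
      where
      eq : ∀ p a b → p ℕ.+ (a ℕ.+ b) ≡ a ℕ.+ (p ℕ.+ b)
      eq = solve-∀ℕ

  -- The translates of one sum by w - 1, ..., 0 form a chain. Some translate hits t exactly when the
  -- sum lies in a window of w consecutive values, so a small-ball probability becomes an
  -- expectation of `hits`.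
  shifts : (φ : V → ℕ) → ∀ {m} → ℕ → List (Vec V m → ℕ)
  shifts φ zero    = []
  shifts φ (suc w) = lin φ w ∷ shifts φ w

  length-shifts : ∀ φ {m} w → length (shifts φ {m} w) ≡ w
  length-shifts φ zero    = refl
  length-shifts φ (suc w) = cong suc (length-shifts φ w)

  shifts-below : ∀ φ {m} {u} w → w ℕ.≤ u → All (lin φ u ▷_) (shifts φ {m} w)
  shifts-below φ zero    w≤u = []
  shifts-below φ (suc w) w<u = (λ v → lin-strict φ v w<u) ∷ shifts-below φ w (ℕ.<⇒≤ w<u)

  shifts-descending : ∀ φ {m} w → AllPairs _▷_ (shifts φ {m} w)
  shifts-descending φ zero    = []
  shifts-descending φ (suc w) = shifts-below φ w ℕ.≤-refl ∷ shifts-descending φ w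

  1≤hits-shifts : ∀ φ t w {m} (v : Vec V m) → lin φ 0 v ℕ.≤ t → t ℕ.< w ℕ.+ lin φ 0 v → 1ℚ ≤ hits t (shifts φ w) v
  1≤hits-shifts φ t zero    v low high = contradiction high (ℕ.≤⇒≯ low)
  1≤hits-shifts φ t (suc w) v low high with lin φ w v ℕ.≟ t
  ... | yes _ = ≤-offset (hits t (shifts φ w) v) (0≤hits t (shifts φ w) v) refl
  ... | no ≢t = ≤-trans (1≤hits-shifts φ t w v low
                  (ℕ.≤∧≢⇒< (ℕ.s≤s⁻¹ high) λ t≡ → ≢t (trans (lin-start φ w v) (sym t≡))))
                  (≤-reflexive (sym (+-identityˡ _)))

-- Differences of degrees

module SmallBall {V : Set} (𝔈 : Expectation V) where
  open Expectation 𝔈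
  open Tuples 𝔈

  𝔼-lin : ∀ φ K a → 𝔼 K (λ v → ι (lin φ a v)) ≡ ι a + ι K * E (λ x → ι (φ x))
  𝔼-lin φ zero    a = sym (trans (cong (ι a +_) (*-zeroˡ (E λ x → ι (φ x)))) (+-identityʳ (ι a)))
  𝔼-lin φ (suc K) a = begin
    E (λ x → 𝔼 K λ v → ι (lin φ (φ x ℕ.+ a) v))
      ≡⟨ E-cong (λ x → trans (𝔼-lin φ K (φ x ℕ.+ a)) (trans (cong (_+ ι K * e) (ι-+ (φ x) a)) (+-assoc (ι (φ x)) (ι a) _))) ⟩
    E (λ x → ι (φ x) + (ι a + ι K * e))           ≡⟨ trans (E-+ _ _) (cong (e +_) (E-const _)) ⟩
    e + (ι a + ι K * e)                           ≡⟨ eq e (ι a) (ι K) ⟩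
    ι a + (1ℚ + ι K) * e                          ∎
    where
    open ≡-Reasoning
    e : ℚ
    e = E (λ x → ι (φ x))
    eq : ∀ e a k → e + (a + k * e) ≡ a + (1ℚ + k) * e
    eq = solve-∀ ringℚ

  Close : ∀ {K} → ℕ → (p q : V → Bool) → Vec V K → Set
  Close m p q B = lin (λ b → bit (p b)) 0 B ℕ.≤ m ℕ.+ lin (λ b → bit (q b)) 0 B
                × lin (λ b → bit (q b)) 0 B ℕ.≤ m ℕ.+ lin (λ b → bit (p b)) 0 B

  close? : ∀ {K} m p q (B : Vec V K) → Dec (Close m p q B)
  close? m p q B = (_ ℕ.≤? _) ×-dec (_ ℕ.≤? _)

  module OneSided (m K d : ℕ) (p q : V → Bool) where

    r : V → Bool
    r b = p b ∧ not (q b)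

    P a w δ : ℚ
    P = 𝔼 K λ B → 𝟙 (close? m p q B)
    a = E λ b → ν (r b)
    w = ι (suc (m ℕ.+ m))
    δ = ι d

    0≤P : 0ℚ ≤ P
    0≤P = 0≤𝔼 K λ B → 0≤𝟙 (close? m p q B)

    0≤a : 0ℚ ≤ a
    0≤a = 0≤E λ b → 0≤ν (r b)

    0≤1-a : 0ℚ ≤ 1ℚ - a
    0≤1-a = 0≤q-p (E≤ λ b → ν≤1 (r b))

    private
      -- The contribution of b to the difference of the two degrees, raised by 1 to stay in ℕ.
      τ : V → ℕ
      τ b = bit (p b) ℕ.+ bit (not (q b))

      open Anticoncentration 𝔈 (λ x y → τ x ℕ.< τ y)

      -- Only pairs in which x contributes +1 and y does not are used; `τ` is 2 on the former and at
      -- most 1 on the latter. The product form makes the mean equal to `a * (1ℚ - a)`.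
      ω : V → V → ℚ
      ω x y = ν (r x) * (1ℚ - ν (r y))

      ω-comparable : ∀ x y → ω x y ≤ 0ℚ ⊎ (ω x y ≤ 1ℚ × (τ x ℕ.< τ y ⊎ τ y ℕ.< τ x))
      ω-comparable x y with p x | q x | p y | q y
      ... | false | _     | py    | qy    = inj₁ (≤-reflexive (*-zeroˡ (1ℚ - ν (py ∧ not qy))))
      ... | true  | true  | py    | qy    = inj₁ (≤-reflexive (*-zeroˡ (1ℚ - ν (py ∧ not qy))))
      ... | true  | false | true  | false = inj₁ ≤-refl
      ... | true  | false | true  | true  = inj₂ (≤-refl , inj₂ ℕ.≤-refl)
      ... | true  | false | false | false = inj₂ (≤-refl , inj₂ ℕ.≤-refl)
      ... | true  | false | false | true  = inj₂ (≤-refl , inj₂ (ℕ.s≤s ℕ.z≤n))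

      θ≡ : a * (1ℚ - a) ≡ E λ x → E λ y → ω x y
      θ≡ = sym (begin
        E (λ x → E λ y → ν (r x) * (1ℚ - ν (r y)))
          ≡⟨ E-cong (λ x → trans (E-* (ν (r x)) _) (*-comm (ν (r x)) _)) ⟩
        E (λ x → E (λ y → 1ℚ - ν (r y)) * ν (r x))  ≡⟨ E-* (E λ y → 1ℚ - ν (r y)) (λ x → ν (r x)) ⟩
        E (λ y → 1ℚ - ν (r y)) * a                  ≡⟨ cong (_* a) (E-complement λ y → ν (r y)) ⟩
        (1ℚ - a) * a                                ≡⟨ *-comm (1ℚ - a) a ⟩
        a * (1ℚ - a)                                ∎)
        where open ≡-Reasoning

      lin-Mono : ∀ j i → Mono j (lin τ i)
      lin-Mono zero    i = tt
      lin-Mono (suc j) i = (λ τx<τy v → lin-strict τ v (ℕ.+-monoˡ-< i τx<τy)) , λ x → lin-Mono j (τ x ℕ.+ i)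

      shifts-Mono : ∀ j w → All (Mono j) (shifts τ w)
      shifts-Mono j zero    = []
      shifts-Mono j (suc w) = lin-Mono j w ∷ shifts-Mono j w

      balance : ∀ {K} (B : Vec V K) → lin τ 0 B ℕ.+ lin (λ b → bit (q b)) 0 B ≡ K ℕ.+ lin (λ b → bit (p b)) 0 B
      balance {K} B = begin
        lin τ 0 B ℕ.+ lin (λ b → bit (q b)) 0 B             ≡⟨ lin-+ τ _ 0 0 B ⟨
        lin (λ b → τ b ℕ.+ bit (q b)) 0 B                   ≡⟨ lin-cong (λ b → swap-bit (bit (p b)) (q b)) B ⟩
        lin (λ b → 1 ℕ.+ bit (p b)) 0 B                     ≡⟨ lin-+ (λ _ → 1) _ 0 0 B ⟩
        lin (λ _ → 1) 0 B ℕ.+ lin (λ b → bit (p b)) 0 B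
          ≡⟨ cong (ℕ._+ lin (λ b → bit (p b)) 0 B) (trans (lin-one 0 B) (ℕ.+-identityʳ K)) ⟩
        K ℕ.+ lin (λ b → bit (p b)) 0 B                     ∎
        where
        open ≡-Reasoning
        swap-bit : ∀ n b → n ℕ.+ bit (not b) ℕ.+ bit b ≡ 1 ℕ.+ n
        swap-bit n true  = trans (cong (ℕ._+ 1) (ℕ.+-identityʳ n)) (ℕ.+-comm n 1)
        swap-bit n false = trans (ℕ.+-identityʳ (n ℕ.+ 1)) (ℕ.+-comm n 1)

      -- By `balance`, closeness confines the sum of `τ` to the interval from K - m to K + m. It has
      -- 2m + 1 values, and for each of them one of the translates equals K + m.
      close⇒hit : ∀ B → Close m p q B → 1ℚ ≤ hits (K ℕ.+ m) (shifts τ (suc (m ℕ.+ m))) B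
      close⇒hit B (dx≤ , dy≤) = 1≤hits-shifts τ (K ℕ.+ m) (suc (m ℕ.+ m)) B
        (ℕ.+-cancelʳ-≤ dy _ _ (begin
          T ℕ.+ dy              ≡⟨ balance B ⟩
          K ℕ.+ dx              ≤⟨ ℕ.+-monoʳ-≤ K dx≤ ⟩
          K ℕ.+ (m ℕ.+ dy)      ≡⟨ ℕ.+-assoc K m dy ⟨
          K ℕ.+ m ℕ.+ dy        ∎))
        (ℕ.s≤s (ℕ.+-cancelʳ-≤ dx _ _ (begin
          K ℕ.+ m ℕ.+ dx            ≡⟨ eq₁ K m dx ⟩
          (K ℕ.+ dx) ℕ.+ m          ≡⟨ cong (ℕ._+ m) (balance B) ⟨
          T ℕ.+ dy ℕ.+ m            ≤⟨ ℕ.+-monoˡ-≤ m (ℕ.+-monoʳ-≤ T dy≤) ⟩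
          T ℕ.+ (m ℕ.+ dx) ℕ.+ m    ≡⟨ eq₂ T m dx ⟩
          m ℕ.+ m ℕ.+ T ℕ.+ dx      ∎)))
        where
        open ℕ.≤-Reasoning
        T  = lin τ 0 B
        dx = lin (λ b → bit (p b)) 0 B
        dy = lin (λ b → bit (q b)) 0 B
        eq₁ : ∀ K m d → K ℕ.+ m ℕ.+ d ≡ (K ℕ.+ d) ℕ.+ m
        eq₁ = solve-∀ℕ
        eq₂ : ∀ T m d → T ℕ.+ (m ℕ.+ d) ℕ.+ m ≡ m ℕ.+ m ℕ.+ T ℕ.+ d
        eq₂ = solve-∀ℕ

      N : Vec V K → ℕ
      N = lin (λ b → bit (not (r b))) 0
      -- The difference of the bits of p and q is 1 on `r` and at least -1 elsewhere. Close degrees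
      -- therefore require (K - m)/2 vertices outside `r`, which is unlikely when `a` is near 1.
      per-vertex : ∀ b → 1 ℕ.+ bit (q b) ℕ.≤ bit (p b) ℕ.+ (bit (not (r b)) ℕ.+ bit (not (r b)))
      per-vertex b with p b | q b
      ... | true  | true  = ℕ.s≤s (ℕ.s≤s ℕ.z≤n)
      ... | true  | false = ℕ.s≤s ℕ.z≤n
      ... | false | true  = ℕ.s≤s (ℕ.s≤s ℕ.z≤n)
      ... | false | false = ℕ.s≤s ℕ.z≤n
      close⇒ : ∀ B → Close m p q B → K ℕ.≤ m ℕ.+ (N B ℕ.+ N B)
      close⇒ B (dx≤ , _) = ℕ.+-cancelʳ-≤ dy _ _ (begin
        K ℕ.+ dy
          ≡⟨ cong (ℕ._+ dy) (trans (lin-one 0 B) (ℕ.+-identityʳ K)) ⟨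
        lin (λ _ → 1) 0 B ℕ.+ dy                       ≡⟨ lin-+ (λ _ → 1) _ 0 0 B ⟨
        lin (λ b → 1 ℕ.+ bit (q b)) 0 B                ≤⟨ lin-mono per-vertex B ℕ.≤-refl ⟩
        lin _ 0 B
          ≡⟨ trans (lin-+ (λ b → bit (p b)) _ 0 0 B) (cong (lin (λ b → bit (p b)) 0 B ℕ.+_) (lin-+ _ _ 0 0 B)) ⟩
        lin (λ b → bit (p b)) 0 B ℕ.+ (N B ℕ.+ N B)    ≤⟨ ℕ.+-monoˡ-≤ _ dx≤ ⟩
        m ℕ.+ dy ℕ.+ (N B ℕ.+ N B)                     ≡⟨ eq m dy (N B ℕ.+ N B) ⟩
        m ℕ.+ (N B ℕ.+ N B) ℕ.+ dy                     ∎)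
        where
        open ℕ.≤-Reasoning
        dy = lin (λ b → bit (q b)) 0 B
        eq : ∀ m d n → m ℕ.+ d ℕ.+ n ≡ m ℕ.+ n ℕ.+ d
        eq = solve-∀ℕ

    -- In quotient form, P ≤ w/(w + δ) + w δ/(K a (1 - a)): the walk starts at w, the number of
    -- translates. Taking `c = ι K * θ` makes the last term of `bound` vanish at time K. The
    -- estimate degenerates as a tends to 1, where `markov-bound` replaces it.
    window-bound : ι K * (a * (1ℚ - a)) * (w + δ) * P ≤ ι K * (a * (1ℚ - a)) * w + (w + δ) * (w * δ)
    window-bound = begin
      c * (w + δ) * P
        ≤⟨ *-monoˡ (0≤* 0≤c (0≤+ (0≤ι (suc (m ℕ.+ m))) (0≤ι d)))
             (𝔼-mono K λ B → 𝟙≤ (close? m p q B) (0≤hits (K ℕ.+ m) L B) (close⇒hit B)) ⟩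
      c * (w + δ) * 𝔼 K (hits (K ℕ.+ m) L)
        ≤⟨ subst (λ l → c * (ι l + δ) * 𝔼 K (hits (K ℕ.+ m) L) ≤ bound ω ω-comparable θ c θ≡ 0≤θ 0≤c K (ι l) δ)
             (length-shifts τ {K} (suc (m ℕ.+ m)))
             (hits-bound ω ω-comparable θ c θ≡ 0≤θ 0≤c K (K ℕ.+ m) L d (shifts-Mono K _) (shifts-descending τ _) ≤-refl) ⟩
      c * w + (w + δ) * (w * δ + (c - c))
        ≡⟨ eq c w δ ⟩
      c * w + (w + δ) * (w * δ) ∎
      where
      open ≤-Reasoning
      L : List (Vec V K → ℕ)
      L = shifts τ (suc (m ℕ.+ m))
      θ c : ℚ
      θ = a * (1ℚ - a)
      c = ι K * θ
      0≤θ : 0ℚ ≤ θ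
      0≤θ = 0≤* 0≤a 0≤1-a
      0≤c : 0ℚ ≤ c
      0≤c = 0≤* (0≤ι K) 0≤θ
      eq : ∀ c w δ → c * w + (w + δ) * (w * δ + (c - c)) ≡ c * w + (w + δ) * (w * δ)
      eq = solve-∀ ringℚ

    markov-bound : m ℕ.≤ K → (ι K - ι m) * P ≤ (1ℚ + 1ℚ) * (ι K * (1ℚ - a))
    markov-bound m≤K = begin
      (ι K - ι m) * P                                               ≡⟨ 𝔼-* K (ι K - ι m) _ ⟨
      𝔼 K (λ B → (ι K - ι m) * 𝟙 (close? m p q B))                  ≤⟨ 𝔼-mono K pointwise ⟩
      𝔼 K (λ B → (1ℚ + 1ℚ) * ι (N B))                               ≡⟨ 𝔼-* K (1ℚ + 1ℚ) _ ⟩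
      (1ℚ + 1ℚ) * 𝔼 K (λ B → ι (N B))                               ≡⟨ cong ((1ℚ + 1ℚ) *_) (𝔼-lin _ K 0) ⟩
      (1ℚ + 1ℚ) * (0ℚ + ι K * E (λ b → ν (not (r b))))
        ≡⟨ cong ((1ℚ + 1ℚ) *_) (+-identityˡ (ι K * E (λ b → ν (not (r b))))) ⟩
      (1ℚ + 1ℚ) * (ι K * E (λ b → ν (not (r b))))                   ≡⟨ cong (λ z → (1ℚ + 1ℚ) * (ι K * z)) Enot ⟩
      (1ℚ + 1ℚ) * (ι K * (1ℚ - a))                                  ∎
      where
      open ≤-Reasoning
      Enot : E (λ b → ν (not (r b))) ≡ 1ℚ - a
      Enot = trans (E-cong λ b → ν-not (r b)) (E-complement λ b → ν (r b))
      pointwise : ∀ B → (ι K - ι m) * 𝟙 (close? m p q B) ≤ (1ℚ + 1ℚ) * ι (N B)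
      pointwise B with close? m p q B
      ... | no  _ = ≤-trans (≤-reflexive (*-zeroʳ (ι K - ι m))) (0≤* (0≤ι 2) (0≤ι (N B)))
      ... | yes c = ≤-offset ((ι m + (ι (N B) + ι (N B))) - ι K)
          (0≤q-p (≤-trans (ι-mono (close⇒ B c)) (≤-reflexive (trans (ι-+ m _) (cong (ι m +_) (ι-+ (N B) (N B)))))))
          (eq (ι K) (ι m) (ι (N B)))
        where
        eq : ∀ k m n → (1ℚ + 1ℚ) * n ≡ (k - m) * 1ℚ + ((m + (n + n)) - k)
        eq = solve-∀ ringℚ

module TwoSidedSmallBall {V : Set} (𝔈 : Expectation V) where
  open Expectation 𝔈
  open Tuples 𝔈
  open SmallBall 𝔈

  module _ (m K d s : ℕ) (2m≤K : m ℕ.+ m ℕ.≤ K) where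

    private
      κ σ w δ ρ : ℚ
      κ = ι K
      σ = ι s
      w = ι (suc (m ℕ.+ m))
      δ = ι d
      ρ = w + δ

      0≤κ = 0≤ι K
      0≤σ = 0≤ι s
      0≤w = 0≤ι (suc (m ℕ.+ m))
      0≤δ = 0≤ι d

      0≤ρ : 0ℚ ≤ ρ
      0≤ρ = 0≤+ 0≤w 0≤δ

      0≤e : 0ℚ ≤ σ * σ * (ρ * (w * δ))
      0≤e = 0≤* (0≤* 0≤σ 0≤σ) (0≤* 0≤ρ (0≤* 0≤w 0≤δ))

    -- If a ≤ 1 - 1/σ the window bound applies; otherwise almost every vertex
    -- contributes +1 and Markov's inequality suffices.
    one-sided : ∀ p q → let open OneSided m K d p q using (a; P) in
      κ * a * ρ * σ * P ≤ a * (κ * w * σ + ι 4 * κ * ρ) + σ * σ * (ρ * (w * δ))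
    one-sided p q = cases (≤-total 1ℚ (σ * (1ℚ - a))) (≤-total (ρ * P) w)
      where
      open OneSided m K d p q hiding (w; δ)
      open ≤-Reasoning
      cases : 1ℚ ≤ σ * (1ℚ - a) ⊎ σ * (1ℚ - a) ≤ 1ℚ → ρ * P ≤ w ⊎ w ≤ ρ * P →
              κ * a * ρ * σ * P ≤ a * (κ * w * σ + ι 4 * κ * ρ) + σ * σ * (ρ * (w * δ))
      cases (inj₁ _) (inj₁ ρP≤w) = begin
        κ * a * ρ * σ * P                          ≡⟨ eq₁ κ a ρ σ P ⟩
        (κ * a * σ) * (ρ * P)                      ≤⟨ *-monoˡ (0≤* (0≤* 0≤κ 0≤a) 0≤σ) ρP≤w ⟩
        (κ * a * σ) * w                            ≤⟨ ≤-offset (a * (ι 4 * κ * ρ) + σ * σ * (ρ * (w * δ)))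
                                                        (0≤+ (0≤* 0≤a (0≤* (0≤* (0≤ι 4) 0≤κ) 0≤ρ)) 0≤e)
                                                        (eq₂ κ a σ w (ι 4 * κ * ρ) (σ * σ * (ρ * (w * δ)))) ⟩
        a * (κ * w * σ + ι 4 * κ * ρ) + σ * σ * (ρ * (w * δ)) ∎
        where
        eq₁ : ∀ κ a ρ σ P → κ * a * ρ * σ * P ≡ (κ * a * σ) * (ρ * P)
        eq₁ = solve-∀ ringℚ
        eq₂ : ∀ κ a σ w x e → a * (κ * w * σ + x) + e ≡ (κ * a * σ) * w + (a * x + e)
        eq₂ = solve-∀ ringℚ
      -- The excess ρ P - w may be multiplied by σ (1 - a) ≥ 1 because it is nonnegative here. This
      -- introduces the factor 1 - a that `window-bound` needs.
      cases (inj₁ 1≤σe) (inj₂ w≤ρP) = begin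
        κ * a * ρ * σ * P                                   ≡⟨ eq₁ κ a ρ σ P w ⟩
        κ * a * σ * w + κ * a * σ * (ρ * P - w) * 1ℚ        ≤⟨ +-monoʳ-≤ (κ * a * σ * w) (*-monoˡ
                                                                 (0≤* (0≤* (0≤* 0≤κ 0≤a) 0≤σ) (0≤q-p w≤ρP)) 1≤σe) ⟩
        κ * a * σ * w + κ * a * σ * (ρ * P - w) * (σ * (1ℚ - a))
                                                            ≡⟨ eq₂ κ a ρ σ P w (1ℚ - a) ⟩
        κ * a * σ * w + σ * σ * (κ * (a * (1ℚ - a)) * ρ * P - κ * (a * (1ℚ - a)) * w)
                                                            ≤⟨ +-monoʳ-≤ (κ * a * σ * w) (*-monoˡ (0≤* 0≤σ 0≤σ)
                                                                 (+-monoˡ-≤ (- (κ * (a * (1ℚ - a)) * w)) window-bound)) ⟩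
        κ * a * σ * w + σ * σ * (κ * (a * (1ℚ - a)) * w + ρ * (w * δ) - κ * (a * (1ℚ - a)) * w)
                                                            ≤⟨ ≤-offset (a * (ι 4 * κ * ρ)) (0≤* 0≤a (0≤* (0≤* (0≤ι 4) 0≤κ) 0≤ρ))
                                                                 (eq₃ κ a σ w (κ * (a * (1ℚ - a)) * w) (ι 4 * κ * ρ) (ρ * (w * δ))) ⟩
        a * (κ * w * σ + ι 4 * κ * ρ) + σ * σ * (ρ * (w * δ)) ∎
        where
        eq₁ : ∀ κ a ρ σ P w → κ * a * ρ * σ * P ≡ κ * a * σ * w + κ * a * σ * (ρ * P - w) * 1ℚ
        eq₁ = solve-∀ ringℚ
        eq₂ : ∀ κ a ρ σ P w e → κ * a * σ * w + κ * a * σ * (ρ * P - w) * (σ * e)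
                              ≡ κ * a * σ * w + σ * σ * (κ * (a * e) * ρ * P - κ * (a * e) * w)
        eq₂ = solve-∀ ringℚ
        eq₃ : ∀ κ a σ w t x e → a * (κ * w * σ + x) + σ * σ * e ≡ κ * a * σ * w + σ * σ * (t + e - t) + a * x
        eq₃ = solve-∀ ringℚ
      -- From 2m ≤ K follows κ ≤ 2 (κ - m); together with the factor 2 of `markov-bound` this is the
      -- origin of the 4.
      cases (inj₂ σe≤1) _ = begin
        κ * a * ρ * σ * P                              ≤⟨ ≤-offset (a * ρ * σ * ((κ - (ι m + ι m)) * P))
                                                            (0≤* (0≤* (0≤* 0≤a 0≤ρ) 0≤σ) (0≤* (0≤q-p 2μ≤κ) 0≤P)) (eq₁ κ a ρ σ P (ι m)) ⟩
        a * ρ * σ * (ι 2 * ((κ - ι m) * P))            ≤⟨ *-monoˡ (0≤* (0≤* 0≤a 0≤ρ) 0≤σ) (*-monoˡ (0≤ι 2)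
                                                            (markov-bound (ℕ.≤-trans (ℕ.m≤m+n m m) 2m≤K))) ⟩
        a * ρ * σ * (ι 2 * ((1ℚ + 1ℚ) * (κ * (1ℚ - a))))  ≡⟨ eq₂ κ a ρ σ (1ℚ - a) ⟩
        a * (ι 4 * κ * ρ) * (σ * (1ℚ - a))             ≤⟨ *-monoˡ (0≤* 0≤a (0≤* (0≤* (0≤ι 4) 0≤κ) 0≤ρ)) σe≤1 ⟩
        a * (ι 4 * κ * ρ) * 1ℚ                         ≤⟨ ≤-offset (a * (κ * w * σ) + σ * σ * (ρ * (w * δ)))
                                                            (0≤+ (0≤* 0≤a (0≤* (0≤* 0≤κ 0≤w) 0≤σ)) 0≤e)
                                                            (eq₃ a (κ * w * σ) (ι 4 * κ * ρ) (σ * σ * (ρ * (w * δ)))) ⟩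
        a * (κ * w * σ + ι 4 * κ * ρ) + σ * σ * (ρ * (w * δ)) ∎
        where
        2μ≤κ : ι m + ι m ≤ κ
        2μ≤κ = ≤-trans (≤-reflexive (sym (ι-+ m m))) (ι-mono 2m≤K)
        eq₁ : ∀ κ a ρ σ P μ → a * ρ * σ * ((1ℚ + 1ℚ) * ((κ - μ) * P)) ≡ κ * a * ρ * σ * P + a * ρ * σ * ((κ - (μ + μ)) * P)
        eq₁ = solve-∀ ringℚ
        eq₂ : ∀ κ a ρ σ e → a * ρ * σ * ((1ℚ + 1ℚ) * ((1ℚ + 1ℚ) * (κ * e))) ≡ a * ((1ℚ + 1ℚ + 1ℚ + 1ℚ) * κ * ρ) * (σ * e)
        eq₂ = solve-∀ ringℚ
        eq₃ : ∀ a x y e → a * (x + y) + e ≡ a * y * 1ℚ + (a * x + e)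
        eq₃ = solve-∀ ringℚ

    -- The main terms of `one-sided` are proportional to a, so the bounds for (p , q) and (q , p)
    -- can be added: xor splits into the two one-sided differences, whose probabilities sum to D,
    -- and closeness is symmetric.
    two-sided : ∀ p q → let D = E (λ b → ν (p b xor q b)) ; P = 𝔼 K (λ B → 𝟙 (close? m p q B)) in
      κ * D * ρ * σ * P ≤ D * (κ * w * σ + ι 4 * κ * ρ) + ι 2 * (σ * σ * (ρ * (w * δ)))
    two-sided p q = begin
      κ * D * ρ * σ * P.P                                     ≡⟨ cong (λ D → κ * D * ρ * σ * P.P) D≡ ⟩
      κ * (P.a + Q.a) * ρ * σ * P.P                           ≡⟨ eq₁ κ P.a Q.a ρ σ P.P ⟩
      κ * P.a * ρ * σ * P.P + κ * Q.a * ρ * σ * P.P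
        ≡⟨ cong (λ R → κ * P.a * ρ * σ * P.P + κ * Q.a * ρ * σ * R) P≡Q ⟩
      κ * P.a * ρ * σ * P.P + κ * Q.a * ρ * σ * Q.P           ≤⟨ +-mono-≤ (one-sided p q) (one-sided q p) ⟩
      P.a * x + e + (Q.a * x + e)                             ≡⟨ eq₂ P.a Q.a x e ⟩
      (P.a + Q.a) * x + ι 2 * e                               ≡⟨ cong (λ D → D * x + ι 2 * e) D≡ ⟨
      D * x + ι 2 * e                                         ∎
      where
      open ≤-Reasoning
      module P = OneSided m K d p q
      module Q = OneSided m K d q p
      D x e : ℚ
      D = E λ b → ν (p b xor q b)
      x = κ * w * σ + ι 4 * κ * ρ
      e = σ * σ * (ρ * (w * δ))
      D≡ : D ≡ P.a + Q.a
      D≡ = trans (E-cong λ b → xor-split (p b) (q b)) (E-+ _ _)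
        where
        xor-split : ∀ x y → ν (x xor y) ≡ ν (x ∧ not y) + ν (y ∧ not x)
        xor-split true  true  = refl
        xor-split true  false = refl
        xor-split false true  = refl
        xor-split false false = refl
      P≡Q : P.P ≡ Q.P
      P≡Q = 𝔼-cong K λ B → 𝟙-swap B
        where
        𝟙-swap : ∀ B → 𝟙 (close? m p q B) ≡ 𝟙 (close? m q p B)
        𝟙-swap B with close? m p q B | close? m q p B
        ... | yes _ | yes _ = refl
        ... | no  _ | no  _ = refl
        ... | yes c | no ¬c = contradiction (swap c) ¬c
        ... | no ¬c | yes c = contradiction (swap c) ¬c
      eq₁ : ∀ κ a b ρ σ P → κ * (a + b) * ρ * σ * P ≡ κ * a * ρ * σ * P + κ * b * ρ * σ * P
      eq₁ = solve-∀ ringℚ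
      eq₂ : ∀ a b x e → a * x + e + (b * x + e) ≡ (a + b) * x + (1ℚ + 1ℚ) * e
      eq₂ = solve-∀ ringℚ

-- Edges spanned by a random tuple

module EdgeCount {V : Set} (𝔈 : Expectation V) (g : V → V → Bool) where
  open Expectation 𝔈
  open Tuples 𝔈
  open SmallBall 𝔈 using (Close; close?)

  -- a is the number of edges found so far, h x the number of neighbours of x
  -- among the vertices already chosen.
  X : ∀ {m} → ℕ → (V → ℕ) → Vec V m → ℕ
  X a h []      = a
  X a h (x ∷ v) = X (a ℕ.+ h x) (λ y → bit (g x y) ℕ.+ h y) v

  degree : ∀ {K} → (V → ℕ) → Vec V K → V → ℕ
  degree h B y = lin (λ b → bit (g b y)) (h y) B

  𝔼-split : ∀ K {m} (f : ℕ → ℚ) a h →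
    𝔼 (K ℕ.+ m) (λ v → f (X a h v)) ≡ 𝔼 K (λ B → 𝔼 m λ v → f (X (X a h B) (degree h B) v))
  𝔼-split zero    f a h = refl
  𝔼-split (suc K) f a h = E-cong λ x → 𝔼-split K f (a ℕ.+ h x) (λ y → bit (g x y) ℕ.+ h y)

  -- Each of the m remaining vertices lowers the lead b - a by at most 1, because h exceeds k by at
  -- most 1 and this persists when both grow by the same bits.
  X-strict : ∀ {m a b} {h k : V → ℕ} → (∀ y → h y ℕ.≤ suc (k y)) → a ℕ.+ m ℕ.< b →
             ∀ (v : Vec V m) → X a h v ℕ.< X b k v
  X-strict {a = a} h≤1+k a<b []      = ℕ.≤-<-trans (ℕ.m≤m+n a 0) a<b
  X-strict {suc m} {a} {b} {h} {k} h≤1+k a<b (x ∷ v) = X-strict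
    (λ y → ℕ.≤-trans (ℕ.+-monoʳ-≤ (bit (g x y)) (h≤1+k y)) (ℕ.≤-reflexive (ℕ.+-suc _ (k y))))
    (begin-strict
      a ℕ.+ h x ℕ.+ m            ≤⟨ ℕ.+-monoˡ-≤ m (ℕ.+-monoʳ-≤ a (h≤1+k x)) ⟩
      a ℕ.+ suc (k x) ℕ.+ m      ≡⟨ eq a (k x) m ⟩
      a ℕ.+ suc m ℕ.+ k x        <⟨ ℕ.+-monoˡ-< (k x) a<b ⟩
      b ℕ.+ k x                  ∎)
    v
    where
    open ℕ.≤-Reasoning
    eq : ∀ a k m → a ℕ.+ suc k ℕ.+ m ≡ a ℕ.+ suc m ℕ.+ k
    eq = solve-∀ℕ

  -- Choosing y instead of x gains as many edges to the revealed vertices as there are coordinates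
  -- left, and loses at most one edge to each later vertex, of which there is one fewer. Fixing a
  -- vertex z changes the gap by at most 1, just what the smaller number of coordinates allows.
  X-Mono : (_≺_ : V → V → Set) → ∀ m a {h} → (∀ {x y} → x ≺ y → m ℕ.+ h x ℕ.≤ h y) →
           Anticoncentration.Mono 𝔈 _≺_ m (X a h)
  X-Mono _≺_ zero    a     gap = tt
  X-Mono _≺_ (suc m) a {h} gap = increase , λ z → X-Mono _≺_ m (a ℕ.+ h z) (gap′ z)
    where
    open ℕ.≤-Reasoning
    increase : ∀ {x y} → x ≺ y → ∀ v → X a h (x ∷ v) ℕ.< X a h (y ∷ v)
    increase {x} {y} x≺y v = X-strict
      (λ z → ℕ.≤-trans (ℕ.+-monoˡ-≤ (h z) (bit≤1 (g x z))) (ℕ.s≤s (ℕ.m≤n+m (h z) _)))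
      (begin-strict
        a ℕ.+ h x ℕ.+ m        ≡⟨ trans (ℕ.+-assoc a (h x) m) (cong (a ℕ.+_) (ℕ.+-comm (h x) m)) ⟩
        a ℕ.+ (m ℕ.+ h x)      <⟨ ℕ.+-monoʳ-< a (gap x≺y) ⟩
        a ℕ.+ h y              ∎)
      v
    gap′ : ∀ z {x y} → x ≺ y → m ℕ.+ (bit (g z x) ℕ.+ h x) ℕ.≤ bit (g z y) ℕ.+ h y
    gap′ z {x} {y} x≺y = begin
      m ℕ.+ (bit (g z x) ℕ.+ h x)     ≤⟨ ℕ.+-monoʳ-≤ m (ℕ.+-monoˡ-≤ (h x) (bit≤1 (g z x))) ⟩
      m ℕ.+ suc (h x)                 ≡⟨ ℕ.+-suc m (h x) ⟩
      suc m ℕ.+ h x                   ≤⟨ gap x≺y ⟩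
      h y                             ≤⟨ ℕ.m≤n+m (h y) _ ⟩
      bit (g z y) ℕ.+ h y             ∎

  D : V → V → ℚ
  D x y = E λ z → ν (g z x xor g z y)

  D̄ : ℚ
  D̄ = E λ x → E λ y → D x y

  0≤D : ∀ x y → 0ℚ ≤ D x y
  0≤D x y = 0≤E λ z → 0≤ν (g z x xor g z y)

  D≤1 : ∀ x y → D x y ≤ 1ℚ
  D≤1 x y = E≤ λ z → ν≤1 (g z x xor g z y)

  0≤D̄ : 0ℚ ≤ D̄
  0≤D̄ = 0≤E λ x → 0≤E λ y → 0≤D x y

  close-degrees? : ∀ {K} m (B : Vec V K) x y → Dec (Close m (λ b → g b x) (λ b → g b y) B)
  close-degrees? m B x y = close? m (λ b → g b x) (λ b → g b y) B

  -- The weight of the pairs left incomparable after `B` is revealed. Pairs that few vertices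
  -- distinguish may be close for most `B`, but they weigh little; for x = y the weight is 0.
  lost : ∀ {K} m → Vec V K → ℚ
  lost m B = E λ x → E λ y → D x y * 𝟙 (close-degrees? m B x y)

  -- The walk starts from the single function `X a h`, with upper barrier 1 + s. Its mean step `θ`
  -- is `D̄ - lost m B`, but `c = ι m * D̄` does not depend on `B`, which makes the bound affine in
  -- `lost m B` and ready to be averaged.
  conditional-bound : ∀ {K} m s a ℓ (B : Vec V K) →
    ι m * D̄ * (1ℚ + ι s) * 𝔼 m (λ v → 𝟙 (X a (degree (λ _ → 0) B) v ℕ.≟ ℓ))
    ≤ ι m * D̄ + (1ℚ + ι s) * (ι s + ι m * lost m B)
  conditional-bound m s a ℓ B = begin
    c * (1ℚ + σ) * 𝔼 m (λ v → 𝟙 (X a h v ℕ.≟ ℓ))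
      ≡⟨ cong (c * (1ℚ + σ) *_) (𝔼-cong m λ v → sym (+-identityʳ _)) ⟩
    c * (1ℚ + σ) * 𝔼 m (hits ℓ (X a h ∷ []))
      ≤⟨ hits-bound ω ω-comparable θ c refl 0≤θ 0≤c m ℓ (X a h ∷ []) s
           (X-Mono _≺_ m a (λ gap → gap) ∷ []) ([] ∷ []) mθ≤c ⟩
    c * 1ℚ + (1ℚ + σ) * (1ℚ * σ + (c - ι m * θ))
      ≡⟨ cong (λ t → c * 1ℚ + (1ℚ + σ) * (1ℚ * σ + (c - ι m * t))) θ≡ ⟩
    c * 1ℚ + (1ℚ + σ) * (1ℚ * σ + (c - ι m * (D̄ - lost m B)))
      ≡⟨ eq (ι m) D̄ σ (lost m B) ⟩
    c + (1ℚ + σ) * (σ + ι m * lost m B) ∎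
    where
    open ≤-Reasoning
    h : V → ℕ
    h = degree (λ _ → 0) B
    _≺_ : V → V → Set
    x ≺ y = m ℕ.+ h x ℕ.≤ h y
    open Anticoncentration 𝔈 _≺_
    σ c : ℚ
    σ = ι s
    c = ι m * D̄
    𝟙B : V → V → ℚ
    𝟙B x y = 𝟙 (close-degrees? m B x y)
    ω : V → V → ℚ
    ω x y = D x y * (1ℚ - 𝟙B x y)
    θ : ℚ
    θ = E λ x → E λ y → ω x y
    ω-comparable : ∀ x y → ω x y ≤ 0ℚ ⊎ (ω x y ≤ 1ℚ × (x ≺ y ⊎ y ≺ x))
    ω-comparable x y with close-degrees? m B x y
    ... | yes _      = inj₁ (≤-reflexive (*-zeroʳ (D x y)))
    ... | no ¬close  = inj₂ (≤-trans (≤-reflexive (*-identityʳ (D x y))) (D≤1 x y) , far)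
      where
      far : x ≺ y ⊎ y ≺ x
      far with ℕ.≤-total (h x) (m ℕ.+ h y)
      ... | inj₂ y≺x = inj₂ y≺x
      ... | inj₁ hx≤ with ℕ.≤-total (h y) (m ℕ.+ h x)
      ...   | inj₂ x≺y = inj₁ x≺y
      ...   | inj₁ hy≤ = contradiction (hx≤ , hy≤) ¬close
    0≤1-𝟙 : ∀ x y → 0ℚ ≤ 1ℚ - 𝟙B x y
    0≤1-𝟙 x y = 0≤q-p (𝟙≤1 (close-degrees? m B x y))
    0≤θ : 0ℚ ≤ θ
    0≤θ = 0≤E λ x → 0≤E λ y → 0≤* (0≤D x y) (0≤1-𝟙 x y)
    0≤c : 0ℚ ≤ c
    0≤c = 0≤* (0≤ι m) 0≤D̄
    θ≡ : θ ≡ D̄ - lost m B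
    θ≡ = trans (E-cong λ x → trans (E-cong λ y → expand (D x y) (𝟙B x y)) (trans (E-+ _ _) (cong (E (D x) +_) (E-* (- 1ℚ) _))))
      (trans (E-+ _ _) (trans (cong (D̄ +_) (E-* (- 1ℚ) _)) (sym (minus D̄ (lost m B)))))
      where
      expand : ∀ d t → d * (1ℚ - t) ≡ d + (- 1ℚ) * (d * t)
      expand = solve-∀ ringℚ
      minus : ∀ d t → d - t ≡ d + (- 1ℚ) * t
      minus = solve-∀ ringℚ
    mθ≤c : ι m * θ ≤ c
    mθ≤c = *-monoˡ (0≤ι m) (E-mono λ x → E-mono λ y → ≤-trans
      (*-monoˡ (0≤D x y) (≤-offset (𝟙B x y) (0≤𝟙 (close-degrees? m B x y)) (eq₁ (𝟙B x y))))
      (≤-reflexive (*-identityʳ (D x y))))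
      where
      eq₁ : ∀ t → 1ℚ ≡ (1ℚ - t) + t
      eq₁ = solve-∀ ringℚ
    eq : ∀ m D s L → m * D * 1ℚ + (1ℚ + s) * (1ℚ * s + (m * D - m * (D - L))) ≡ m * D + (1ℚ + s) * (s + m * L)
    eq = solve-∀ ringℚ

  -- With the average over `B` moved inside, each pair contributes `D x y` times a probability to
  -- which `two-sided` applies. That bound is affine in `D x y`, so averaging over pairs leaves only
  -- `D̄`.
  lost-bound : ∀ m K d s → m ℕ.+ m ℕ.≤ K →
    let κ = ι K ; σ = ι s ; w = ι (suc (m ℕ.+ m)) ; δ = ι d ; ρ = w + δ in
    κ * ρ * σ * 𝔼 K (lost m) ≤ D̄ * (κ * w * σ + ι 4 * κ * ρ) + ι 2 * (σ * σ * (ρ * (w * δ)))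
  lost-bound m K d s 2m≤K = begin
    κ * ρ * σ * 𝔼 K (lost m)                                ≡⟨ cong (κ * ρ * σ *_) exchange ⟩
    κ * ρ * σ * E (λ x → E λ y → D x y * P x y)             ≡⟨ E-* (κ * ρ * σ) _ ⟨
    E (λ x → κ * ρ * σ * E λ y → D x y * P x y)             ≡⟨ E-cong (λ x → E-* (κ * ρ * σ) _) ⟨
    E (λ x → E λ y → κ * ρ * σ * (D x y * P x y))           ≤⟨ E-mono (λ x → E-mono λ y → ≤-trans
                                                                 (≤-reflexive (eq₁ κ ρ σ (D x y) (P x y)))
                                                                 (TwoSidedSmallBall.two-sided 𝔈 m K d s 2m≤K (λ b → g b x) (λ b → g b y))) ⟩
    E (λ x → E λ y → D x y * u + e)                         ≡⟨ E-cong (λ x → affine (D x)) ⟩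
    E (λ x → E (D x) * u + e)                               ≡⟨ affine (λ x → E (D x)) ⟩
    D̄ * u + e                                               ∎
    where
    open ≤-Reasoning
    κ σ w δ ρ u e : ℚ
    κ = ι K
    σ = ι s
    w = ι (suc (m ℕ.+ m))
    δ = ι d
    ρ = w + δ
    u = κ * w * σ + ι 4 * κ * ρ
    e = ι 2 * (σ * σ * (ρ * (w * δ)))
    P : V → V → ℚ
    P x y = 𝔼 K λ B → 𝟙 (close-degrees? m B x y)
    affine : ∀ f → E (λ x → f x * u + e) ≡ E f * u + e
    affine f = trans (E-+ _ _) (cong₂ _+_ (trans (E-cong λ x → *-comm (f x) u) (trans (E-* u f) (*-comm u (E f)))) (E-const e))
    exchange : 𝔼 K (lost m) ≡ E (λ x → E λ y → D x y * P x y)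
    exchange = trans (sym (E-𝔼-swap K _)) (E-cong λ x → trans (sym (E-𝔼-swap K _)) (E-cong λ y → 𝔼-* K (D x y) _))
    eq₁ : ∀ κ ρ σ D P → κ * ρ * σ * (D * P) ≡ κ * D * ρ * σ * P
    eq₁ = solve-∀ ringℚ

  𝕡 : ∀ k → ℕ → ℚ
  𝕡 k ℓ = 𝔼 k λ v → 𝟙 (X 0 (λ _ → 0) v ℕ.≟ ℓ)

  combined-bound : ∀ m K d s ℓ → m ℕ.+ m ℕ.≤ K →
    let κ = ι K ; σ = ι s ; μ = ι m ; w = ι (suc (m ℕ.+ m)) ; δ = ι d ; ρ = w + δ in
    κ * ρ * σ * (μ * D̄ * (1ℚ + σ) * 𝕡 (K ℕ.+ m) ℓ)
    ≤ κ * ρ * σ * (μ * D̄) + (1ℚ + σ) * (κ * ρ * σ * σ + μ * (D̄ * (κ * w * σ + ι 4 * κ * ρ) + ι 2 * (σ * σ * (ρ * (w * δ)))))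
  combined-bound m K d s ℓ 2m≤K = begin
    κ * ρ * σ * (μ * D̄ * (1ℚ + σ) * 𝕡 (K ℕ.+ m) ℓ)
      ≡⟨ cong (λ p → κ * ρ * σ * (μ * D̄ * (1ℚ + σ) * p)) (𝔼-split K (λ n → 𝟙 (n ℕ.≟ ℓ)) 0 (λ _ → 0)) ⟩
    κ * ρ * σ * (μ * D̄ * (1ℚ + σ) * 𝔼 K (λ B → 𝔼 m λ v → 𝟙 (X (X 0 (λ _ → 0) B) (degree (λ _ → 0) B) v ℕ.≟ ℓ)))
      ≤⟨ *-monoˡ (0≤* (0≤* (0≤ι K) 0≤ρ) (0≤ι s)) (≤-trans (≤-reflexive (sym (𝔼-* K (μ * D̄ * (1ℚ + σ)) _)))
           (𝔼-mono K λ B → conditional-bound m s (X 0 (λ _ → 0) B) ℓ B)) ⟩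
    κ * ρ * σ * 𝔼 K (λ B → μ * D̄ + (1ℚ + σ) * (σ + μ * lost m B))
      ≡⟨ cong (κ * ρ * σ *_) (trans (𝔼-affine K (μ * D̄) (1ℚ + σ) _) (cong (λ t → μ * D̄ + (1ℚ + σ) * t) (𝔼-affine K σ μ (lost m)))) ⟩
    κ * ρ * σ * (μ * D̄ + (1ℚ + σ) * (σ + μ * 𝔼 K (lost m)))
      ≡⟨ eq (κ * ρ * σ) (μ * D̄) σ μ (𝔼 K (lost m)) ⟩
    κ * ρ * σ * (μ * D̄) + (1ℚ + σ) * (κ * ρ * σ * σ + μ * (κ * ρ * σ * 𝔼 K (lost m)))
      ≤⟨ +-monoʳ-≤ (κ * ρ * σ * (μ * D̄)) (*-monoˡ (0≤+ 0≤1 (0≤ι s)) (+-monoʳ-≤ (κ * ρ * σ * σ) (*-monoˡ (0≤ι m) (lost-bound m K d s 2m≤K)))) ⟩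
    κ * ρ * σ * (μ * D̄) + (1ℚ + σ) * (κ * ρ * σ * σ + μ * (D̄ * (κ * w * σ + ι 4 * κ * ρ) + ι 2 * (σ * σ * (ρ * (w * δ))))) ∎
    where
    open ≤-Reasoning
    κ σ μ w δ ρ : ℚ
    κ = ι K
    σ = ι s
    μ = ι m
    w = ι (suc (m ℕ.+ m))
    δ = ι d
    ρ = w + δ
    0≤ρ : 0ℚ ≤ ρ
    0≤ρ = 0≤+ (0≤ι (suc (m ℕ.+ m))) (0≤ι d)
    eq : ∀ z c s m L → z * (c + (1ℚ + s) * (s + m * L)) ≡ z * c + (1ℚ + s) * (z * s + m * (z * L))
    eq = solve-∀ ringℚ

-- Choice of the parameters

parameter-arithmetic : ∀ (σ D κ ρ w : ℚ) → let μ = σ * σ * σ ; δ = μ * σ in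
  1ℚ ≤ σ → 0ℚ ≤ D → 0ℚ ≤ κ → 0ℚ ≤ w → 1ℚ ≤ ι 4 * σ * D → w ≤ ι 3 * μ → δ ≤ ρ → μ * δ * μ ≤ ι 2 * κ →
  κ * ρ * σ * (μ * D) + (1ℚ + σ) * (κ * ρ * σ * σ + μ * (D * (κ * w * σ + ι 4 * κ * ρ) + ι 2 * (σ * σ * (ρ * (w * δ)))))
  ≤ ι 119 * (κ * ρ * σ * (μ * D))
-- The difference of the two sides is a sum of nonnegative multiples of the hypotheses. After
-- replacing 1 + σ by 2 σ, the terms in units of κ ρ σ μ D are 1; 8, as 1 ≤ 4 σ D turns 2 κ ρ μ into
-- 8 units; 6, from w ≤ 3 μ and μ σ = δ ≤ ρ; 8; and 96, as w ≤ 3 μ and μ δ μ ≤ 2 κ lead to 24 κ ρ μ.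
-- They add up to 119.
parameter-arithmetic σ D κ ρ w 1≤σ 0≤D 0≤κ 0≤w 1≤4σD w≤3μ δ≤ρ μδμ≤2κ = ≤-offset _
  (0≤+ (0≤* (0≤q-p 1≤σ) (0≤+ (0≤* (0≤* (0≤* 0≤κ 0≤ρ) 0≤σ) 0≤σ) (0≤* 0≤μ (0≤+ (0≤* 0≤D (0≤+ (0≤* (0≤* 0≤κ 0≤w) 0≤σ)
         (0≤* (0≤* (0≤ι 4) 0≤κ) 0≤ρ))) (0≤* (0≤ι 2) (0≤* (0≤* 0≤σ 0≤σ) (0≤* 0≤ρ (0≤* 0≤w 0≤δ)))))))) (
   0≤+ (0≤* (0≤* (0≤* (0≤* (0≤ι 26) 0≤μ) 0≤κ) 0≤ρ) (0≤q-p 1≤4σD)) (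
   0≤+ (0≤* (0≤+ (0≤* (0≤* (0≤* (0≤* (0≤* (0≤ι 2) 0≤σ) 0≤σ) 0≤μ) 0≤D) 0≤κ) (0≤* (0≤* (0≤* (0≤* (0≤ι 4) 0≤μ) 0≤μ) 0≤ρ) 0≤δ)) (0≤q-p w≤3μ)) (
   0≤+ (0≤* (0≤* (0≤* (0≤* (0≤* (0≤ι 6) 0≤σ) 0≤μ) 0≤D) 0≤κ) (0≤q-p δ≤ρ))
       (0≤* (0≤* (0≤* (0≤ι 12) 0≤ρ) 0≤μ) (0≤q-p μδμ≤2κ))))))
  (eq σ D κ ρ w)
  where
  0≤σ = ≤-trans 0≤1 1≤σ
  0≤μ = 0≤* (0≤* 0≤σ 0≤σ) 0≤σ
  0≤δ = 0≤* 0≤μ 0≤σ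
  0≤ρ = ≤-trans 0≤δ δ≤ρ
  eq : ∀ σ D κ ρ w →
    ι 119 * (κ * ρ * σ * ((σ * σ * σ) * D)) ≡
    (κ * ρ * σ * ((σ * σ * σ) * D) + (1ℚ + σ) * (κ * ρ * σ * σ + (σ * σ * σ) * (D * (κ * w * σ + ι 4 * κ * ρ) + ι 2 * (σ * σ * (ρ * (w * (σ * σ * σ * σ)))))))
    + ((σ - 1ℚ) * (κ * ρ * σ * σ + (σ * σ * σ) * (D * (κ * w * σ + ι 4 * κ * ρ) + ι 2 * (σ * σ * (ρ * (w * (σ * σ * σ * σ))))))
    + (ι 26 * (σ * σ * σ) * κ * ρ * (ι 4 * σ * D - 1ℚ)
    + ((ι 2 * σ * σ * (σ * σ * σ) * D * κ + ι 4 * (σ * σ * σ) * (σ * σ * σ) * ρ * (σ * σ * σ * σ)) * (ι 3 * (σ * σ * σ) - w)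
    + (ι 6 * σ * (σ * σ * σ) * D * κ * (ρ - (σ * σ * σ * σ))
    + ι 12 * ρ * (σ * σ * σ) * (ι 2 * κ - (σ * σ * σ) * (σ * σ * σ * σ) * (σ * σ * σ))))))
  eq = solve-∀ ringℚ

-- Edge density

module Density {V : Set} (𝔈 : Expectation V) (g : V → V → Bool) where
  open Expectation 𝔈
  open Tuples 𝔈
  open EdgeCount 𝔈 g

  p : ℚ
  p = E λ x → E λ y → ν (g x y)

  0≤p : 0ℚ ≤ p
  0≤p = 0≤E λ x → 0≤E λ y → 0≤ν (g x y)

  p≤1 : p ≤ 1ℚ
  p≤1 = E≤ λ x → E≤ λ y → ν≤1 (g x y)

  -- Doubling clears the denominator of k (k - 1)/2, the number of pairs of positions. The state (a
  -- , h) is general because the induction passes through every state.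
  twice-𝔼X : ∀ k a h → ι 2 * 𝔼 k (λ v → ι (X a h v)) ≡ ι 2 * ι a + ι 2 * ι k * E (λ x → ι (h x)) + ι k * (ι k - 1ℚ) * p
  twice-𝔼X zero    a h = eq (ι a) (E λ x → ι (h x)) p
    where
    eq : ∀ a e p → ι 2 * a ≡ ι 2 * a + ι 2 * 0ℚ * e + 0ℚ * (0ℚ - 1ℚ) * p
    eq = solve-∀ ringℚ
  twice-𝔼X (suc k) a h = begin
    ι 2 * E (λ x → 𝔼 k λ v → ι (X (a ℕ.+ h x) (λ y → bit (g x y) ℕ.+ h y) v))
      ≡⟨ E-* (ι 2) _ ⟨
    E (λ x → ι 2 * 𝔼 k λ v → ι (X (a ℕ.+ h x) (λ y → bit (g x y) ℕ.+ h y) v))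
      ≡⟨ E-cong (λ x → trans (twice-𝔼X k (a ℕ.+ h x) _) (cong₂ (λ s t → ι 2 * s + ι 2 * ι k * t + z) (ι-+ a (h x))
           (trans (E-cong λ y → ι-+ (bit (g x y)) (h y)) (E-+ _ _)))) ⟩
    E (λ x → ι 2 * (ι a + ι (h x)) + ι 2 * ι k * (E (λ y → ν (g x y)) + e) + z)
      ≡⟨ E-cong (λ x → eq₁ (ι a) (ι (h x)) (ι k) (E λ y → ν (g x y)) e z) ⟩
    E (λ x → ι 2 * ι a + ι 2 * ι k * e + z + (ι 2 * ι (h x) + ι 2 * ι k * E (λ y → ν (g x y))))
      ≡⟨ trans (E-+ (λ _ → c) (λ x → ι 2 * ι (h x) + ι 2 * ι k * d x)) (cong₂ _+_ (E-const c)
           (trans (E-+ (λ x → ι 2 * ι (h x)) (λ x → ι 2 * ι k * d x)) (cong₂ _+_ (E-* (ι 2) _) (E-* (ι 2 * ι k) d)))) ⟩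
    ι 2 * ι a + ι 2 * ι k * e + z + (ι 2 * e + ι 2 * ι k * p)
      ≡⟨ eq₂ (ι a) (ι k) e p ⟩
    ι 2 * ι a + ι 2 * (1ℚ + ι k) * e + (1ℚ + ι k) * (1ℚ + ι k - 1ℚ) * p ∎
    where
    open ≡-Reasoning
    d : V → ℚ
    d x = E λ y → ν (g x y)
    e z c : ℚ
    e = E λ x → ι (h x)
    z = ι k * (ι k - 1ℚ) * p
    c = ι 2 * ι a + ι 2 * ι k * e + z
    eq₁ : ∀ a h k f e z → ι 2 * (a + h) + ι 2 * k * (f + e) + z ≡ ι 2 * a + ι 2 * k * e + z + (ι 2 * h + ι 2 * k * f)
    eq₁ = solve-∀ ringℚ
    eq₂ : ∀ a k e p → ι 2 * a + ι 2 * k * e + k * (k - 1ℚ) * p + (ι 2 * e + ι 2 * k * p)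
                    ≡ ι 2 * a + ι 2 * (1ℚ + k) * e + (1ℚ + k) * (1ℚ + k - 1ℚ) * p
    eq₂ = solve-∀ ringℚ

  twice-𝔼X≤ : ∀ k → ι 2 * 𝔼 k (λ v → ι (X 0 (λ _ → 0) v)) ≤ ι (k ℕ.* k) * p
  twice-𝔼X≤ k = ≤-offset (ι k * p) (0≤* (0≤ι k) 0≤p)
    (trans (cong (_* p) (ι-* k k)) (trans (eq (ι k) p) (cong (_+ ι k * p)
      (sym (trans (twice-𝔼X k 0 (λ _ → 0)) (cong (λ t → ι 2 * 0ℚ + ι 2 * ι k * t + ι k * (ι k - 1ℚ) * p) (E-const 0ℚ)))))))
    where
    eq : ∀ k p → k * k * p ≡ ι 2 * 0ℚ + ι 2 * k * 0ℚ + k * (k - 1ℚ) * p + k * p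
    eq = solve-∀ ringℚ

  -- If g x y = 1 and g z w = 0 then, according to g x w, either x
  -- distinguishes y from w or w distinguishes x from z.
  p[1-p]≤2D̄ : (∀ x y → g x y ≡ g y x) → p * (1ℚ - p) ≤ ι 2 * D̄
  p[1-p]≤2D̄ g-sym = begin
    p * (1ℚ - p)
      ≡⟨ expand ⟩
    E (λ x → E λ y → E λ z → E λ w → ν (g x y) * (1ℚ - ν (g z w)))
      ≤⟨ E-mono (λ x → E-mono λ y → E-mono λ z → E-mono λ w → path (g x y) (g x w) (g z w)) ⟩
    E (λ x → E λ y → E λ z → E λ w → ν (g x y xor g x w) + ν (g x w xor g z w))
      ≡⟨ E-cong (λ x → E-cong λ y → trans (E-cong λ z → E-+ (λ w → ν (g x y xor g x w)) (λ w → ν (g x w xor g z w)))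
           (trans (E-+ (λ _ → E λ w → ν (g x y xor g x w)) (λ z → E λ w → ν (g x w xor g z w)))
           (cong (_+ E (λ z → E λ w → ν (g x w xor g z w))) (E-const (E λ w → ν (g x y xor g x w)))))) ⟩
    E (λ x → E λ y → E (λ w → ν (g x y xor g x w)) + E (λ z → E λ w → ν (g x w xor g z w)))
      ≡⟨ trans (E-cong λ x → trans (E-+ _ _) (cong (E (λ y → E λ w → ν (g x y xor g x w)) +_) (E-const _))) (E-+ _ _) ⟩
    E (λ x → E λ y → E λ w → ν (g x y xor g x w)) + E (λ x → E λ z → E λ w → ν (g x w xor g z w))
      ≡⟨ cong₂ _+_ (trans (E-swap _) (E-cong λ y → E-swap _))
                   (E-cong λ x → E-cong λ z → E-cong λ w → cong₂ (λ b c → ν (b xor c)) (g-sym x w) (g-sym z w)) ⟩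
    D̄ + D̄
      ≡⟨ eq D̄ ⟩
    ι 2 * D̄ ∎
    where
    open ≤-Reasoning
    eq : ∀ d → d + d ≡ ι 2 * d
    eq = solve-∀ ringℚ
    expand : p * (1ℚ - p) ≡ E (λ x → E λ y → E λ z → E λ w → ν (g x y) * (1ℚ - ν (g z w)))
    expand = sym (begin-equality
      E (λ x → E λ y → E λ z → E λ w → ν (g x y) * (1ℚ - ν (g z w)))
        ≡⟨ E-cong (λ x → E-cong λ y → trans (E-cong λ z → trans (E-* (ν (g x y)) _) (cong (ν (g x y) *_) (E-complement _)))
             (trans (E-* (ν (g x y)) _) (cong (ν (g x y) *_) (E-complement _)))) ⟩
      E (λ x → E λ y → ν (g x y) * (1ℚ - p))
        ≡⟨ E-cong (λ x → trans (E-cong λ y → *-comm (ν (g x y)) (1ℚ - p)) (E-* (1ℚ - p) _)) ⟩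
      E (λ x → (1ℚ - p) * E λ y → ν (g x y))
        ≡⟨ trans (E-* (1ℚ - p) _) (*-comm (1ℚ - p) p) ⟩
      p * (1ℚ - p) ∎)
    path : ∀ a b c → ν a * (1ℚ - ν c) ≤ ν (a xor b) + ν (b xor c)
    path false b     c     = ≤-trans (≤-reflexive (*-zeroˡ (1ℚ - ν c))) (0≤+ (0≤ν (false xor b)) (0≤ν (b xor c)))
    path true  true  true  = ≤-refl
    path true  false true  = 0≤ι 2
    path true  true  false = ≤-refl
    path true  false false = ≤-refl

-- The three ranges of the density

module Anticoncentrated {V : Set} (𝔈 : Expectation V) (g : V → V → Bool) (g-sym : ∀ x y → g x y ≡ g y x) where
  open Expectation 𝔈
  open Tuples 𝔈
  open EdgeCount 𝔈 g
  open Density 𝔈 g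

  private
    g′ : V → V → Bool
    g′ x y = not (g x y)

    module C  = EdgeCount 𝔈 g′
    module C′ = Density 𝔈 g′

  0≤𝕡 : ∀ k ℓ → 0ℚ ≤ 𝕡 k ℓ
  0≤𝕡 k ℓ = 0≤𝔼 k λ v → 0≤𝟙 (X 0 (λ _ → 0) v ℕ.≟ ℓ)

  𝕡≤1 : ∀ k ℓ → 𝕡 k ℓ ≤ 1ℚ
  𝕡≤1 k ℓ = 𝔼≤ k λ v → 𝟙≤1 (X 0 (λ _ → 0) v ℕ.≟ ℓ)

  complement-density : C′.p ≡ 1ℚ - p
  complement-density = trans
    (E-cong λ x → trans (E-cong λ y → ν-not (g x y)) (E-complement λ y → ν (g x y)))
    (E-complement λ x → E λ y → ν (g x y))

  -- Each pair of positions counts for exactly one of `g` and its negation, repeated vertices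
  -- included, since the diagonal is negated too. In `go`, j is the number of vertices already
  -- placed, over which the two neighbour counts of any y sum to j.
  complement-count : ∀ {m} (v : Vec V m) →
    2 ℕ.* X 0 (λ _ → 0) v ℕ.+ 2 ℕ.* C.X 0 (λ _ → 0) v ℕ.+ m ≡ m ℕ.* m
  complement-count {m} v = trans (go {a = 0} {0} {h = λ _ → 0} {λ _ → 0} v 0 (λ _ → refl)) (eq m)
    where
    eq : ∀ m → 2 ℕ.* (0 ℕ.+ 0) ℕ.+ 2 ℕ.* m ℕ.* 0 ℕ.+ m ℕ.* m ≡ m ℕ.* m
    eq = solve-∀ℕ
    bits : ∀ b → bit b ℕ.+ bit (not b) ≡ 1
    bits true  = refl
    bits false = refl
    go : ∀ {m a a′} {h h′ : V → ℕ} (v : Vec V m) j → (∀ y → h y ℕ.+ h′ y ≡ j) →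
         2 ℕ.* X a h v ℕ.+ 2 ℕ.* C.X a′ h′ v ℕ.+ m ≡ 2 ℕ.* (a ℕ.+ a′) ℕ.+ 2 ℕ.* m ℕ.* j ℕ.+ m ℕ.* m
    go {a = a} {a′} [] j h+h′ = eq₀ a a′
      where
      eq₀ : ∀ a a′ → 2 ℕ.* a ℕ.+ 2 ℕ.* a′ ℕ.+ 0 ≡ 2 ℕ.* (a ℕ.+ a′) ℕ.+ 0 ℕ.+ 0
      eq₀ = solve-∀ℕ
    go {suc m} {a} {a′} {h} {h′} (x ∷ v) j h+h′ = begin
      2 ℕ.* X _ _ v ℕ.+ 2 ℕ.* C.X _ _ v ℕ.+ suc m      ≡⟨ ℕ.+-suc _ m ⟩
      suc (2 ℕ.* X _ _ v ℕ.+ 2 ℕ.* C.X _ _ v ℕ.+ m)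
        ≡⟨ cong suc (go v (suc j) λ y → trans (eq₁ (bit (g x y)) (h y) _ (h′ y)) (cong₂ ℕ._+_ (bits (g x y)) (h+h′ y))) ⟩
      suc (2 ℕ.* (a ℕ.+ h x ℕ.+ (a′ ℕ.+ h′ x)) ℕ.+ 2 ℕ.* m ℕ.* suc j ℕ.+ m ℕ.* m)
                                                       ≡⟨ cong (λ t → suc (2 ℕ.* t ℕ.+ 2 ℕ.* m ℕ.* suc j ℕ.+ m ℕ.* m)) (trans (eq₂ a (h x) a′ (h′ x)) (cong (a ℕ.+ a′ ℕ.+_) (h+h′ x))) ⟩
      suc (2 ℕ.* (a ℕ.+ a′ ℕ.+ j) ℕ.+ 2 ℕ.* m ℕ.* suc j ℕ.+ m ℕ.* m)
                                                       ≡⟨ eq₃ a a′ j m ⟩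
      2 ℕ.* (a ℕ.+ a′) ℕ.+ 2 ℕ.* suc m ℕ.* j ℕ.+ suc m ℕ.* suc m ∎
      where
      open ≡-Reasoning
      eq₁ : ∀ b h c h′ → b ℕ.+ h ℕ.+ (c ℕ.+ h′) ≡ b ℕ.+ c ℕ.+ (h ℕ.+ h′)
      eq₁ = solve-∀ℕ
      eq₂ : ∀ a h b k → a ℕ.+ h ℕ.+ (b ℕ.+ k) ≡ a ℕ.+ b ℕ.+ (h ℕ.+ k)
      eq₂ = solve-∀ℕ
      eq₃ : ∀ a b j m → suc (2 ℕ.* (a ℕ.+ b ℕ.+ j) ℕ.+ 2 ℕ.* m ℕ.* suc j ℕ.+ m ℕ.* m) ≡ 2 ℕ.* (a ℕ.+ b) ℕ.+ 2 ℕ.* suc m ℕ.* j ℕ.+ suc m ℕ.* suc m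
      eq₃ = solve-∀ℕ

  markov : ∀ k ℓ q N π (Y : Vec V k → ℕ) → .{{_ : NonZero N}} → (∀ v → X 0 (λ _ → 0) v ≡ ℓ → N ℕ.≤ q ℕ.* (2 ℕ.* Y v)) →
    ι 2 * 𝔼 k (λ v → ι (Y v)) ≤ ι N * π → 𝕡 k ℓ ≤ ι q * π
  markov k ℓ q N@(suc _) π Y large EY≤ = *-cancelˡ-≤-pos (ι N) {{positive (0<ι N)}} (begin
    ι N * 𝕡 k ℓ                                            ≡⟨ 𝔼-* k (ι N) _ ⟨
    𝔼 k (λ v → ι N * 𝟙 (X 0 (λ _ → 0) v ℕ.≟ ℓ))            ≤⟨ 𝔼-mono k pointwise ⟩
    𝔼 k (λ v → ι q * (ι 2 * ι (Y v)))
      ≡⟨ trans (𝔼-* k (ι q) _) (cong (ι q *_) (𝔼-* k (ι 2) _)) ⟩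
    ι q * (ι 2 * 𝔼 k (λ v → ι (Y v)))                      ≤⟨ *-monoˡ (0≤ι q) EY≤ ⟩
    ι q * (ι N * π)                                        ≡⟨ eq (ι q) (ι N) π ⟩
    ι N * (ι q * π)                                        ∎)
    where
    open ≤-Reasoning
    pointwise : ∀ v → ι N * 𝟙 (X 0 (λ _ → 0) v ℕ.≟ ℓ) ≤ ι q * (ι 2 * ι (Y v))
    pointwise v with X 0 (λ _ → 0) v ℕ.≟ ℓ
    ... | no  _   = ≤-trans (≤-reflexive (*-zeroʳ (ι N))) (0≤* (0≤ι q) (0≤* (0≤ι 2) (0≤ι (Y v))))
    ... | yes X≡ℓ = ≤-trans (≤-reflexive (*-identityʳ (ι N))) (≤-trans (ι-mono (large v X≡ℓ))
                      (≤-reflexive (trans (ι-* q _) (cong (ι q *_) (ι-* 2 (Y v))))))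
    eq : ∀ q n π → q * (n * π) ≡ n * (q * π)
    eq = solve-∀ ringℚ

  low-density : ∀ k ℓ q .{{_ : NonZero k}} → k ℕ.* k ℕ.≤ q ℕ.* ℓ → 𝕡 k ℓ ≤ ι q * p
  low-density k ℓ q k²≤qℓ = markov k ℓ q (k ℕ.* k) p (X 0 (λ _ → 0)) {{ℕ.m*n≢0 k k}}
    (λ { v refl → ℕ.≤-trans k²≤qℓ (ℕ.*-monoʳ-≤ q (ℕ.m≤m+n _ _)) }) (twice-𝔼X≤ k)

  high-density : ∀ k ℓ q .{{_ : NonZero k}} → q ℕ.≤ k → 2 ℕ.* (k ℕ.* k) ℕ.+ 2 ℕ.* (q ℕ.* ℓ) ℕ.≤ q ℕ.* (k ℕ.* k) →
    𝕡 k ℓ ≤ ι q * (1ℚ - p)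
  high-density k ℓ q q≤k h = subst (λ π → 𝕡 k ℓ ≤ ι q * π) complement-density
    (markov k ℓ q (k ℕ.* k) C′.p (C.X 0 (λ _ → 0)) {{ℕ.m*n≢0 k k}} large (C′.twice-𝔼X≤ k))
    where
    open ℕ.≤-Reasoning
    -- There are k (k - 1)/2 pairs of positions, not k²/2; the resulting defect q k is absorbed, by
    -- q ≤ k, into one of the two k² of the hypothesis.
    large : ∀ v → X 0 (λ _ → 0) v ≡ ℓ → k ℕ.* k ℕ.≤ q ℕ.* (2 ℕ.* C.X 0 (λ _ → 0) v)
    large v refl = ℕ.+-cancelʳ-≤ (k ℕ.* k ℕ.+ 2 ℕ.* (q ℕ.* x)) _ _ (begin
      k ℕ.* k ℕ.+ (k ℕ.* k ℕ.+ 2 ℕ.* (q ℕ.* x))       ≡⟨ eq₁ (k ℕ.* k) (2 ℕ.* (q ℕ.* x)) ⟩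
      2 ℕ.* (k ℕ.* k) ℕ.+ 2 ℕ.* (q ℕ.* x)             ≤⟨ h ⟩
      q ℕ.* (k ℕ.* k)                                 ≡⟨ cong (q ℕ.*_) (complement-count v) ⟨
      q ℕ.* (2 ℕ.* x ℕ.+ 2 ℕ.* y ℕ.+ k)               ≡⟨ eq₂ q x y k ⟩
      q ℕ.* (2 ℕ.* y) ℕ.+ (q ℕ.* k ℕ.+ 2 ℕ.* (q ℕ.* x)) ≤⟨ ℕ.+-monoʳ-≤ (q ℕ.* (2 ℕ.* y)) (ℕ.+-monoˡ-≤ (2 ℕ.* (q ℕ.* x)) (ℕ.*-monoˡ-≤ k q≤k)) ⟩
      q ℕ.* (2 ℕ.* y) ℕ.+ (k ℕ.* k ℕ.+ 2 ℕ.* (q ℕ.* x)) ∎)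
      where
      x = X 0 (λ _ → 0) v
      y = C.X 0 (λ _ → 0) v
      eq₁ : ∀ n m → n ℕ.+ (n ℕ.+ m) ≡ 2 ℕ.* n ℕ.+ m
      eq₁ = solve-∀ℕ
      eq₂ : ∀ q x y k → q ℕ.* (2 ℕ.* x ℕ.+ 2 ℕ.* y ℕ.+ k) ≡ q ℕ.* (2 ℕ.* y) ℕ.+ (q ℕ.* k ℕ.+ 2 ℕ.* (q ℕ.* x))
      eq₂ = solve-∀ℕ

  module _ (s k ℓ : ℕ) (2≤s : 2 ℕ.≤ s) (s¹⁰≤k : s ℕ.^ 10 ℕ.≤ k) where
    private
      m d K : ℕ
      m = s ℕ.* s ℕ.* s
      d = m ℕ.* s
      K = k ℕ.∸ m

      m≡s³ : m ≡ s ℕ.^ 3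
      m≡s³ = eq s
        where
        eq : ∀ s → s ℕ.* s ℕ.* s ≡ s ℕ.* (s ℕ.* (s ℕ.* 1))
        eq = solve-∀ℕ

      4m≤s¹⁰ : 4 ℕ.* m ℕ.≤ s ℕ.^ 10
      4m≤s¹⁰ = begin
        4 ℕ.* m
          -- Here 4 + 124 is the seventh power of 2.
          ≤⟨ ℕ.*-monoˡ-≤ m (ℕ.≤-trans (ℕ.m≤m+n 4 124) (ℕ.^-monoˡ-≤ 7 2≤s)) ⟩
        s ℕ.^ 7 ℕ.* m                           ≡⟨ cong (s ℕ.^ 7 ℕ.*_) m≡s³ ⟩
        s ℕ.^ 7 ℕ.* s ℕ.^ 3                     ≡⟨ ℕ.^-distribˡ-+-* s 7 3 ⟨
        s ℕ.^ 10                                ∎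
        where open ℕ.≤-Reasoning

      4m≤k : 4 ℕ.* m ℕ.≤ k
      4m≤k = ℕ.≤-trans 4m≤s¹⁰ s¹⁰≤k

      m≤k : m ℕ.≤ k
      m≤k = ℕ.≤-trans (ℕ.m≤n*m m 4) 4m≤k

      K+m≡k : K ℕ.+ m ≡ k
      K+m≡k = ℕ.m∸n+n≡m m≤k

      2m≤K : m ℕ.+ m ℕ.≤ K
      2m≤K = ℕ.+-cancelʳ-≤ m _ _ (begin
        m ℕ.+ m ℕ.+ m     ≤⟨ ℕ.m≤m+n _ m ⟩
        m ℕ.+ m ℕ.+ m ℕ.+ m ≡⟨ eq m ⟩
        4 ℕ.* m           ≤⟨ 4m≤k ⟩
        k                 ≡⟨ K+m≡k ⟨
        K ℕ.+ m           ∎)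
        where
        open ℕ.≤-Reasoning
        eq : ∀ m → m ℕ.+ m ℕ.+ m ℕ.+ m ≡ 4 ℕ.* m
        eq = solve-∀ℕ

      -- The exponent 10 is 3 + 4 + 3, and k ≤ 2 K because 2 m ≤ k.
      mdm≤2K : m ℕ.* d ℕ.* m ℕ.≤ 2 ℕ.* K
      mdm≤2K = ℕ.+-cancelʳ-≤ (2 ℕ.* m) _ _ (begin
        m ℕ.* d ℕ.* m ℕ.+ 2 ℕ.* m       ≡⟨ cong (ℕ._+ 2 ℕ.* m) mdm≡s¹⁰ ⟩
        s ℕ.^ 10 ℕ.+ 2 ℕ.* m            ≤⟨ ℕ.+-mono-≤ s¹⁰≤k (ℕ.≤-trans (ℕ.*-monoˡ-≤ m (ℕ.m≤m+n 2 2)) 4m≤k) ⟩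
        k ℕ.+ k                         ≡⟨ cong₂ ℕ._+_ K+m≡k K+m≡k ⟨
        K ℕ.+ m ℕ.+ (K ℕ.+ m)           ≡⟨ eq′ K m ⟩
        2 ℕ.* K ℕ.+ 2 ℕ.* m             ∎)
        where
        open ℕ.≤-Reasoning
        mdm≡s¹⁰ : m ℕ.* d ℕ.* m ≡ s ℕ.^ 10
        mdm≡s¹⁰ = trans (cong (λ m → m ℕ.* (m ℕ.* s) ℕ.* m) m≡s³)
          (trans (cong (ℕ._* s ℕ.^ 3) (trans (cong (s ℕ.^ 3 ℕ.*_) (ℕ.*-comm (s ℕ.^ 3) s)) (sym (ℕ.^-distribˡ-+-* s 3 4))))
            (sym (ℕ.^-distribˡ-+-* s 7 3)))
        eq′ : ∀ K m → K ℕ.+ m ℕ.+ (K ℕ.+ m) ≡ 2 ℕ.* K ℕ.+ 2 ℕ.* m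
        eq′ = solve-∀ℕ

      σ : ℚ
      σ = ι s

      ιm : ι m ≡ σ * σ * σ
      ιm = trans (ι-* (s ℕ.* s) s) (cong (_* σ) (ι-* s s))

      ιd : ι d ≡ σ * σ * σ * σ
      ιd = trans (ι-* m s) (cong (_* σ) ιm)

      1≤σ : 1ℚ ≤ σ
      1≤σ = ι-mono {1} (ℕ.≤-trans (ℕ.n≤1+n 1) 2≤s)

    medium-density : 1ℚ ≤ ι 4 * σ * D̄ → σ * 𝕡 k ℓ ≤ ι 119
    medium-density 1≤4σD̄ = begin
      σ * 𝕡 k ℓ                 ≤⟨ *-monoʳ (0≤𝕡 k ℓ) (≤-offset {σ} {1ℚ + σ} 1ℚ 0≤1 (+-comm 1ℚ σ)) ⟩
      (1ℚ + σ) * 𝕡 k ℓ          ≤⟨ *-cancelˡ-≤-pos Z {{positive 0<Z}} (begin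
          Z * ((1ℚ + σ) * 𝕡 k ℓ)                          ≡⟨ cong (λ k → Z * ((1ℚ + σ) * 𝕡 k ℓ)) K+m≡k ⟨
          Z * ((1ℚ + σ) * 𝕡 (K ℕ.+ m) ℓ)
            ≡⟨ eq (ι K * ρ * σ) (μ * D̄) (1ℚ + σ) (𝕡 (K ℕ.+ m) ℓ) ⟩
          ι K * ρ * σ * (μ * D̄ * (1ℚ + σ) * 𝕡 (K ℕ.+ m) ℓ) ≤⟨ bound ⟩
          _
            ≤⟨ parameter-arithmetic σ D̄ (ι K) ρ w 1≤σ 0≤D̄ (0≤ι K) (0≤ι (suc (m ℕ.+ m))) 1≤4σD̄ w≤3μ δ≤ρ μδμ≤2κ ⟩
          ι 119 * Z                                       ≡⟨ *-comm (ι 119) Z ⟩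
          Z * ι 119                                       ∎) ⟩
      ι 119                     ∎
      where
      open ≤-Reasoning
      μ δ w ρ Z : ℚ
      μ = σ * σ * σ
      δ = μ * σ
      w = ι (suc (m ℕ.+ m))
      ρ = w + δ
      Z = ι K * ρ * σ * (μ * D̄)
      bound : ι K * ρ * σ * (μ * D̄ * (1ℚ + σ) * 𝕡 (K ℕ.+ m) ℓ)
        ≤ ι K * ρ * σ * (μ * D̄) + (1ℚ + σ) * (ι K * ρ * σ * σ + μ * (D̄ * (ι K * w * σ + ι 4 * ι K * ρ) + ι 2 * (σ * σ * (ρ * (w * δ)))))
      bound = subst₂ (λ μ δ → ι K * (w + δ) * σ * (μ * D̄ * (1ℚ + σ) * 𝕡 (K ℕ.+ m) ℓ)
        ≤ ι K * (w + δ) * σ * (μ * D̄) + (1ℚ + σ) * (ι K * (w + δ) * σ * σ + μ * (D̄ * (ι K * w * σ + ι 4 * ι K * (w + δ)) + ι 2 * (σ * σ * ((w + δ) * (w * δ))))))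
        ιm ιd (combined-bound m K d s ℓ 2m≤K)
      1≤m : 1 ℕ.≤ m
      1≤m = ℕ.*-mono-≤ (ℕ.*-mono-≤ 1≤s 1≤s) 1≤s
        where 1≤s = ℕ.≤-trans (ℕ.n≤1+n 1) 2≤s
      w≤3μ : w ≤ ι 3 * μ
      w≤3μ = ≤-trans (ι-mono {suc (m ℕ.+ m)} {3 ℕ.* m} (ℕ.≤-trans (ℕ.+-monoˡ-≤ (m ℕ.+ m) 1≤m) (ℕ.≤-reflexive (eq₃ m))))
        (≤-reflexive (trans (ι-* 3 m) (cong (ι 3 *_) ιm)))
        where
        eq₃ : ∀ m → m ℕ.+ (m ℕ.+ m) ≡ 3 ℕ.* m
        eq₃ = solve-∀ℕ
      δ≤ρ : δ ≤ ρ
      δ≤ρ = ≤-offset w (0≤ι (suc (m ℕ.+ m))) (+-comm w δ)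
      μδμ≤2κ : μ * δ * μ ≤ ι 2 * ι K
      μδμ≤2κ = ≤-trans (≤-reflexive (sym (trans (ι-* (m ℕ.* d) m) (cong₂ _*_ (trans (ι-* m d) (cong₂ _*_ ιm ιd)) ιm))))
        (≤-trans (ι-mono mdm≤2K) (≤-reflexive (ι-* 2 K)))
      0<* : ∀ {a b} → 0ℚ < a → 0ℚ < b → 0ℚ < a * b
      0<* {a} {b} 0<a 0<b = positive⁻¹ (a * b) {{pos*pos⇒pos a {{positive 0<a}} b {{positive 0<b}}}}
      0<1 : 0ℚ < 1ℚ
      0<1 = positive⁻¹ 1ℚ
      0<σ : 0ℚ < σ
      0<σ = <-≤-trans 0<1 1≤σ
      0<μ : 0ℚ < μ
      0<μ = 0<* (0<* 0<σ 0<σ) 0<σ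
      0<κ : 0ℚ < ι K
      0<κ = <-≤-trans 0<1 (ι-mono {1} (ℕ.≤-trans 1≤m (ℕ.≤-trans (ℕ.m≤m+n m m) 2m≤K)))
      0<ρ : 0ℚ < ρ
      0<ρ = <-≤-trans (0<* 0<μ 0<σ) δ≤ρ
      0<D̄ : 0ℚ < D̄
      0<D̄ = ≰⇒> λ D̄≤0 → <-irrefl refl (<-≤-trans 0<1 (≤-trans 1≤4σD̄ (≤-trans (*-monoˡ (0≤* (0≤ι 4) (<⇒≤ 0<σ)) D̄≤0) (≤-reflexive (*-zeroʳ (ι 4 * σ))))))
      0<Z : 0ℚ < Z
      0<Z = 0<* (0<* (0<* 0<κ 0<ρ) 0<σ) (0<* 0<μ 0<D̄)
      eq : ∀ a b c P → a * b * (c * P) ≡ a * (b * c * P)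
      eq = solve-∀ ringℚ

  -- One of p and 1 - p is at least 1/2 and the other at least 1/σ, so 2 σ p (1 - p) ≥ 1;
  -- `p[1-p]≤2D̄` supplies the remaining factor 2.
  1≤4σD̄ : ∀ σ → 1ℚ ≤ σ * p → 1ℚ ≤ σ * (1ℚ - p) → 1ℚ ≤ ι 4 * σ * D̄
  1≤4σD̄ σ 1≤σp 1≤σp′ = ≤-trans (cases (≤-total (ι 2 * p) 1ℚ))
    (≤-trans (*-monoˡ (0≤* (0≤ι 2) 0≤σ) (p[1-p]≤2D̄ g-sym)) (≤-reflexive (eq₀ σ D̄)))
    where
    0≤σ : 0ℚ ≤ σ
    0≤σ = ≤-trans (0≤+ (≤-trans 0≤1 1≤σp) (≤-trans 0≤1 1≤σp′)) (≤-reflexive (eq σ p))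
      where
      eq : ∀ σ p → σ * p + σ * (1ℚ - p) ≡ σ
      eq = solve-∀ ringℚ
    eq₀ : ∀ σ D → ι 2 * σ * (ι 2 * D) ≡ ι 4 * σ * D
    eq₀ = solve-∀ ringℚ
    cases : ι 2 * p ≤ 1ℚ ⊎ 1ℚ ≤ ι 2 * p → 1ℚ ≤ ι 2 * σ * (p * (1ℚ - p))
    cases (inj₁ 2p≤1) = ≤-offset ((σ * p - 1ℚ) + σ * p * (1ℚ - ι 2 * p)) (0≤+ (0≤q-p 1≤σp) (0≤* (0≤* 0≤σ 0≤p) (0≤q-p 2p≤1))) (eq σ p)
      where
      eq : ∀ σ p → ι 2 * σ * (p * (1ℚ - p)) ≡ 1ℚ + ((σ * p - 1ℚ) + σ * p * (1ℚ - ι 2 * p))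
      eq = solve-∀ ringℚ
    cases (inj₂ 1≤2p) = ≤-offset ((σ * (1ℚ - p) - 1ℚ) + σ * (1ℚ - p) * (ι 2 * p - 1ℚ)) (0≤+ (0≤q-p 1≤σp′) (0≤* (0≤* 0≤σ (0≤q-p p≤1)) (0≤q-p 1≤2p))) (eq σ p)
      where
      eq : ∀ σ p → ι 2 * σ * (p * (1ℚ - p)) ≡ 1ℚ + ((σ * (1ℚ - p) - 1ℚ) + σ * (1ℚ - p) * (ι 2 * p - 1ℚ))
      eq = solve-∀ ringℚ

  tuple-bound : ∀ s k ℓ q .{{_ : NonZero k}} → s ℕ.^ 10 ℕ.≤ k → k ℕ.* k ℕ.≤ q ℕ.* ℓ →
    2 ℕ.* (k ℕ.* k) ℕ.+ 2 ℕ.* (q ℕ.* ℓ) ℕ.≤ q ℕ.* (k ℕ.* k) → ι s * 𝕡 k ℓ ≤ ι (119 ℕ.+ q)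
  tuple-bound s k ℓ q s¹⁰≤k low high = cases (s ℕ.≤? 119 ℕ.+ q) (≤-total 1ℚ (ι s * p)) (≤-total 1ℚ (ι s * (1ℚ - p)))
    where
    open ≤-Reasoning
    large : ∀ {π} → 𝕡 k ℓ ≤ ι q * π → ι s * π ≤ 1ℚ → ι s * 𝕡 k ℓ ≤ ι (119 ℕ.+ q)
    large {π} 𝕡≤ sπ≤1 = begin
      ι s * 𝕡 k ℓ         ≤⟨ *-monoˡ (0≤ι s) 𝕡≤ ⟩
      ι s * (ι q * π)     ≡⟨ eq (ι s) (ι q) π ⟩
      ι q * (ι s * π)     ≤⟨ *-monoˡ (0≤ι q) sπ≤1 ⟩
      ι q * 1ℚ            ≡⟨ *-identityʳ (ι q) ⟩
      ι q                 ≤⟨ ι-mono (ℕ.m≤n+m q 119) ⟩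
      ι (119 ℕ.+ q)       ∎
      where
      eq : ∀ s q π → s * (q * π) ≡ q * (s * π)
      eq = solve-∀ ringℚ
    cases : Dec (s ℕ.≤ 119 ℕ.+ q) → 1ℚ ≤ ι s * p ⊎ ι s * p ≤ 1ℚ → 1ℚ ≤ ι s * (1ℚ - p) ⊎ ι s * (1ℚ - p) ≤ 1ℚ →
      ι s * 𝕡 k ℓ ≤ ι (119 ℕ.+ q)
    -- Small s is settled by 𝕡 ≤ 1. In the other cases s > 119 + q provides 2 ≤ s for medium density
    -- and q ≤ s ≤ k for high density.
    cases (yes s≤119+q) _ _ = ≤-trans (*-monoˡ (0≤ι s) (𝕡≤1 k ℓ)) (≤-trans (≤-reflexive (*-identityʳ (ι s))) (ι-mono s≤119+q))
    cases (no s≰) (inj₂ σp≤1) _ = large (low-density k ℓ q low) σp≤1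
    cases (no s≰) (inj₁ _) (inj₂ σp′≤1) = large (high-density k ℓ q (ℕ.≤-trans q≤s (ℕ.≤-trans s≤s¹⁰ s¹⁰≤k)) high) σp′≤1
      where
      q≤s : q ℕ.≤ s
      q≤s = ℕ.≤-trans (ℕ.m≤n+m q 119) (ℕ.≰⇒≥ s≰)
      s≤s¹⁰ : s ℕ.≤ s ℕ.^ 10
      s≤s¹⁰ = subst (ℕ._≤ s ℕ.^ 10) (ℕ.^-identityʳ s)
        (ℕ.^-monoʳ-≤ s {{ℕ.>-nonZero (ℕ.≤-trans (ℕ.s≤s ℕ.z≤n) (ℕ.≰⇒> s≰))}} {1} {10} (ℕ.s≤s ℕ.z≤n))
    cases (no s≰) (inj₁ 1≤σp) (inj₁ 1≤σp′) = ≤-trans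
      (medium-density s k ℓ (ℕ.≤-trans (ℕ.m≤m+n 2 (118 ℕ.+ q)) (ℕ.≰⇒> s≰)) s¹⁰≤k (1≤4σD̄ (ι s) 1≤σp 1≤σp′)) (ι-mono (ℕ.m≤m+n 119 q))

-- From subsets to tuples

module ∑ℕ = Sum ℕ.+-*-semiring
open ∑ℕ using (sum; sum-cong-≗)

𝟙ℕ : {P : Set} → Dec P → ℕ
𝟙ℕ P? = bit (does P?)

module _ {A : Set} {P : Pred A 0ℓ} (P? : Decidable P) where

  count : List A → ℕ
  count xs = length (filter P? xs)

  count-++ : ∀ xs ys → count (xs ++ ys) ≡ count xs ℕ.+ count ys
  count-++ xs ys = trans (cong length (filter-++ P? xs ys)) (length-++ (filter P? xs))

  count-∷ : ∀ x xs → count (x ∷ xs) ≡ 𝟙ℕ (P? x) ℕ.+ count xs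
  count-∷ x xs with does (P? x)
  ... | true  = refl
  ... | false = refl

count-map : {A B : Set} {P : Pred B 0ℓ} (P? : Decidable P) (f : A → B) → ∀ xs → count P? (map f xs) ≡ count (P? ∘ f) xs
count-map P? f []       = refl
count-map P? f (x ∷ xs) with does (P? (f x))
... | true  = cong suc (count-map P? f xs)
... | false = count-map P? f xs

filter-map : {A B : Set} {P : Pred B 0ℓ} (P? : Decidable P) (f : A → B) → ∀ xs → filter P? (map f xs) ≡ map f (filter (P? ∘ f) xs)
filter-map P? f []       = refl
filter-map P? f (x ∷ xs) with does (P? (f x))
... | true  = cong (f x ∷_) (filter-map P? f xs)
... | false = filter-map P? f xs

count-tabulate : {A : Set} {P : Pred A 0ℓ} (P? : Decidable P) → ∀ {n} (f : Fin n → A) → count P? (tabulate f) ≡ sum (λ i → 𝟙ℕ (P? (f i)))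
count-tabulate P? {zero}  f = refl
count-tabulate P? {suc n} f = trans (count-∷ P? (f zero) _) (cong (𝟙ℕ (P? (f zero)) ℕ.+_) (count-tabulate P? (f ∘ suc)))

count-cartesianProduct : {A B : Set} {P : Pred (A × B) 0ℓ} (P? : Decidable P) → ∀ {n} (f : Fin n → A) (ys : List B) →
  count P? (cartesianProduct (tabulate f) ys) ≡ sum (λ i → count (λ y → P? (f i , y)) ys)
count-cartesianProduct P? {zero}  f ys = refl
count-cartesianProduct P? {suc n} f ys = trans (count-++ P? (map (f zero ,_) ys) _)
  (cong₂ ℕ._+_ (count-map P? (f zero ,_) ys) (count-cartesianProduct P? (f ∘ suc) ys))

sumOver : ∀ {n} → Subset n → (Fin n → ℕ) → ℕ
sumOver []          f = 0
sumOver (true ∷ A)  f = f zero ℕ.+ sumOver A (f ∘ suc)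
sumOver (false ∷ A) f = sumOver A (f ∘ suc)

sumOver-insert : ∀ {n} (A : Subset n) f i → lookup A i ≡ false → sumOver (A [ i ]≔ true) f ≡ f i ℕ.+ sumOver A f
sumOver-insert (false ∷ A) f zero    _   = refl
sumOver-insert (false ∷ A) f (suc i) i∉A = sumOver-insert A (f ∘ suc) i i∉A
sumOver-insert (true ∷ A)  f (suc i) i∉A = trans (cong (f zero ℕ.+_) (sumOver-insert A (f ∘ suc) i i∉A))
  (eq (f zero) (f (suc i)) _)
  where
  eq : ∀ a b c → a ℕ.+ (b ℕ.+ c) ≡ b ℕ.+ (a ℕ.+ c)
  eq = solve-∀ℕ

sumOver-cong : ∀ {n} (A : Subset n) {f g : Fin n → ℕ} → (∀ i → f i ≡ g i) → sumOver A f ≡ sumOver A g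
sumOver-cong []          f≗g = refl
sumOver-cong (true ∷ A)  f≗g = cong₂ ℕ._+_ (f≗g zero) (sumOver-cong A (f≗g ∘ suc))
sumOver-cong (false ∷ A) f≗g = sumOver-cong A (f≗g ∘ suc)

sumOver-⊥ : ∀ n (f : Fin n → ℕ) → sumOver ⊥ f ≡ 0
sumOver-⊥ zero    f = refl
sumOver-⊥ (suc n) f = sumOver-⊥ n (f ∘ suc)

sum-∈ : ∀ {n} (A : Subset n) (f : Fin n → Bool) → sum (λ i → bit (does (i ∈? A) ∧ f i)) ≡ sumOver A (λ i → bit (f i))
sum-∈ []          f = refl
sum-∈ (true ∷ A)  f = cong (bit (f zero) ℕ.+_) (sum-∈ A (f ∘ suc))
sum-∈ (false ∷ A) f = sum-∈ A (f ∘ suc)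

sum-zero : ∀ n → sum {n} (λ _ → 0) ≡ 0
sum-zero zero    = refl
sum-zero (suc n) = sum-zero n

tailGraph : ∀ {n} → Graph (suc n) → Graph n
tailGraph G = record { adj    = λ i j → adj G (suc i) (suc j)
                     ; symm   = λ i j → symm G (suc i) (suc j)
                     ; irrefl = λ i → irrefl G (suc i) }

edges-sum : ∀ {n} (G : Graph n) A → edges G A ≡ sum (λ i → sum (λ j → 𝟙ℕ (isEdgeIn? G A (i , j))))
edges-sum {n} G A = trans (count-cartesianProduct (isEdgeIn? G A) (λ i → i) (allFin n))
  (sum-cong-≗ λ i → count-tabulate (λ j → isEdgeIn? G A (i , j)) (λ j → j))

-- Row 0 of the double sum holds the edges at the new vertex. Column 0 vanishes since no index is
-- below 0, and the other entries reduce to those of the smaller graph because `<?` and `∈?` compute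
-- under `suc`.
edges-true : ∀ {n} (G : Graph (suc n)) A → edges G (true ∷ A) ≡ sumOver A (λ j → bit (adj G zero (suc j))) ℕ.+ edges (tailGraph G) A
edges-true G A = trans (edges-sum G (true ∷ A)) (cong₂ ℕ._+_ (sum-∈ A (adj G zero ∘ suc)) (sym (edges-sum (tailGraph G) A)))

edges-false : ∀ {n} (G : Graph (suc n)) A → edges G (false ∷ A) ≡ edges (tailGraph G) A
edges-false {n} G A = trans (edges-sum G (false ∷ A)) (trans (cong₂ ℕ._+_ (sum-zero n) refl) (sym (edges-sum (tailGraph G) A)))

degreeIn : ∀ {n} → Graph n → Subset n → Fin n → ℕ
degreeIn G A j = sumOver A (λ i → bit (adj G i j))

edges-insert : ∀ {n} (G : Graph n) A i → lookup A i ≡ false → edges G (A [ i ]≔ true) ≡ edges G A ℕ.+ degreeIn G A i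
edges-insert G (false ∷ A) zero _ = begin
  edges G (true ∷ A)                                                           ≡⟨ edges-true G A ⟩
  sumOver A (λ j → bit (adj G zero (suc j))) ℕ.+ edges (tailGraph G) A
    ≡⟨ ℕ.+-comm _ (edges (tailGraph G) A) ⟩
  edges (tailGraph G) A ℕ.+ sumOver A (λ j → bit (adj G zero (suc j)))
    ≡⟨ cong₂ ℕ._+_ (sym (edges-false G A)) (sumOver-cong A λ j → cong bit (symm G zero (suc j))) ⟩
  edges G (false ∷ A) ℕ.+ degreeIn G (false ∷ A) zero                          ∎
  where open ≡-Reasoning
edges-insert G (false ∷ A) (suc i) i∉A = begin
  edges G (false ∷ A [ i ]≔ true)                             ≡⟨ edges-false G _ ⟩
  edges (tailGraph G) (A [ i ]≔ true)                         ≡⟨ edges-insert (tailGraph G) A i i∉A ⟩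
  edges (tailGraph G) A ℕ.+ degreeIn (tailGraph G) A i
    ≡⟨ cong (ℕ._+ degreeIn (tailGraph G) A i) (edges-false G A) ⟨
  edges G (false ∷ A) ℕ.+ degreeIn G (false ∷ A) (suc i)      ∎
  where open ≡-Reasoning
edges-insert G (true ∷ A) (suc i) i∉A = begin
  edges G (true ∷ A [ i ]≔ true)                              ≡⟨ edges-true G _ ⟩
  sumOver (A [ i ]≔ true) f ℕ.+ edges (tailGraph G) (A [ i ]≔ true)
                                                              ≡⟨ cong₂ ℕ._+_ (sumOver-insert A f i i∉A) (edges-insert (tailGraph G) A i i∉A) ⟩
  f i ℕ.+ sumOver A f ℕ.+ (edges (tailGraph G) A ℕ.+ degreeIn (tailGraph G) A i)
                                                              ≡⟨ eq (f i) (sumOver A f) (edges (tailGraph G) A) (degreeIn (tailGraph G) A i) ⟩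
  sumOver A f ℕ.+ edges (tailGraph G) A ℕ.+ (f i ℕ.+ degreeIn (tailGraph G) A i)
                                                              ≡⟨ cong (ℕ._+ degreeIn G (true ∷ A) (suc i)) (edges-true G A) ⟨
  edges G (true ∷ A) ℕ.+ degreeIn G (true ∷ A) (suc i)        ∎
  where
  open ≡-Reasoning
  f : Fin _ → ℕ
  f j = bit (adj G zero (suc j))
  eq : ∀ a b c d → a ℕ.+ b ℕ.+ (c ℕ.+ d) ≡ b ℕ.+ c ℕ.+ (a ℕ.+ d)
  eq = solve-∀ℕ

edges-⊥ : ∀ {n} (G : Graph n) → edges G ⊥ ≡ 0
edges-⊥ {zero}  G = refl
edges-⊥ {suc n} G = trans (edges-false G ⊥) (edges-⊥ (tailGraph G))

-- Pascal's recursion, which splits on whether the first vertex is chosen. Unlike the filtered list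
-- `kSubsets` it is structural, so sums over k-sets are open to induction.
∑ₖ : ∀ n → ℕ → (Subset n → ℕ) → ℕ
∑ₖ zero    zero    Φ = Φ []
∑ₖ zero    (suc k) Φ = 0
∑ₖ (suc n) zero    Φ = ∑ₖ n zero (Φ ∘ (false ∷_))
∑ₖ (suc n) (suc k) Φ = ∑ₖ n k (Φ ∘ (true ∷_)) ℕ.+ ∑ₖ n (suc k) (Φ ∘ (false ∷_))

kSubsets-zero : ∀ n → kSubsets (suc n) zero ≡ map (false ∷_) (kSubsets n zero)
kSubsets-zero n = trans (filter-++ size? (map (true ∷_) (subsets n)) _)
  (cong₂ _++_ (trans (filter-map size? (true ∷_) (subsets n)) (cong (map (true ∷_)) (filter-none (size? ∘ (true ∷_)) (All.universal (λ _ ()) (subsets n)))))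
              (filter-map size? (false ∷_) (subsets n)))
  where
  size? : Decidable (λ (A : Subset (suc n)) → ∣ A ∣ ≡ 0)
  size? A = ∣ A ∣ ℕ.≟ 0

kSubsets-suc : ∀ n k → kSubsets (suc n) (suc k) ≡ map (true ∷_) (kSubsets n k) ++ map (false ∷_) (kSubsets n (suc k))
kSubsets-suc n k = trans (filter-++ size? (map (true ∷_) (subsets n)) _)
  (cong₂ _++_ (trans (filter-map size? (true ∷_) (subsets n)) (cong (map (true ∷_)) (filter-≐ (size? ∘ (true ∷_)) _ (ℕ.suc-injective , cong suc) (subsets n))))
              (filter-map size? (false ∷_) (subsets n)))
  where
  size? : Decidable (λ (A : Subset (suc n)) → ∣ A ∣ ≡ suc k)
  size? A = ∣ A ∣ ℕ.≟ suc k

count-kSubsets : ∀ n k {P : Pred (Subset n) 0ℓ} (P? : Decidable P) → count P? (kSubsets n k) ≡ ∑ₖ n k (λ A → 𝟙ℕ (P? A))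
count-kSubsets zero    zero    P? = trans (count-∷ P? [] []) (ℕ.+-identityʳ _)
count-kSubsets zero    (suc k) P? = refl
count-kSubsets (suc n) zero    P? = trans (cong (count P?) (kSubsets-zero n))
  (trans (count-map P? (false ∷_) (kSubsets n zero)) (count-kSubsets n zero (P? ∘ (false ∷_))))
count-kSubsets (suc n) (suc k) P? = trans (cong (count P?) (kSubsets-suc n k))
  (trans (count-++ P? (map (true ∷_) (kSubsets n k)) _) (cong₂ ℕ._+_
    (trans (count-map P? (true ∷_) (kSubsets n k)) (count-kSubsets n k (P? ∘ (true ∷_))))
    (trans (count-map P? (false ∷_) (kSubsets n (suc k))) (count-kSubsets n (suc k) (P? ∘ (false ∷_))))))

length-kSubsets : ∀ n k → length (kSubsets n k) ≡ ∑ₖ n k (λ _ → 1)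
length-kSubsets n k = trans (cong length (sym (filter-all (λ A → yes′ A) (All.universal (λ _ → refl) (kSubsets n k))))) (count-kSubsets n k yes′)
  where
  yes′ : Decidable (λ (A : Subset n) → 0 ≡ 0)
  yes′ _ = yes refl

∑ₖ-+ : ∀ n k Φ Ψ → ∑ₖ n k (λ A → Φ A ℕ.+ Ψ A) ≡ ∑ₖ n k Φ ℕ.+ ∑ₖ n k Ψ
∑ₖ-+ zero    zero    Φ Ψ = refl
∑ₖ-+ zero    (suc k) Φ Ψ = refl
∑ₖ-+ (suc n) zero    Φ Ψ = ∑ₖ-+ n zero _ _
∑ₖ-+ (suc n) (suc k) Φ Ψ = trans (cong₂ ℕ._+_ (∑ₖ-+ n k _ _) (∑ₖ-+ n (suc k) _ _)) (eq (∑ₖ n k _) _ _ _)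
  where
  eq : ∀ a b c d → a ℕ.+ b ℕ.+ (c ℕ.+ d) ≡ a ℕ.+ c ℕ.+ (b ℕ.+ d)
  eq = solve-∀ℕ

∑ₖ-⊥ : ∀ n Φ → ∑ₖ n 0 Φ ≡ Φ ⊥
∑ₖ-⊥ zero    Φ = refl
∑ₖ-⊥ (suc n) Φ = ∑ₖ-⊥ n (Φ ∘ (false ∷_))

extensions : ∀ {n} → (Subset n → ℕ) → Subset n → ℕ
extensions Φ A = sum λ i → if lookup A i then 0 else Φ (A [ i ]≔ true)

-- Every (k+1)-set arises from k+1 pairs of a k-set and a new element.
∑ₖ-extensions : ∀ n k Φ → ∑ₖ n k (extensions Φ) ≡ suc k ℕ.* ∑ₖ n (suc k) Φ
∑ₖ-extensions zero    zero    Φ = refl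
∑ₖ-extensions zero    (suc k) Φ = sym (ℕ.*-zeroʳ (suc (suc k)))
∑ₖ-extensions (suc n) zero    Φ = trans (∑ₖ-+ n 0 _ _) (trans (cong (∑ₖ n 0 (Φ ∘ (true ∷_)) ℕ.+_) (∑ₖ-extensions n 0 (Φ ∘ (false ∷_)))) (eq (∑ₖ n 0 _) _))
  where
  eq : ∀ a b → a ℕ.+ 1 ℕ.* b ≡ 1 ℕ.* (a ℕ.+ b)
  eq = solve-∀ℕ
∑ₖ-extensions (suc n) (suc k) Φ = trans (cong₂ ℕ._+_ (∑ₖ-extensions n k (Φ ∘ (true ∷_)))
  (trans (∑ₖ-+ n (suc k) _ _) (cong (∑ₖ n (suc k) (Φ ∘ (true ∷_)) ℕ.+_) (∑ₖ-extensions n (suc k) (Φ ∘ (false ∷_)))))) (eq k (∑ₖ n (suc k) _) _)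
  where
  eq : ∀ k a b → suc k ℕ.* a ℕ.+ (a ℕ.+ suc (suc k) ℕ.* b) ≡ suc (suc k) ℕ.* (a ℕ.+ b)
  eq = solve-∀ℕ

-- At A this sums Φ over the enlargements of A by k distinct new vertices, in every order: the
-- injective counterpart of `𝔼`.
extensions^ : ∀ {n} → ℕ → (Subset n → ℕ) → Subset n → ℕ
extensions^ zero    Φ = Φ
extensions^ (suc k) Φ = extensions (extensions^ k Φ)

extensions^-⊥ : ∀ n k Φ → extensions^ k Φ ⊥ ≡ k ! ℕ.* ∑ₖ n k Φ
extensions^-⊥ n k Φ = begin
  extensions^ k Φ ⊥                     ≡⟨ ∑ₖ-⊥ n (extensions^ k Φ) ⟨
  ∑ₖ n 0 (extensions^ k Φ)              ≡⟨ ℕ.*-identityʳ _ ⟨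
  ∑ₖ n 0 (extensions^ k Φ) ℕ.* 0 !      ≡⟨ go k 0 ⟩
  (k ℕ.+ 0) ! ℕ.* ∑ₖ n (k ℕ.+ 0) Φ      ≡⟨ cong (λ k → k ! ℕ.* ∑ₖ n k Φ) (ℕ.+-identityʳ k) ⟩
  k ! ℕ.* ∑ₖ n k Φ                      ∎
  where
  open ≡-Reasoning
  go : ∀ k j → ∑ₖ n j (extensions^ k Φ) ℕ.* j ! ≡ (k ℕ.+ j) ! ℕ.* ∑ₖ n (k ℕ.+ j) Φ
  go zero    j = ℕ.*-comm (∑ₖ n j Φ) (j !)
  go (suc k) j = begin
    ∑ₖ n j (extensions (extensions^ k Φ)) ℕ.* j !
      ≡⟨ cong (ℕ._* j !) (∑ₖ-extensions n j (extensions^ k Φ)) ⟩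
    suc j ℕ.* ∑ₖ n (suc j) (extensions^ k Φ) ℕ.* j !
      ≡⟨ eq (suc j) (∑ₖ n (suc j) (extensions^ k Φ)) (j !) ⟩
    ∑ₖ n (suc j) (extensions^ k Φ) ℕ.* (suc j ℕ.* j !)       ≡⟨ go k (suc j) ⟩
    (k ℕ.+ suc j) ! ℕ.* ∑ₖ n (k ℕ.+ suc j) Φ                 ≡⟨ cong (λ k → k ! ℕ.* ∑ₖ n k Φ) (ℕ.+-suc k j) ⟩
    (suc k ℕ.+ j) ! ℕ.* ∑ₖ n (suc k ℕ.+ j) Φ                 ∎
    where
    eq : ∀ a b c → a ℕ.* b ℕ.* c ≡ b ℕ.* (a ℕ.* c)
    eq = solve-∀ℕ

-- Injective tuples among all tuples

extensions-const : ∀ {n} c (A : Subset n) → extensions (λ _ → c) A ℕ.+ ∣ A ∣ ℕ.* c ≡ n ℕ.* c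
extensions-const c []          = refl
extensions-const c (true ∷ A)  = trans (eq (extensions (λ _ → c) A) c (∣ A ∣ ℕ.* c)) (cong (c ℕ.+_) (extensions-const c A))
  where
  eq : ∀ e c b → e ℕ.+ (c ℕ.+ b) ≡ c ℕ.+ (e ℕ.+ b)
  eq = solve-∀ℕ
extensions-const c (false ∷ A) = trans (ℕ.+-assoc c _ _) (cong (c ℕ.+_) (extensions-const c A))

sum-mono : ∀ {n} {f g : Fin n → ℕ} → (∀ i → f i ℕ.≤ g i) → sum f ℕ.≤ sum g
sum-mono {zero}  f≤g = ℕ.z≤n
sum-mono {suc n} f≤g = ℕ.+-mono-≤ (f≤g zero) (sum-mono (f≤g ∘ suc))

extensions-mono : ∀ {n} {Φ Ψ : Subset n → ℕ} A → (∀ i → lookup A i ≡ false → Φ (A [ i ]≔ true) ℕ.≤ Ψ (A [ i ]≔ true)) →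
                  extensions Φ A ℕ.≤ extensions Ψ A
extensions-mono {Φ = Φ} {Ψ} A Φ≤Ψ = sum-mono λ i → pointwise i (lookup A i) refl
  where
  pointwise : ∀ i b → lookup A i ≡ b → (if b then 0 else Φ (A [ i ]≔ true)) ℕ.≤ (if b then 0 else Ψ (A [ i ]≔ true))
  pointwise i true  _   = ℕ.z≤n
  pointwise i false i∉A = Φ≤Ψ i i∉A

∣insert∣ : ∀ {n} (A : Subset n) i → lookup A i ≡ false → ∣ A [ i ]≔ true ∣ ≡ suc ∣ A ∣
∣insert∣ (false ∷ A) zero    _   = refl
∣insert∣ (false ∷ A) (suc i) i∉A = ∣insert∣ A i i∉A
∣insert∣ (true ∷ A)  (suc i) i∉A = cong suc (∣insert∣ A i i∉A)

-- Every one of the k choices has at least M candidates. The room condition is inherited, since a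
-- choice lowers k and raises the size of A by 1.
power≤extensions^ : ∀ {n} k M (A : Subset n) → M ℕ.+ k ℕ.+ ∣ A ∣ ℕ.≤ n → M ℕ.^ k ℕ.≤ extensions^ k (λ _ → 1) A
power≤extensions^ zero    M A _ = ℕ.≤-refl
power≤extensions^ {n} (suc k) M A room = begin
  M ℕ.* M ℕ.^ k                            ≤⟨ ℕ.+-cancelʳ-≤ (∣ A ∣ ℕ.* M ℕ.^ k) _ _ (begin
      M ℕ.* M ℕ.^ k ℕ.+ ∣ A ∣ ℕ.* M ℕ.^ k                        ≡⟨ ℕ.*-distribʳ-+ (M ℕ.^ k) M ∣ A ∣ ⟨
      (M ℕ.+ ∣ A ∣) ℕ.* M ℕ.^ k
        ≤⟨ ℕ.*-monoˡ-≤ (M ℕ.^ k) (ℕ.≤-trans (ℕ.+-monoˡ-≤ ∣ A ∣ (ℕ.m≤m+n M (suc k))) room) ⟩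
      n ℕ.* M ℕ.^ k                                              ≡⟨ extensions-const (M ℕ.^ k) A ⟨
      extensions (λ _ → M ℕ.^ k) A ℕ.+ ∣ A ∣ ℕ.* M ℕ.^ k         ∎) ⟩
  extensions (λ _ → M ℕ.^ k) A
    ≤⟨ extensions-mono {Ψ = extensions^ k (λ _ → 1)} A (λ i i∉A → power≤extensions^ k M (A [ i ]≔ true)
                                                (subst (ℕ._≤ n) (trans (eq M k ∣ A ∣) (cong (M ℕ.+ k ℕ.+_) (sym (∣insert∣ A i i∉A)))) room)) ⟩
  extensions (extensions^ k (λ _ → 1)) A   ∎
  where
  open ℕ.≤-Reasoning
  eq : ∀ M k a → M ℕ.+ suc k ℕ.+ a ≡ M ℕ.+ k ℕ.+ suc a
  eq = solve-∀ℕ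

-- This is (1 - k/n)^j ≥ 1 - j k/n for n = M + k, multiplied by n^(j + 1).
bernoulli : ∀ M k j → (M ℕ.+ k) ℕ.^ j ℕ.* (M ℕ.+ k) ℕ.≤ M ℕ.^ j ℕ.* (M ℕ.+ k) ℕ.+ j ℕ.* k ℕ.* (M ℕ.+ k) ℕ.^ j
bernoulli M k zero    = ℕ.m≤m+n _ _
bernoulli M k (suc j) = begin
  n ℕ.* n ℕ.^ j ℕ.* n                                                  ≡⟨ ℕ.*-assoc n (n ℕ.^ j) n ⟩
  n ℕ.* (n ℕ.^ j ℕ.* n)                                                ≤⟨ ℕ.*-monoʳ-≤ n (bernoulli M k j) ⟩
  n ℕ.* (M ℕ.^ j ℕ.* n ℕ.+ j ℕ.* k ℕ.* n ℕ.^ j)                        ≡⟨ eq₁ M k (M ℕ.^ j) j (n ℕ.^ j) ⟩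
  M ℕ.* M ℕ.^ j ℕ.* n ℕ.+ k ℕ.* n ℕ.* M ℕ.^ j ℕ.+ j ℕ.* k ℕ.* (n ℕ.* n ℕ.^ j)
    ≤⟨ ℕ.+-monoˡ-≤ (j ℕ.* k ℕ.* (n ℕ.* n ℕ.^ j)) (ℕ.+-monoʳ-≤ (M ℕ.* M ℕ.^ j ℕ.* n) (ℕ.*-monoʳ-≤ (k ℕ.* n) (ℕ.^-monoˡ-≤ j (ℕ.m≤m+n M k)))) ⟩
  M ℕ.* M ℕ.^ j ℕ.* n ℕ.+ k ℕ.* n ℕ.* n ℕ.^ j ℕ.+ j ℕ.* k ℕ.* (n ℕ.* n ℕ.^ j)
    ≡⟨ eq₂ (M ℕ.* M ℕ.^ j ℕ.* n) k n (n ℕ.^ j) j ⟩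
  M ℕ.* M ℕ.^ j ℕ.* n ℕ.+ suc j ℕ.* k ℕ.* (n ℕ.* n ℕ.^ j)              ∎
  where
  open ℕ.≤-Reasoning
  n : ℕ
  n = M ℕ.+ k
  eq₁ : ∀ M k Mj j nj → (M ℕ.+ k) ℕ.* (Mj ℕ.* (M ℕ.+ k) ℕ.+ j ℕ.* k ℕ.* nj)
                      ≡ M ℕ.* Mj ℕ.* (M ℕ.+ k) ℕ.+ k ℕ.* (M ℕ.+ k) ℕ.* Mj ℕ.+ j ℕ.* k ℕ.* ((M ℕ.+ k) ℕ.* nj)
  eq₁ = solve-∀ℕ
  eq₂ : ∀ a k n nj j → a ℕ.+ k ℕ.* n ℕ.* nj ℕ.+ j ℕ.* k ℕ.* (n ℕ.* nj) ≡ a ℕ.+ suc j ℕ.* k ℕ.* (n ℕ.* nj)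
  eq₂ = solve-∀ℕ

power≤twice-power : ∀ M k → 2 ℕ.* (k ℕ.* k) ℕ.≤ M ℕ.+ k → (M ℕ.+ k) ℕ.^ k ℕ.≤ 2 ℕ.* M ℕ.^ k
power≤twice-power M zero    _      = ℕ.m≤m+n 1 1
power≤twice-power M k@(suc _) 2k²≤n = ℕ.*-cancelˡ-≤ n {{ℕ.>-nonZero (ℕ.≤-trans (ℕ.s≤s ℕ.z≤n) (ℕ.m≤n+m k M))}}
  (ℕ.+-cancelʳ-≤ (n ℕ.* n ℕ.^ k) _ _ (begin
    n ℕ.* n ℕ.^ k ℕ.+ n ℕ.* n ℕ.^ k                        ≡⟨ eq₁ n (n ℕ.^ k) ⟩
    2 ℕ.* (n ℕ.^ k ℕ.* n)                                  ≤⟨ ℕ.*-monoʳ-≤ 2 (bernoulli M k k) ⟩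
    2 ℕ.* (M ℕ.^ k ℕ.* n ℕ.+ k ℕ.* k ℕ.* n ℕ.^ k)          ≡⟨ eq₂ (M ℕ.^ k) n (k ℕ.* k) (n ℕ.^ k) ⟩
    n ℕ.* (2 ℕ.* M ℕ.^ k) ℕ.+ 2 ℕ.* (k ℕ.* k) ℕ.* n ℕ.^ k
      ≤⟨ ℕ.+-monoʳ-≤ (n ℕ.* (2 ℕ.* M ℕ.^ k)) (ℕ.*-monoˡ-≤ (n ℕ.^ k) 2k²≤n) ⟩
    n ℕ.* (2 ℕ.* M ℕ.^ k) ℕ.+ n ℕ.* n ℕ.^ k                ∎))
  where
  open ℕ.≤-Reasoning
  n : ℕ
  n = M ℕ.+ k
  eq₁ : ∀ n a → n ℕ.* a ℕ.+ n ℕ.* a ≡ 2 ℕ.* (a ℕ.* n)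
  eq₁ = solve-∀ℕ
  eq₂ : ∀ m n k a → 2 ℕ.* (m ℕ.* n ℕ.+ k ℕ.* a) ≡ n ℕ.* (2 ℕ.* m) ℕ.+ 2 ℕ.* k ℕ.* a
  eq₂ = solve-∀ℕ

-- The uniform distribution on the vertices

module ∑ℚ = Sum (CommutativeRing.semiring +-*-commutativeRing)

uniform : ∀ n .{{_ : NonZero n}} → Expectation (Fin n)
uniform n = record
  { E       = λ f → r * ∑ℚ.sum f
  ; E-mono  = λ f≤g → *-monoˡ 0≤r (sum-mono≤ f≤g)
  ; E-const = λ c → trans (cong (r *_) (sum-const n c)) (trans (sym (*-assoc r (ι n) c)) (trans (cong (_* c) r*n≡1) (*-identityˡ c)))
  ; E-+     = λ f g → trans (cong (r *_) (∑ℚ.∑-distrib-+ f g)) (*-distribˡ-+ r (∑ℚ.sum f) (∑ℚ.sum g))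
  ; E-*     = λ c f → trans (cong (r *_) (sym (∑ℚ.*-distribˡ-sum c f))) (exchange r c (∑ℚ.sum f))
  ; E-swap  = λ f → cong (r *_) (trans (sym (∑ℚ.*-distribˡ-sum r (λ x → ∑ℚ.sum (f x))))
                (trans (cong (r *_) (∑ℚ.∑-comm f)) (∑ℚ.*-distribˡ-sum r (λ y → ∑ℚ.sum (λ x → f x y)))))
  }
  where
  instance
    n-pos : Positive (ι n)
    n-pos = positive (0<ι n)
    n-nonZero : ℚ.NonZero (ι n)
    n-nonZero = pos⇒nonZero (ι n)
  r : ℚ
  r = 1/ ι n
  r*n≡1 : r * ι n ≡ 1ℚ
  r*n≡1 = *-inverseˡ (ι n)
  0≤r : 0ℚ ≤ r
  0≤r = <⇒≤ (positive⁻¹ r {{1/pos⇒pos (ι n)}})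
  exchange : ∀ r c s → r * (c * s) ≡ c * (r * s)
  exchange = solve-∀ ringℚ
  sum-mono≤ : ∀ {m} {f g : Fin m → ℚ} → (∀ i → f i ≤ g i) → ∑ℚ.sum f ≤ ∑ℚ.sum g
  sum-mono≤ {zero}  f≤g = ≤-refl
  sum-mono≤ {suc m} f≤g = +-mono-≤ (f≤g zero) (sum-mono≤ (f≤g ∘ suc))
  sum-const : ∀ m c → ∑ℚ.sum {m} (λ _ → c) ≡ ι m * c
  sum-const zero    c = sym (*-zeroˡ c)
  sum-const (suc m) c = trans (cong (c +_) (sum-const m c)) (eq c (ι m))
    where
    eq : ∀ c m → c + m * c ≡ (1ℚ + m) * c
    eq = solve-∀ ringℚ

ι-sum≤ : ∀ n .{{_ : NonZero n}} (f : Fin n → ℕ) (h : Fin n → ℚ) → (∀ i → ι (f i) ≤ h i) →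
  ι (∑ℕ.sum f) ≤ ι n * Expectation.E (uniform n) h
ι-sum≤ n f h f≤h = ≤-trans (go f h f≤h) (≤-reflexive (sym
  (trans (sym (*-assoc (ι n) (1/ ι n) (∑ℚ.sum h))) (trans (cong (_* ∑ℚ.sum h) (*-inverseʳ (ι n))) (*-identityˡ _)))))
  where
  instance
    n-nonZero : ℚ.NonZero (ι n)
    n-nonZero = pos⇒nonZero (ι n) {{positive (0<ι n)}}
  go : ∀ {m} (f : Fin m → ℕ) (h : Fin m → ℚ) → (∀ i → ι (f i) ≤ h i) → ι (∑ℕ.sum f) ≤ ∑ℚ.sum h
  go {zero}  f h f≤h = ≤-refl
  go {suc m} f h f≤h = ≤-trans (≤-reflexive (ι-+ (f zero) _)) (+-mono-≤ (f≤h zero) (go (f ∘ suc) (h ∘ suc) (f≤h ∘ suc)))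

ι-𝟙ℕ : {P : Set} (P? : Dec P) → ι (𝟙ℕ P?) ≡ 𝟙 P?
ι-𝟙ℕ (yes _) = refl
ι-𝟙ℕ (no  _) = refl

module _ {n} .{{_ : NonZero n}} (G : Graph n) where
  open Expectation (uniform n)
  open Tuples (uniform n)
  open EdgeCount (uniform n) (adj G)

  X-cong : ∀ {m a b} {h k : Fin n → ℕ} → a ≡ b → (∀ y → h y ≡ k y) → ∀ (v : Vec (Fin n) m) → X a h v ≡ X b k v
  X-cong a≡b h≗k []      = a≡b
  X-cong a≡b h≗k (x ∷ v) = X-cong (cong₂ ℕ._+_ a≡b (h≗k x)) (λ y → cong (bit (adj G x y) ℕ.+_) (h≗k y)) v

  -- By `edges-insert`, the pair of `edges G A` and `degreeIn G A` is the state that `X` keeps after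
  -- the vertices of A. A repeated vertex contributes 0 on the left and a nonnegative amount on the
  -- right.
  extensions^≤tuples : ∀ k ℓ A → ι (extensions^ k (λ A → 𝟙ℕ (edges G A ℕ.≟ ℓ)) A)
    ≤ ι (n ℕ.^ k) * 𝔼 k (λ v → 𝟙 (X (edges G A) (degreeIn G A) v ℕ.≟ ℓ))
  extensions^≤tuples zero    ℓ A = ≤-reflexive (trans (ι-𝟙ℕ (edges G A ℕ.≟ ℓ)) (sym (*-identityˡ _)))
  extensions^≤tuples (suc k) ℓ A = begin
    ι (extensions Φ A)
      ≤⟨ ι-sum≤ n _ (λ i → ι (n ℕ.^ k) * p i) (λ i → term i (lookup A i) refl) ⟩
    ι n * E (λ i → ι (n ℕ.^ k) * p i)        ≡⟨ cong (ι n *_) (E-* (ι (n ℕ.^ k)) p) ⟩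
    ι n * (ι (n ℕ.^ k) * E p)                ≡⟨ *-assoc (ι n) (ι (n ℕ.^ k)) (E p) ⟨
    ι n * ι (n ℕ.^ k) * E p                  ≡⟨ cong (_* E p) (ι-* n (n ℕ.^ k)) ⟨
    ι (n ℕ.* n ℕ.^ k) * E p                  ∎
    where
    open ≤-Reasoning
    Φ : Subset n → ℕ
    Φ = extensions^ k (λ A → 𝟙ℕ (edges G A ℕ.≟ ℓ))
    p : Fin n → ℚ
    p i = 𝔼 k λ v → 𝟙 (X (edges G A) (degreeIn G A) (i ∷ v) ℕ.≟ ℓ)
    term : ∀ i b → lookup A i ≡ b → ι (if b then 0 else Φ (A [ i ]≔ true)) ≤ ι (n ℕ.^ k) * p i
    term i true  _   = 0≤* (0≤ι (n ℕ.^ k)) (0≤𝔼 k λ v → 0≤𝟙 (X (edges G A) (degreeIn G A) (i ∷ v) ℕ.≟ ℓ))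
    term i false i∉A = ≤-trans (extensions^≤tuples k ℓ (A [ i ]≔ true)) (≤-reflexive (cong (ι (n ℕ.^ k) *_) (𝔼-cong k λ v →
      cong (λ x → 𝟙 (x ℕ.≟ ℓ)) (X-cong (edges-insert G A i i∉A) (λ y → sumOver-insert A (λ j → bit (adj G j y)) i i∉A) v))))

toℚᵘ-ι : ∀ n → toℚᵘ (ι n) ℚᵘ.≃ ℚᵘ.mkℚᵘ (ℤ.+ n) 0
toℚᵘ-ι zero    = ℚᵘ.≃-refl
toℚᵘ-ι (suc n) = begin-equality
  toℚᵘ (1ℚ + ι n)                         ≃⟨ toℚᵘ-homo-+ 1ℚ (ι n) ⟩
  toℚᵘ 1ℚ ℚᵘ.+ toℚᵘ (ι n)                 ≃⟨ ℚᵘ.+-congʳ (toℚᵘ 1ℚ) (toℚᵘ-ι n) ⟩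
  ℚᵘ.mkℚᵘ (ℤ.+ 1) 0 ℚᵘ.+ ℚᵘ.mkℚᵘ (ℤ.+ n) 0
    ≃⟨ ℚᵘ.*≡* (cong (ℤ._* ℤ.+ 1) (trans (cong (λ t → ℤ.+ 1 ℤ.+ t) (ℤ.*-identityʳ (ℤ.+ n))) refl)) ⟩
  ℚᵘ.mkℚᵘ (ℤ.+ suc n) 0                     ∎
  where open ℚᵘ.≤-Reasoning

/-*-ι : ∀ a b → ℤ.+ a / suc b * ι (suc b) ≡ ι a
/-*-ι a b = toℚᵘ-injective (begin-equality
  toℚᵘ (ℤ.+ a / suc b * ι (suc b))                  ≃⟨ toℚᵘ-homo-* (ℤ.+ a / suc b) (ι (suc b)) ⟩
  toℚᵘ (ℤ.+ a / suc b) ℚᵘ.* toℚᵘ (ι (suc b))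
    ≃⟨ ℚᵘ.*-cong (toℚᵘ-fromℚᵘ (ℚᵘ.mkℚᵘ (ℤ.+ a) b)) (toℚᵘ-ι (suc b)) ⟩
  ℚᵘ.mkℚᵘ (ℤ.+ a) b ℚᵘ.* ℚᵘ.mkℚᵘ (ℤ.+ suc b) 0
    ≃⟨ ℚᵘ.*≡* (trans (ℤ.*-identityʳ (ℤ.+ a ℤ.* ℤ.+ suc b)) (cong (λ c → ℤ.+ a ℤ.* ℤ.+ c) (sym (ℕ.*-identityʳ (suc b))))) ⟩
  ℚᵘ.mkℚᵘ (ℤ.+ a) 0                                 ≃⟨ toℚᵘ-ι a ⟨
  toℚᵘ (ι a)                                      ∎)
  where open ℚᵘ.≤-Reasoning

ratio-bound : ∀ s C a b → ι s * ι a ≤ ι C * ι b → ι s * ratio a b ≤ ι C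
ratio-bound s C a zero    _ = ≤-trans (≤-reflexive (*-zeroʳ (ι s))) (0≤ι C)
ratio-bound s C a (suc b) h = *-cancelʳ-≤-pos (ι (suc b)) {{positive (0<ι (suc b))}}
  (≤-trans (≤-reflexive (trans (*-assoc (ι s) (ℤ.+ a / suc b) (ι (suc b))) (cong (ι s *_) (/-*-ι a b)))) h)

-- At least half of the n^k tuples are injective when n ≥ 2k².
prob-bound : ∀ {n} (G : Graph n) s k ℓ q .{{_ : NonZero k}} → 2 ℕ.* (k ℕ.* k) ℕ.≤ n → s ℕ.^ 10 ℕ.≤ k → k ℕ.* k ℕ.≤ q ℕ.* ℓ →
  2 ℕ.* (k ℕ.* k) ℕ.+ 2 ℕ.* (q ℕ.* ℓ) ℕ.≤ q ℕ.* (k ℕ.* k) → ι s * prob G k ℓ ≤ ι (2 ℕ.* (119 ℕ.+ q))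
prob-bound {n} G s k ℓ q 2k²≤n s¹⁰≤k low high =
  subst₂ (λ a b → ι s * ratio a b ≤ ι (2 ℕ.* C)) (sym (count-kSubsets n k (λ A → edges G A ℕ.≟ ℓ))) (sym (length-kSubsets n k))
    (ratio-bound s (2 ℕ.* C) a b (*-cancelˡ-≤-pos (ι (k !)) {{positive (0<ι (k !) {{k ℕ.!≢0}})}} (begin
      ι (k !) * (ι s * ι a)                       ≡⟨ eq₁ (ι (k !)) (ι s) (ι a) ⟩
      ι s * (ι (k !) * ι a)
        ≡⟨ cong (ι s *_) (trans (sym (ι-* (k !) a)) (cong ι (sym (extensions^-⊥ n k Φ)))) ⟩
      ι s * ι (extensions^ k Φ ⊥)                 ≤⟨ *-monoˡ (0≤ι s) (extensions^≤tuples G k ℓ ⊥) ⟩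
      ι s * (ι (n ℕ.^ k) * 𝔼 k (λ v → 𝟙 (X (edges G ⊥) (degreeIn G ⊥) v ℕ.≟ ℓ)))
                                                  ≡⟨ cong (λ p → ι s * (ι (n ℕ.^ k) * p)) (𝔼-cong k λ v → cong (λ x → 𝟙 (x ℕ.≟ ℓ))
                                                       (X-cong G (edges-⊥ G) (λ y → sumOver-⊥ n _) v)) ⟩
      ι s * (ι (n ℕ.^ k) * 𝕡 k ℓ)                 ≡⟨ eq₁ (ι s) (ι (n ℕ.^ k)) (𝕡 k ℓ) ⟩
      ι (n ℕ.^ k) * (ι s * 𝕡 k ℓ)
        ≤⟨ *-monoˡ (0≤ι (n ℕ.^ k)) (Anticoncentrated.tuple-bound (uniform n) (adj G) (symm G) s k ℓ q s¹⁰≤k low high) ⟩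
      ι (n ℕ.^ k) * ι C                           ≤⟨ *-monoʳ (0≤ι C) (ι-mono n^k≤) ⟩
      ι (2 ℕ.* (k ! ℕ.* b)) * ι C
        ≡⟨ cong (_* ι C) (trans (ι-* 2 (k ! ℕ.* b)) (cong (ι 2 *_) (ι-* (k !) b))) ⟩
      ι 2 * (ι (k !) * ι b) * ι C                 ≡⟨ eq₂ (ι 2) (ι (k !)) (ι b) (ι C) ⟩
      ι (k !) * (ι 2 * ι C * ι b)                 ≡⟨ cong (λ t → ι (k !) * (t * ι b)) (ι-* 2 C) ⟨
      ι (k !) * (ι (2 ℕ.* C) * ι b)               ∎)))
  where
  instance
    n-nonZero : NonZero n
    n-nonZero = ℕ.>-nonZero (ℕ.≤-trans (ℕ.*-mono-≤ {1} {2} (ℕ.s≤s ℕ.z≤n) (ℕ.>-nonZero⁻¹ (k ℕ.* k) {{ℕ.m*n≢0 k k}})) 2k²≤n)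
  open ≤-Reasoning
  open Tuples (uniform n)
  open EdgeCount (uniform n) (adj G)
  C a b M : ℕ
  C = 119 ℕ.+ q
  Φ : Subset n → ℕ
  Φ A = 𝟙ℕ (edges G A ℕ.≟ ℓ)
  a = ∑ₖ n k Φ
  b = ∑ₖ n k (λ _ → 1)
  M = n ℕ.∸ k
  M+k≡n : M ℕ.+ k ≡ n
  M+k≡n = ℕ.m∸n+n≡m (ℕ.≤-trans (ℕ.≤-trans (ℕ.m≤m*n k k) (ℕ.m≤n*m (k ℕ.* k) 2)) 2k²≤n)
  n^k≤ : n ℕ.^ k ℕ.≤ 2 ℕ.* (k ! ℕ.* b)
  n^k≤ = ℕ.≤-trans (subst (λ n → n ℕ.^ k ℕ.≤ 2 ℕ.* M ℕ.^ k) M+k≡n (power≤twice-power M k (ℕ.≤-trans 2k²≤n (ℕ.≤-reflexive (sym M+k≡n)))))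
    (ℕ.*-monoʳ-≤ 2 (ℕ.≤-trans (power≤extensions^ k M ⊥ (ℕ.≤-reflexive (trans (cong (M ℕ.+ k ℕ.+_) (∣⊥∣≡0 n)) (trans (ℕ.+-identityʳ _) M+k≡n))))
      (ℕ.≤-reflexive (extensions^-⊥ n k (λ _ → 1)))))
  eq₁ : ∀ a b c → a * (b * c) ≡ b * (a * c)
  eq₁ = solve-∀ ringℚ
  eq₂ : ∀ t k b c → t * (k * b) * c ≡ k * (t * c * b)
  eq₂ = solve-∀ ringℚ

-- Passage to real numbers

ι-cancel : ∀ {m n} → ι m ≤ ι n → m ℕ.≤ n
ι-cancel {m} {n} ιm≤ιn = ℕ.≮⇒≥ λ n<m → <-irrefl refl (<-≤-trans (n<1+n n) (≤-trans (ι-mono n<m) ιm≤ιn))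
  where
  n<1+n : ∀ n → ι n < ι (suc n)
  n<1+n n = subst (_< 1ℚ + ι n) (+-identityˡ (ι n)) (+-monoˡ-< (ι n) (positive⁻¹ 1ℚ))

archimedean : ∀ ε → 0ℚ < ε → ∃[ q ] (1ℚ ≤ ι q * ε)
archimedean ε@(mkℚ ℤ.+[1+ p ] d _) _ = suc d , (begin
  1ℚ                                    ≤⟨ ι-mono {1} {suc p} (ℕ.s≤s ℕ.z≤n) ⟩
  ι (suc p)                             ≡⟨ /-*-ι (suc p) d ⟨
  ℤ.+ suc p / suc d * ι (suc d)         ≡⟨ cong (_* ι (suc d)) (↥p/↧p≡p ε) ⟩
  ε * ι (suc d)                         ≡⟨ *-comm ε (ι (suc d)) ⟩
  ι (suc d) * ε                         ∎)
  where open ≤-Reasoning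
archimedean (mkℚ ℤ.+0 _ _)       (*<* (ℤ.+<+ ()))
archimedean (mkℚ ℤ.-[1+ _ ] _ _) (*<* ())

integerRoot : ∀ e .{{_ : NonZero e}} k → ∃[ s ] (s ℕ.^ e ℕ.≤ k × k ℕ.< suc s ℕ.^ e)
integerRoot (suc e) k = search k (ℕ.m≤m*n (suc k) (suc k ℕ.^ e) {{ℕ.m^n≢0 (suc k) e}})
  where
  search : ∀ b → k ℕ.< suc b ℕ.^ suc e → ∃[ s ] (s ℕ.^ suc e ℕ.≤ k × k ℕ.< suc s ℕ.^ suc e)
  search zero    k<      = 0 , ℕ.z≤n , k<
  search (suc b) k< with suc b ℕ.^ suc e ℕ.≤? k
  ... | yes ≤k = suc b , ≤k , k<
  ... | no  ≰k = search b (ℕ.≰⇒> ≰k)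

^-distribʳ-* : ∀ e m n → (m ℕ.* n) ℕ.^ e ≡ m ℕ.^ e ℕ.* n ℕ.^ e
^-distribʳ-* zero    m n = refl
^-distribʳ-* (suc e) m n = trans (cong (m ℕ.* n ℕ.*_) (^-distribʳ-* e m n)) (ℕ.[m*n]*[o*p]≡[m*o]*[n*p] m n (m ℕ.^ e) (n ℕ.^ e))

-- Behind it is 1/(s + 1) < k^(-1/d). At precision M = j + 1, comparing d-th powers in the
-- maximality of r = J M excludes (r + 1)(s + 1) < M, and M times the approximation is r.
inverseRoot-lower : ∀ k d .{{_ : NonZero k}} .{{_ : NonZero d}} s → k ℕ.< suc s ℕ.^ d → ∀ j →
  ι (suc j) ≤ ι (suc s) * (ι (suc j) * seq (k ^-1/ d) j + 1ℚ)
inverseRoot-lower k d s k<[1+s]^d j = begin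
  ι M
    ≤⟨ ι-mono (ℕ.≮⇒≥ λ [1+J][1+s]<M → ℕ.<-irrefl refl (absurd (ℕ.<⇒≤ [1+J][1+s]<M))) ⟩
  ι (suc r ℕ.* suc s)                     ≡⟨ ι-* (suc r) (suc s) ⟩
  (1ℚ + ι r) * ι (suc s)                  ≡⟨ cong (λ t → (1ℚ + t) * ι (suc s)) (/-*-ι r j) ⟨
  (1ℚ + a * ι M) * ι (suc s)              ≡⟨ eq a (ι M) (ι (suc s)) ⟩
  ι (suc s) * (ι M * a + 1ℚ)              ∎
  where
  open ≤-Reasoning
  M r : ℕ
  M = suc j
  r = InverseRoot.J k d M
  a : ℚ
  a = seq (k ^-1/ d) j
  eq : ∀ a m s → (1ℚ + a * m) * s ≡ s * (m * a + 1ℚ)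
  eq = solve-∀ ringℚ
  absurd : suc r ℕ.* suc s ℕ.≤ M → M ℕ.^ d ℕ.< M ℕ.^ d
  absurd h = ℕ.<-≤-trans (InverseRoot.J-upper k d M) (ℕ.≤-trans (ℕ.*-monoʳ-≤ (suc r ℕ.^ d) (ℕ.<⇒≤ k<[1+s]^d))
    (ℕ.≤-trans (ℕ.≤-reflexive (sym (^-distribʳ-* d (suc r) (suc s)))) (ℕ.^-monoˡ-≤ d h)))

/1≡ι : ∀ n → ℤ.+ n / 1 ≡ ι n
/1≡ι n = trans (sym (*-identityʳ (ℤ.+ n / 1))) (/-*-ι n 0)

k^2≡k*k : ∀ k → k ℕ.^ 2 ≡ k ℕ.* k
k^2≡k*k k = cong (k ℕ.*_) (ℕ.*-identityʳ k)

-- c is replaced by a positive rational 1/q below it, which turns the two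
-- inequalities of the hypothesis into inequalities between natural numbers.
natural-bounds : ∀ c → 0ℝ <ℝ c → ∃[ q ] (∀ k ℓ .{{_ : NonZero k}} →
  c *ℝ fromℚ (ℤ.+ (k ℕ.^ 2) / 1) ≤ℝ fromℚ ((ℤ.+ ℓ / 1) ⊓ ((ℤ.+ (k ℕ.^ 2) / 2) - (ℤ.+ ℓ / 1))) →
  k ℕ.* k ℕ.≤ q ℕ.* ℓ × 2 ℕ.* (k ℕ.* k) ℕ.+ 2 ℕ.* (q ℕ.* ℓ) ℕ.≤ q ℕ.* (k ℕ.* k))
natural-bounds c (δ , 0<δ , N₀ , δ≤c) = q , λ k ℓ hyp → low k ℓ hyp , high k ℓ hyp
  where
  -- Half of δ absorbs the tolerance of `≤ℝ`: as K ≥ 1, δ K ≤ min + η leaves η K ≤ min.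
  η : ℚ
  η = ½ * δ
  0<η : 0ℚ < η
  0<η = positive⁻¹ η {{pos*pos⇒pos ½ δ {{positive 0<δ}}}}
  q : ℕ
  q = proj₁ (archimedean η 0<η)
  1≤qη : 1ℚ ≤ ι q * η
  1≤qη = proj₂ (archimedean η 0<η)
  module _ (k ℓ : ℕ) .{{_ : NonZero k}}
    (hyp : c *ℝ fromℚ (ℤ.+ (k ℕ.^ 2) / 1) ≤ℝ fromℚ ((ℤ.+ ℓ / 1) ⊓ ((ℤ.+ (k ℕ.^ 2) / 2) - (ℤ.+ ℓ / 1)))) where
    open ≤-Reasoning
    min : ℚ
    min = (ℤ.+ ℓ / 1) ⊓ ((ℤ.+ (k ℕ.^ 2) / 2) - (ℤ.+ ℓ / 1))
    K : ℚ
    K = ι (k ℕ.* k)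
    K≡ : ℤ.+ (k ℕ.^ 2) / 1 ≡ K
    K≡ = trans (/1≡ι (k ℕ.^ 2)) (cong ι (k^2≡k*k k))
    1≤K : 1ℚ ≤ K
    1≤K = ι-mono {1} (ℕ.>-nonZero⁻¹ (k ℕ.* k) {{ℕ.m*n≢0 k k}})
    δK≤min+η : δ * K ≤ min + η
    δK≤min+η with N , h ← hyp η 0<η = begin
      δ * K
        ≤⟨ *-monoʳ (0≤ι (k ℕ.* k)) (≤-trans (≤-reflexive (sym (+-identityˡ δ))) (δ≤c (N ℕ.⊔ N₀) (ℕ.m≤n⊔m N N₀))) ⟩
      seq c (N ℕ.⊔ N₀) * K                             ≡⟨ cong (seq c (N ℕ.⊔ N₀) *_) K≡ ⟨
      seq c (N ℕ.⊔ N₀) * (ℤ.+ (k ℕ.^ 2) / 1)           ≤⟨ h (N ℕ.⊔ N₀) (ℕ.m≤m⊔n N N₀) ⟩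
      min + η                                          ∎
    K≤q*min : K ≤ ι q * min
    K≤q*min = begin
      K                              ≡⟨ *-identityˡ K ⟨
      1ℚ * K                         ≤⟨ *-monoʳ (0≤ι (k ℕ.* k)) 1≤qη ⟩
      ι q * η * K                    ≡⟨ *-assoc (ι q) η K ⟩
      ι q * (η * K)
        ≤⟨ *-monoˡ (0≤ι q) (≤-trans (≤-offset (η * (K - 1ℚ)) (0≤* (<⇒≤ 0<η) (0≤q-p 1≤K)) (eq₁ δ K))
                                          (≤-trans (+-monoˡ-≤ (- η) δK≤min+η) (≤-reflexive (eq₂ min η)))) ⟩
      ι q * min                      ∎
      where
      eq₁ : ∀ δ K → δ * K - ½ * δ ≡ ½ * δ * K + ½ * δ * (K - 1ℚ)
      eq₁ = solve-∀ ringℚ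
      eq₂ : ∀ m η → m + η - η ≡ m
      eq₂ = solve-∀ ringℚ
    low : k ℕ.* k ℕ.≤ q ℕ.* ℓ
    low = ι-cancel (begin
      K                     ≤⟨ K≤q*min ⟩
      ι q * min             ≤⟨ *-monoˡ (0≤ι q) (p⊓q≤p _ _) ⟩
      ι q * (ℤ.+ ℓ / 1)     ≡⟨ cong (ι q *_) (/1≡ι ℓ) ⟩
      ι q * ι ℓ             ≡⟨ ι-* q ℓ ⟨
      ι (q ℕ.* ℓ)           ∎)
    high : 2 ℕ.* (k ℕ.* k) ℕ.+ 2 ℕ.* (q ℕ.* ℓ) ℕ.≤ q ℕ.* (k ℕ.* k)
    high = ι-cancel (begin
      ι (2 ℕ.* (k ℕ.* k) ℕ.+ 2 ℕ.* (q ℕ.* ℓ))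
        ≡⟨ trans (ι-+ (2 ℕ.* (k ℕ.* k)) _) (cong₂ _+_ (ι-* 2 (k ℕ.* k)) (trans (ι-* 2 (q ℕ.* ℓ)) (cong (ι 2 *_) (ι-* q ℓ)))) ⟩
      ι 2 * K + ι 2 * (ι q * ι ℓ)
        ≤⟨ +-monoˡ-≤ (ι 2 * (ι q * ι ℓ)) (*-monoˡ (0≤ι 2) K≤q*min) ⟩
      ι 2 * (ι q * min) + ι 2 * (ι q * ι ℓ)
        ≤⟨ +-monoˡ-≤ (ι 2 * (ι q * ι ℓ)) (*-monoˡ (0≤ι 2) (*-monoˡ (0≤ι q) (p⊓q≤q (ℤ.+ ℓ / 1) _))) ⟩
      ι 2 * (ι q * (h - (ℤ.+ ℓ / 1))) + ι 2 * (ι q * ι ℓ)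
                                                     ≡⟨ cong (λ t → ι 2 * (ι q * (h - t)) + ι 2 * (ι q * ι ℓ)) (/1≡ι ℓ) ⟩
      ι 2 * (ι q * (h - ι ℓ)) + ι 2 * (ι q * ι ℓ)    ≡⟨ eq (ι q) h (ι ℓ) ⟩
      ι q * (h * ι 2)
        ≡⟨ cong (ι q *_) (trans (/-*-ι (k ℕ.^ 2) 1) (cong ι (k^2≡k*k k))) ⟩
      ι q * K                                        ≡⟨ ι-* q (k ℕ.* k) ⟨
      ι (q ℕ.* (k ℕ.* k))                            ∎)
      where
      h : ℚ
      h = ℤ.+ (k ℕ.^ 2) / 2
      eq : ∀ q h l → ι 2 * (q * (h - l)) + ι 2 * (q * l) ≡ q * (h * ι 2)
      eq = solve-∀ ringℚ

I-bound : ∀ n s k ℓ q .{{_ : NonZero k}} → 2 ℕ.* (k ℕ.* k) ℕ.≤ n → s ℕ.^ 10 ℕ.≤ k → k ℕ.* k ℕ.≤ q ℕ.* ℓ →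
  2 ℕ.* (k ℕ.* k) ℕ.+ 2 ℕ.* (q ℕ.* ℓ) ℕ.≤ q ℕ.* (k ℕ.* k) → ι s * I n k ℓ ≤ ι (2 ℕ.* (119 ℕ.+ q))
I-bound n s k ℓ q 2k²≤n s¹⁰≤k low high with G , eq ← I-attained n k ℓ =
  subst (λ p → ι s * p ≤ ι (2 ℕ.* (119 ℕ.+ q))) eq (prob-bound G s k ℓ q 2k²≤n s¹⁰≤k low high)

0≤I : ∀ n k ℓ → 0ℚ ≤ I n k ℓ
0≤I n k ℓ with G , eq ← I-attained n k ℓ = subst (0ℚ ≤_) eq (ratio-nonNeg _ (length (kSubsets n k)))

-- As 1 ≤ s, the bound s P ≤ D yields (s + 1) P ≤ 2 D, and `inverseRoot-lower` trades 1/(s + 1) for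
-- the j-th approximation. The error 2D/(j + 1) is at most η once j ≥ 2 t D.
root-bound : ∀ k d .{{_ : NonZero k}} .{{_ : NonZero d}} s D P t η → k ℕ.< suc s ℕ.^ d → 0ℚ ≤ P → ι s * P ≤ ι D → 1 ℕ.≤ s →
  0ℚ ≤ η → 1ℚ ≤ ι t * η → ∀ j → t ℕ.* (2 ℕ.* D) ℕ.≤ j → P ≤ ι (2 ℕ.* D) * seq (k ^-1/ d) j + η
root-bound k d s D P t η k< 0≤P sP≤D 1≤s 0≤η 1≤tη j j-large = *-cancelʳ-≤-pos (ι (suc j)) {{positive (0<ι (suc j))}} (begin
  P * ι (suc j)                               ≤⟨ *-monoˡ 0≤P (inverseRoot-lower k d s k< j) ⟩
  P * (ι (suc s) * (ι (suc j) * a + 1ℚ))      ≡⟨ eq₁ P (ι s) (ι (suc j) * a + 1ℚ) ⟩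
  (P + ι s * P) * (ι (suc j) * a + 1ℚ)
    ≤⟨ *-monoʳ (0≤+ (0≤* (0≤ι (suc j)) 0≤a) 0≤1) (≤-trans (+-monoˡ-≤ (ι s * P) P≤sP)
                                                   (≤-trans (+-mono-≤ sP≤D sP≤D) (≤-reflexive (trans (double (ι D)) (sym (ι-* 2 D)))))) ⟩
  ι (2 ℕ.* D) * (ι (suc j) * a + 1ℚ)          ≡⟨ eq₂ (ι (2 ℕ.* D)) (ι (suc j)) a ⟩
  ι (2 ℕ.* D) * a * ι (suc j) + ι (2 ℕ.* D)   ≤⟨ +-monoʳ-≤ (ι (2 ℕ.* D) * a * ι (suc j)) 2D≤ηj ⟩
  ι (2 ℕ.* D) * a * ι (suc j) + η * ι (suc j) ≡⟨ *-distribʳ-+ (ι (suc j)) (ι (2 ℕ.* D) * a) η ⟨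
  (ι (2 ℕ.* D) * a + η) * ι (suc j)           ∎)
  where
  open ≤-Reasoning
  a : ℚ
  a = seq (k ^-1/ d) j
  0≤a : 0ℚ ≤ a
  0≤a = ratio-nonNeg (InverseRoot.J k d (suc j)) (suc j)
  P≤sP : P ≤ ι s * P
  P≤sP = ≤-trans (≤-reflexive (sym (*-identityˡ P))) (*-monoʳ 0≤P (ι-mono {1} 1≤s))
  double : ∀ x → x + x ≡ ι 2 * x
  double = solve-∀ ringℚ
  eq₁ : ∀ P s z → P * ((1ℚ + s) * z) ≡ (P + s * P) * z
  eq₁ = solve-∀ ringℚ
  eq₂ : ∀ d j a → d * (j * a + 1ℚ) ≡ d * a * j + d
  eq₂ = solve-∀ ringℚ
  2D≤ηj : ι (2 ℕ.* D) ≤ η * ι (suc j)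
  2D≤ηj = begin
    ι (2 ℕ.* D)                   ≡⟨ *-identityˡ _ ⟨
    1ℚ * ι (2 ℕ.* D)              ≤⟨ *-monoʳ (0≤ι (2 ℕ.* D)) 1≤tη ⟩
    ι t * η * ι (2 ℕ.* D)         ≡⟨ eq₃ (ι t) η (ι (2 ℕ.* D)) ⟩
    η * (ι t * ι (2 ℕ.* D))       ≡⟨ cong (η *_) (ι-* t (2 ℕ.* D)) ⟨
    η * ι (t ℕ.* (2 ℕ.* D))       ≤⟨ *-monoˡ 0≤η (ι-mono (ℕ.≤-trans j-large (ℕ.n≤1+n j))) ⟩
    η * ι (suc j)                 ∎
    where
    eq₃ : ∀ t η d → t * η * d ≡ η * (t * d)
    eq₃ = solve-∀ ringℚ

open import Data.Integer.Base using (+_)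
open import Data.Nat.Combinatorics using (_C_)

theorem1p5 : (c : ℝ) → 0ℝ <ℝ c →
    Σ[ K ∈ ℝ ] (0ℝ <ℝ K ×
    ((k ℓ : ℕ) .{{_ : NonZero k}} .{{_ : NonZero ℓ}} →
    ℓ ℕ.≤ k C 2 →
    c *ℝ fromℚ (+ (k ℕ.^ 2) / 1) ≤ℝ fromℚ ((+ ℓ / 1) ⊓ ((+ (k ℕ.^ 2) / 2) - (+ ℓ / 1))) →
    (ind : ℝ) → ind IsIndOf (k , ℓ) →
    ind ≤ℝ K *ℝ (k ^-1/ 10)))
theorem1p5 c 0<c =
  -- The factor 2 inside `D` is the cost of passing from subsets to tuples, the one outside that of
  -- replacing s by s + 1.
  fromℚ (ι (2 ℕ.* D)) , (1ℚ , positive⁻¹ 1ℚ , 0 , λ _ _ → ι-mono {1} {2 ℕ.* D} (ℕ.s≤s ℕ.z≤n)) , bound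
  where
  q D : ℕ
  q = proj₁ (natural-bounds c 0<c)
  D = 2 ℕ.* (119 ℕ.+ q)
  bound : (k ℓ : ℕ) .{{_ : NonZero k}} .{{_ : NonZero ℓ}} → ℓ ℕ.≤ k C 2 →
    c *ℝ fromℚ (+ (k ℕ.^ 2) / 1) ≤ℝ fromℚ ((+ ℓ / 1) ⊓ ((+ (k ℕ.^ 2) / 2) - (+ ℓ / 1))) →
    (ind : ℝ) → ind IsIndOf (k , ℓ) → ind ≤ℝ fromℚ (ι (2 ℕ.* D)) *ℝ (k ^-1/ 10)
  bound k ℓ _ hyp ind lim ε 0<ε =
    let low , high = proj₂ (natural-bounds c 0<c) k ℓ hyp
        s , s¹⁰≤k , k<[1+s]¹⁰ = integerRoot 10 k
        -- One third each for the limit, for the order of reals inside the limit, and for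
        -- `root-bound`.
        η = (+ 1 / 3) * ε
        0<η = positive⁻¹ η {{pos*pos⇒pos (+ 1 / 3) ε {{positive 0<ε}}}}
        t , 1≤tη = archimedean η 0<η
        N₁ , near = lim η 0<η
        n = N₁ ℕ.⊔ 2 ℕ.* (k ℕ.* k)
        N₂ , near′ = proj₂ (near n (ℕ.m≤m⊔n N₁ _)) η 0<η
        1≤s = ℕ.≮⇒≥ λ s<1 → ℕ.<⇒≱ (subst (λ s → k ℕ.< suc s ℕ.^ 10) (ℕ.n<1⇒n≡0 s<1) k<[1+s]¹⁰) (ℕ.>-nonZero⁻¹ k)
    in N₂ ℕ.⊔ t ℕ.* (2 ℕ.* D) , λ j N≤j → let open ≤-Reasoning in begin
      seq ind j                                            ≤⟨ near′ j (ℕ.m⊔n≤o⇒m≤o N₂ _ N≤j) ⟩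
      I n k ℓ + η + η
        ≤⟨ +-monoˡ-≤ η (+-monoˡ-≤ η (root-bound k 10 s D (I n k ℓ) t η k<[1+s]¹⁰ (0≤I n k ℓ)
                                                                (I-bound n s k ℓ q (ℕ.m≤n⊔m N₁ _) s¹⁰≤k low high) 1≤s (<⇒≤ 0<η) 1≤tη j
                                                                (ℕ.m⊔n≤o⇒n≤o N₂ _ N≤j))) ⟩
      ι (2 ℕ.* D) * seq (k ^-1/ 10) j + η + η + η          ≡⟨ thirds (ι (2 ℕ.* D) * seq (k ^-1/ 10) j) ε ⟩
      ι (2 ℕ.* D) * seq (k ^-1/ 10) j + ε                  ∎
    where
    thirds : ∀ x ε → x + (+ 1 / 3) * ε + (+ 1 / 3) * ε + (+ 1 / 3) * ε ≡ x + ε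
    thirds = solve-∀ ringℚ
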